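{- For all $n\ge 0$, $g\ge 0$, $v,f\ge 1$: $$C_g(n)=\mathrm{Cat}(n)\,B_g(n+1),\qquad C^{v,f}(n)=\mathrm{Cat}(n)\,B^{v,f}(n+1),$$ where $\mathrm{Cat}(n)=\frac{1}{n+1}\binom{2n}{n}$.
   Context: Maps are rooted combinatorial maps $M=(H,\sigma,\alpha)$ ($H$ finite set of half-edges, $\alpha$ fixed-point-free involution, $\sigma$ a permutation, $\langle\sigma,\alpha\rangle$ transitive, a root $r\in H$), counted up to root-preserving isomorphism; vertices, edges, faces are the cycles of $\sigma$, $\alpha$, $\sigma\alpha$ (composition right to left), genus $g$ satisfies $v-e+f=2-2g$. A unicellular map has one face; the map with $H=\emptyset$ counts as unicellular (one vertex). For $S\subseteq H$, $\pi_{|S}$ denotes the permutation of $S$ obtained by deleting from the cycles of $\pi$ the elements not in $S$. A covered map is a pair $(M,S)$ with $S\subseteq H$ stable under $\alpha$ such that $(S,\sigma_{|S},\alpha_{|S})$ is a connecting unicellular map ($\sigma_{|S},\alpha_{|S}$ transitive on $S$, $S$ meets every cycle of $\sigma$ — except $S=\emptyset$ allowed when $M$ has one vertex — and $\sigma_{|S}\alpha_{|S}$ cyclic). $C_g(n)$ is the number of covered maps of genus $g$ with $n$ edges; $C^{v,f}(n)$ the number of covered maps with $n$ edges, $v$ vertices and $f$ faces. $B_g(n)$ is the number of bipartite unicellular maps of genus $g$ with $n$ edges; $B^{v,f}(n)$ the number of bipartite unicellular maps with $n$ edges having $v$ white and $f$ black vertices, for the proper 2-coloring in which the root-vertex is white.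 -}

module Defs where

open import Level using (0ℓ)
open import Data.Nat using (ℕ; zero; suc; _*_; _/_)
open import Data.Nat.Combinatorics using (_C_)
import Data.Integer as ℤ
open import Data.Integer using (ℤ; +_)
open import Data.Fin using (Fin)
open import Data.Fin.Permutation as Perm
  using (Permutation; Permutation′; _⟨$⟩ʳ_; _⟨$⟩ˡ_; _∘ₚ_)
open import Data.Fin.Subset using (Subset; _∈_; _∉_; ⊥)
open import Data.Product using (Σ; ∃; _×_; _,_; proj₁; proj₂)
open import Data.Sum using (_⊎_)
open import Data.Unit using (⊤; tt)
open import Function using (_on_; _∘_; _⇔_; mk⇔; Equivalence)
open import Function.Bundles using (Func; Inverse)
open import Relation.Binary using (Rel; Setoid; IsEquivalence)
open import Relation.Binary.Construct.Closure.Equivalence as EqC using (EqClosure)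
import Relation.Binary.Construct.On as On
open import Relation.Binary.Construct.Union using (_∪_)
open import Relation.Binary.PropositionalEquality as ≡
  using (_≡_; _≢_; refl; sym; trans; cong; subst)

-- k is the number of equivalence classes of S.
HasSize : Setoid 0ℓ 0ℓ → ℕ → Set
HasSize S k = Inverse S (≡.setoid (Fin k))

Restrict : (S : Setoid 0ℓ 0ℓ) → (Setoid.Carrier S → Set) → Setoid 0ℓ 0ℓ
Restrict S P = On.setoid {B = Σ (Setoid.Carrier S) P} S proj₁

Connected : {A : Set} → Rel A 0ℓ → Set
Connected R = ∀ x y → EqClosure R x y

Graph : ∀ {m} → Permutation′ m → Rel (Fin m) 0ℓ
Graph π x y = π ⟨$⟩ʳ x ≡ y

-- The classes are the orbits of the group generated by π, fixed points included.
cycles : ∀ {m} → Permutation′ m → Setoid 0ℓ 0ℓ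
cycles π = EqC.setoid (Graph π)

-- Half-edges, except that the map with H = ∅ is given a single corner: it has
-- one vertex and one face although its permutations have no cycle.
Corner : ℕ → Set
Corner zero    = ⊤
Corner (suc m) = Fin (suc m)

corner : ∀ {m} → Fin m → Corner m
corner {suc m} h = h

-- The cycles of π, or a single class when there is no half-edge.
cells : ∀ {m} → Permutation′ m → Setoid 0ℓ 0ℓ
cells {zero}  π = ≡.setoid ⊤
cells {suc m} π = cycles π

cellAt : ∀ {m} (π : Permutation′ m) → Corner m → Setoid.Carrier (cells π)
cellAt {zero}  π c = c
cellAt {suc m} π c = c

-- H = Fin size, which loses nothing since maps are counted up to isomorphism.
record RootedMap : Set where
  field
    size         : ℕ
    σ α          : Permutation′ size
    α-involutive : ∀ h → α ⟨$⟩ʳ (α ⟨$⟩ʳ h) ≡ h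
    α-fixfree    : ∀ h → α ⟨$⟩ʳ h ≢ h
    transitive   : Connected (Graph σ ∪ Graph α)
    root         : Corner size

  vertices edges faces : Setoid 0ℓ 0ℓ
  vertices = cells σ
  edges    = cycles α
  faces    = cells (α ∘ₚ σ)  -- _∘ₚ_ is diagrammatic: this is h ↦ σ (α h)

  vertexOf : Fin size → Setoid.Carrier vertices
  vertexOf h = cellAt σ (corner h)

  rootVertex : Setoid.Carrier vertices
  rootVertex = cellAt σ root

open RootedMap

HasGenus : RootedMap → ℕ → Set
HasGenus M g = ∃ λ v → ∃ λ e → ∃ λ f →
  HasSize (vertices M) v × HasSize (edges M) e × HasSize (faces M) f ×
  + v ℤ.- + e ℤ.+ + f ≡ + 2 ℤ.- + 2 ℤ.* + g

Unicellular : RootedMap → Set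
Unicellular M = HasSize (faces M) 1

record _≅_ (M N : RootedMap) : Set where
  field
    φ      : Permutation (size M) (size N)
    φ-σ    : ∀ h → φ ⟨$⟩ʳ (σ M ⟨$⟩ʳ h) ≡ σ N ⟨$⟩ʳ (φ ⟨$⟩ʳ h)
    φ-α    : ∀ h → φ ⟨$⟩ʳ (α M ⟨$⟩ʳ h) ≡ α N ⟨$⟩ʳ (φ ⟨$⟩ʳ h)
    -- Vacuous when H = ∅.
    φ-root : ∀ h → corner h ≡ root M ⇔ corner (φ ⟨$⟩ʳ h) ≡ root N

open _≅_

≅-refl : ∀ {M} → M ≅ M
≅-refl = record
  { φ = Perm.id ; φ-σ = λ _ → refl ; φ-α = λ _ → refl
  ; φ-root = λ _ → mk⇔ (λ p → p) (λ p → p) }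

private
  flip-commute : ∀ {m n} (φ : Permutation m n) (π : Permutation′ m) (ρ : Permutation′ n) →
    (∀ h → φ ⟨$⟩ʳ (π ⟨$⟩ʳ h) ≡ ρ ⟨$⟩ʳ (φ ⟨$⟩ʳ h)) →
    ∀ h → φ ⟨$⟩ˡ (ρ ⟨$⟩ʳ h) ≡ π ⟨$⟩ʳ (φ ⟨$⟩ˡ h)
  flip-commute φ π ρ eq h =
    trans (cong (λ x → φ ⟨$⟩ˡ (ρ ⟨$⟩ʳ x)) (sym (Perm.inverseʳ φ)))
      (trans (cong (φ ⟨$⟩ˡ_) (sym (eq (φ ⟨$⟩ˡ h)))) (Perm.inverseˡ φ))

  flip-⇔ : ∀ {m n} (φ : Permutation m n) {P : Fin m → Set} {Q : Fin n → Set} →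
    (∀ h → P h ⇔ Q (φ ⟨$⟩ʳ h)) → ∀ h → Q h ⇔ P (φ ⟨$⟩ˡ h)
  flip-⇔ φ {Q = Q} eq h = mk⇔
    (λ q → Equivalence.from (eq _) (subst Q (sym (Perm.inverseʳ φ)) q))
    (λ p → subst Q (Perm.inverseʳ φ) (Equivalence.to (eq _) p))

  trans-⇔ : {A B C : Set} → A ⇔ B → B ⇔ C → A ⇔ C
  trans-⇔ p q = mk⇔ (Equivalence.to q ∘ Equivalence.to p)
                    (Equivalence.from p ∘ Equivalence.from q)

≅-sym : ∀ {M N} → M ≅ N → N ≅ M
≅-sym {M} {N} i = record
  { φ      = Perm.flip (φ i)
  ; φ-σ    = flip-commute (φ i) (σ M) (σ N) (φ-σ i)
  ; φ-α    = flip-commute (φ i) (α M) (α N) (φ-α i)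
  ; φ-root = flip-⇔ (φ i) {λ h → corner h ≡ root M} {λ h → corner h ≡ root N} (φ-root i)
  }

≅-trans : ∀ {M N O} → M ≅ N → N ≅ O → M ≅ O
≅-trans i j = record
  { φ      = φ i ∘ₚ φ j
  ; φ-σ    = λ h → trans (cong (φ j ⟨$⟩ʳ_) (φ-σ i h)) (φ-σ j _)
  ; φ-α    = λ h → trans (cong (φ j ⟨$⟩ʳ_) (φ-α i h)) (φ-α j _)
  ; φ-root = λ h → trans-⇔ (φ-root i h) (φ-root j _)
  }

maps : Setoid 0ℓ 0ℓ
maps = record
  { Carrier = RootedMap ; _≈_ = _≅_
  ; isEquivalence = record { refl = ≅-refl ; sym = ≅-sym ; trans = ≅-trans } }

⟨_⟩ : ∀ {m} → Subset m → Set
⟨ S ⟩ = ∃ (_∈ S)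

-- FirstReturn π S x y: y is the first of π x, π² x, … that lies in S.
data FirstReturn {m} (π : Permutation′ m) (S : Subset m) : Rel (Fin m) 0ℓ where
  stop : ∀ {x} → (π ⟨$⟩ʳ x) ∈ S → FirstReturn π S x (π ⟨$⟩ʳ x)
  skip : ∀ {x y} → (π ⟨$⟩ʳ x) ∉ S → FirstReturn π S (π ⟨$⟩ʳ x) y → FirstReturn π S x y

-- The graph of the restricted permutation of S: deleting the elements outside S
-- from the cycles of π sends x to its first return to S.
_↾_ : ∀ {m} → Permutation′ m → (S : Subset m) → Rel ⟨ S ⟩ 0ℓ
π ↾ S = FirstReturn π S on proj₁

record Covers (M : RootedMap) (S : Subset (size M)) : Set where
  field
    α-stable    : ∀ h → h ∈ S → (α M ⟨$⟩ʳ h) ∈ S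
    transitiveₛ : Connected ((σ M ↾ S) ∪ (α M ↾ S))
    connecting  : (∀ h → ∃ λ s → s ∈ S × EqClosure (Graph (σ M)) h s)
                ⊎ (S ≡ ⊥ × HasSize (vertices M) 1)
    unicellular : Connected λ x y → ∃ λ z → (α M ↾ S) x z × (σ M ↾ S) z y

record CoveredMap : Set where
  field
    map    : RootedMap
    sub    : Subset (size map)
    covers : Covers map sub

open CoveredMap using (map; sub)

record _≅ᶜ_ (A B : CoveredMap) : Set where
  field
    iso   : map A ≅ map B
    φ-sub : ∀ h → h ∈ sub A ⇔ (φ iso ⟨$⟩ʳ h) ∈ sub B

open _≅ᶜ_

≅ᶜ-isEquivalence : IsEquivalence _≅ᶜ_
≅ᶜ-isEquivalence = record
  { refl  = record { iso = ≅-refl ; φ-sub = λ _ → mk⇔ (λ p → p) (λ p → p) }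
  ; sym   = λ {A} {B} i → record
      { iso = ≅-sym (iso i)
      ; φ-sub = flip-⇔ (φ (iso i)) {_∈ sub A} {_∈ sub B} (φ-sub i) }
  ; trans = λ i j → record
      { iso = ≅-trans (iso i) (iso j) ; φ-sub = λ h → trans-⇔ (φ-sub i h) (φ-sub j _) }
  }

coveredMaps : Setoid 0ℓ 0ℓ
coveredMaps = record { Carrier = CoveredMap ; _≈_ = _≅ᶜ_ ; isEquivalence = ≅ᶜ-isEquivalence }

data Colour : Set where
  white black : Colour

record ProperColouring (M : RootedMap) : Set where
  field
    colouring : Func (vertices M) (≡.setoid Colour)

  colour : Setoid.Carrier (vertices M) → Colour
  colour = Func.to colouring

  field
    proper : ∀ h → colour (vertexOf M h) ≢ colour (vertexOf M (α M ⟨$⟩ʳ h))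

  verticesOfColour : Colour → Setoid 0ℓ 0ℓ
  verticesOfColour c = Restrict (vertices M) (λ x → colour x ≡ c)

open ProperColouring

-- Each of the four families is a setoid under root-preserving isomorphism; its
-- number of classes (HasSize) is C_g(n), C^{v,f}(n), B_g(n), B^{v,f}(n) respectively.

coveredOfGenus : (g n : ℕ) → Setoid 0ℓ 0ℓ
coveredOfGenus g n = Restrict coveredMaps λ A →
  HasGenus (map A) g × HasSize (edges (map A)) n

coveredByCells : (v f n : ℕ) → Setoid 0ℓ 0ℓ
coveredByCells v f n = Restrict coveredMaps λ A →
  HasSize (edges (map A)) n × HasSize (vertices (map A)) v × HasSize (faces (map A)) f

bipartiteOfGenus : (g n : ℕ) → Setoid 0ℓ 0ℓ
bipartiteOfGenus g n = Restrict maps λ M →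
  ProperColouring M × Unicellular M × HasGenus M g × HasSize (edges M) n

bipartiteByColours : (v f n : ℕ) → Setoid 0ℓ 0ℓ
bipartiteByColours v f n = Restrict maps λ M →
  Unicellular M × HasSize (edges M) n ×
  Σ (ProperColouring M) λ c →
    colour c (rootVertex M) ≡ white ×
    HasSize (verticesOfColour c white) v × HasSize (verticesOfColour c black) f

-- The division is exact.
Cat : ℕ → ℕ
Cat n = ((2 * n) C n) / suc n

{-# OPTIONS --safe #-}

-- Adding a leg at the root turns a covered map (M, S) into permutations σ, α of one more element,
-- α fixing only the leg, and S is a connecting unicellular submap exactly when the motion θ, which
-- is σ ∘ α on S and σ off S, is cyclic. Orient every edge by comparing the times at which θ visits
-- its two half-edges, in opposite ways for edges in S and off S. Cutting each vertex after its
-- half-edges that are not outgoing then leaves n + 1 pieces joined by the n edges into a plane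
-- tree, and the pieces are glued back by a permutation π of the n + 1 vertices of that tree.
-- Conversely, from a tree and any π, the motion is recovered by exploring the map from the leg,
-- letting an edge belong to S when it is first met at its outgoing half-edge. The vertices of M
-- are the cycles of π; its faces are the cycles of ζ π, where ζ is the cyclic order of the tree
-- along its contour. Bipartite unicellular maps with n + 1 edges are likewise coded by a single
-- permutation π, with the cycles of π and of ζ π as white and black vertices. So covered maps
-- correspond to pairs (plane tree with n edges, bipartite unicellular map with n + 1 edges).
module Submission where

open import Defs
open import Level using (0ℓ)
open import Data.Bool using (Bool; true; false; if_then_else_; not; _xor_)
import Data.Bool.Properties as Boolₚ
open import Data.Nat using (ℕ; zero; suc; _+_; _*_; _∸_; _^_; _/_; _%_; _≤_; _<_; z≤n; s≤s; _<?_; _⊔_)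
import Data.Nat.Properties as ℕₚ
open import Data.Nat.Combinatorics using (_C_; nCk+nC[k+1]≡[n+1]C[k+1]; nCk≡nC[n∸k]; nC1≡n)
open import Data.Nat.DivMod using (m≡m%n+[m/n]*n; m%n<n; m*n/n≡m)
open import Data.Nat.GeneralisedArithmetic using (fold; fold-+)
open import Data.Nat.Tactic.RingSolver using (solve-∀)
import Data.Integer as ℤ
import Data.Integer.Properties as ℤₚ
open import Data.Integer.Tactic.RingSolver using () renaming (solve-∀ to ℤ-solve-∀)
open import Data.Fin using (Fin; zero; suc; toℕ; fromℕ<; inject₁; punchOut; _↑ˡ_; _↑ʳ_; splitAt; finToFun; funToFin)
import Data.Fin.Properties as Finₚ
import Data.Fin.Permutation as Perm
import Data.Fin.Permutation.Components as PC
open import Data.Fin.Permutation using (Permutation; Permutation′; _⟨$⟩ʳ_; _⟨$⟩ˡ_; _∘ₚ_; lift₀; transpose)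
open import Data.Fin.Subset using (Subset; _∈_; _∉_)
import Data.Fin.Subset.Properties as Subsetₚ
open import Data.Vec using (Vec; []; _∷_; lookup; tabulate)
import Data.Vec.Properties as Vecₚ
import Data.Vec.Properties.WithK as Vecᴷ
open import Data.Maybe using (Maybe; just; nothing)
open import Data.Product using (Σ; ∃; ∃₂; _×_; _,_; proj₁; proj₂)
open import Data.Product.Function.NonDependent.Propositional using (_×-↔_)
open import Data.Sum using (_⊎_; inj₁; inj₂; [_,_])
open import Data.Sum.Function.Propositional using (_⊎-↔_)
open import Data.Empty using (⊥; ⊥-elim)
open import Data.Unit using (tt)
open import Function using (_∘_; _↔_; mk↔ₛ′; Inverse; _⇔_; mk⇔; Equivalence)
open import Function.Bundles using (Func; Injection)
open import Function.Construct.Composition using (_↔-∘_; inverse)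
open import Function.Construct.Identity using (↔-id)
open import Function.Construct.Symmetry using (↔-sym) renaming (inverse to invSym)
open import Function.Properties.Inverse using (↔⇒↣)
open import Relation.Binary using (Rel; Setoid; IsEquivalence; Decidable; tri<; tri≈; tri>)
import Relation.Binary.Construct.On as On
open import Relation.Binary.Construct.Closure.Equivalence as EqC using (EqClosure)
open import Relation.Binary.Construct.Union using (_∪_)
open import Relation.Binary.PropositionalEquality as ≡
  using (_≡_; _≢_; refl; sym; trans; cong; cong₂; subst)
open import Relation.Nullary using (¬_; Dec; yes; no; contradiction; does)
open import Relation.Nullary.Decidable using (dec-true; dec-false; _⊎-dec_; _×-dec_; _→-dec_)

-- Why two opposite conventions orient the edges: in both cases `θ` leads from the half-edge of an
-- edge that is visited later to `σ x`, where `x` is the outgoing half-edge of that edge. So `σ x`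
-- is always visited after `x` and after `α x`, the leg counting as last. This inequality makes the
-- pieces a tree; conversely, every orientation admitting such a decreasing rank arises from exactly
-- one submap. A plane tree has such a rank of its own, and it involves `σ` only at outgoing
-- half-edges, which the gluing leaves alone. Hence every `π` is allowed. The number n + 1: of the
-- 2n + 1 half-edges, leg included, n are outgoing, and each of the other n + 1 is the end of one
-- piece. Only the number of trees is evaluated. The number `b` of permutations with the required
-- cycle counts stays unknown, but is common to both families. The genus needs no bijection of its
-- own: v + f vertices, n + 1 edges and one face have the same Euler characteristic as v vertices, n
-- edges and f faces.

module S = Setoid

-- Sizes of setoids and orbits of permutations

mkInverse : {S T : Setoid 0ℓ 0ℓ} (f : S.Carrier S → S.Carrier T) (g : S.Carrier T → S.Carrier S) →
  (∀ {x y} → S._≈_ S x y → S._≈_ T (f x) (f y)) →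
  (∀ {x y} → S._≈_ T x y → S._≈_ S (g x) (g y)) →
  (∀ y → S._≈_ T (f (g y)) y) → (∀ x → S._≈_ S (g (f x)) x) → Inverse S T
mkInverse {S} {T} f g fc gc fg gf = record
  { to = f ; from = g ; to-cong = fc ; from-cong = gc
  ; inverse = (λ {x} {y} p → S.trans T (fc p) (fg x)) , (λ {x} {y} p → S.trans S (gc p) (gf x)) }

hasSize-resp : {S T : Setoid 0ℓ 0ℓ} {k : ℕ} → Inverse S T → HasSize T k → HasSize S k
hasSize-resp = inverse

hasSize-unique : {S : Setoid 0ℓ 0ℓ} {j k : ℕ} → HasSize S j → HasSize S k → j ≡ k
hasSize-unique p q = Perm.↔⇒≡ (inverse (invSym p) q)

-- `R s c` reads "the object `s` has the code `c`". With a relation, coding a given object and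
-- constructing an object for a given code become separate tasks, and well-definedness and
-- injectivity are the two uniqueness conditions.
hasSize-via : {S T : Setoid 0ℓ 0ℓ} {k : ℕ} (R : S.Carrier S → S.Carrier T → Set) →
  (∀ s → ∃ (R s)) → (∀ c → ∃ λ s → R s c) →
  (∀ {s s′ c c′} → R s c → R s′ c′ → S._≈_ S s s′ → S._≈_ T c c′) →
  (∀ {s s′ c c′} → R s c → R s′ c′ → S._≈_ T c c′ → S._≈_ S s s′) →
  HasSize T k → HasSize S k
hasSize-via {S} {T} R l r ul ur = hasSize-resp (mkInverse {S} {T}
  (proj₁ ∘ l) (proj₁ ∘ r)
  (λ {x} {y} → ul (proj₂ (l x)) (proj₂ (l y)))
  (λ {x} {y} → ur (proj₂ (r x)) (proj₂ (r y)))
  (λ c → ul (proj₂ (l (proj₁ (r c)))) (proj₂ (r c)) (S.refl S))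
  (λ s → ur (proj₂ (r (proj₁ (l s)))) (proj₂ (l s)) (S.refl T)))

size-one : {S : Setoid 0ℓ 0ℓ} → S.Carrier S → (∀ x y → S._≈_ S x y) → HasSize S 1
size-one {S} a all = mkInverse {S} {≡.setoid (Fin 1)} (λ _ → zero) (λ _ → a)
  (λ _ → refl) (λ _ → S.refl S) (λ { zero → refl }) (all a)

size-one⁻¹ : {S : Setoid 0ℓ 0ℓ} → HasSize S 1 → ∀ x y → S._≈_ S x y
size-one⁻¹ {S} i x y =
  S.trans S (S.sym S (Inverse.strictlyInverseʳ i x))
    (S.trans S (Inverse.from-cong i (fin1 _ _)) (Inverse.strictlyInverseʳ i y))
  where
  fin1 : (a b : Fin 1) → a ≡ b
  fin1 zero zero = refl

occurs? : (S : Setoid 0ℓ 0ℓ) → Decidable (S._≈_ S) → ∀ a (m : Maybe (S.Carrier S)) →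
  Dec (∃ λ x → m ≡ just x × S._≈_ S x a)
occurs? S _≟_ a nothing = no λ { (_ , () , _) }
occurs? S _≟_ a (just x) with x ≟ a
... | yes p = yes (x , refl , p)
... | no ¬p = no λ { (_ , refl , p) → ¬p p }

-- The enumeration may repeat classes and may have gaps. Its first entry `a` is dropped if a later
-- one is equivalent to it. Otherwise the class of `a` receives number zero and all later entries
-- lie in the setoid `T` of the elements not equivalent to `a`, to which the induction applies.
enumerable⇒hasSize : (M : ℕ) (S : Setoid 0ℓ 0ℓ) → Decidable (S._≈_ S) →
  (e : Fin M → Maybe (S.Carrier S)) →
  (∀ s → ∃₂ λ i x → e i ≡ just x × S._≈_ S x s) →
  ∃ (HasSize S)
enumerable⇒hasSize zero S _≟_ e cov = 0 , mkInverse {S} {≡.setoid (Fin 0)}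
  (absurd ∘ cov) (λ ()) (λ {x} _ → ⊥-elim (absurd′ (cov x))) (λ {x} _ → ⊥-elim (absurd″ x)) (λ ())
  (λ x → ⊥-elim (absurd′ (cov x)))
  where
  absurd : ∀ {P : Fin 0 → Set} → Σ (Fin 0) P → Fin 0
  absurd (() , _)
  absurd′ : ∀ {P : Fin 0 → Set} → Σ (Fin 0) P → ⊥
  absurd′ (() , _)
  absurd″ : Fin 0 → ⊥
  absurd″ ()
enumerable⇒hasSize (suc M) S _≟_ e cov with e zero in eq
... | nothing = enumerable⇒hasSize M S _≟_ (e ∘ suc) cov′
  where
  cov′ : ∀ s → ∃₂ λ i x → e (suc i) ≡ just x × S._≈_ S x s
  cov′ s with cov s
  ... | zero , x , p , _ with () ← trans (sym eq) p
  ... | suc i , x , p , q = i , x , p , q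
... | just a with Finₚ.any? (λ i → occurs? S _≟_ a (e (suc i)))
... | yes (i , y , p , q) = enumerable⇒hasSize M S _≟_ (e ∘ suc) cov′
  where
  cov′ : ∀ s → ∃₂ λ i x → e (suc i) ≡ just x × S._≈_ S x s
  cov′ s with cov s
  ... | suc j , x , u , v = j , x , u , v
  ... | zero , x , u , v with refl ← trans (sym eq) u = i , y , p , S.trans S q v
... | no ¬rep = suc (proj₁ rest) , mkInverse {S} {≡.setoid (Fin (suc (proj₁ rest)))} f g f-cong
    (λ { refl → S.refl S }) fg gf
  where
  T : Setoid 0ℓ 0ℓ
  T = Restrict S (λ x → ¬ S._≈_ S x a)
  restrict : ∀ i m → e (suc i) ≡ m → Maybe (S.Carrier T)
  restrict i nothing p = nothing
  restrict i (just x) p = just (x , λ q → ¬rep (i , x , p , q))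
  e′ : Fin M → Maybe (S.Carrier T)
  e′ i = restrict i (e (suc i)) refl
  cov′ : ∀ s → ∃₂ λ i x → e′ i ≡ just x × S._≈_ T x s
  cov′ (s , s≉a) with cov s
  ... | zero , x , u , v with refl ← trans (sym eq) u = ⊥-elim (s≉a (S.sym S v))
  ... | suc j , x , u , v = j , restrict-just (e (suc j)) refl u
    where
    restrict-just : ∀ m (p : e (suc j) ≡ m) → m ≡ just x →
      ∃ λ y → restrict j m p ≡ just y × S._≈_ T y (s , s≉a)
    restrict-just (just _) p refl = _ , refl , v
  rest : ∃ (HasSize T)
  rest = enumerable⇒hasSize M T (λ x y → proj₁ x ≟ proj₁ y) e′ cov′
  open Inverse (proj₂ rest)
  f′ : ∀ x → Dec (S._≈_ S x a) → Fin (suc (proj₁ rest))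
  f′ x (yes _) = zero
  f′ x (no p) = suc (to (x , p))
  f = λ x → f′ x (x ≟ a)
  g : Fin (suc (proj₁ rest)) → S.Carrier S
  g zero = a
  g (suc i) = proj₁ (from i)
  f-cong : ∀ {x y} → S._≈_ S x y → f x ≡ f y
  f-cong {x} {y} p with x ≟ a | y ≟ a
  ... | yes _ | yes _ = refl
  ... | yes q | no ¬q = ⊥-elim (¬q (S.trans S (S.sym S p) q))
  ... | no ¬q | yes q = ⊥-elim (¬q (S.trans S p q))
  ... | no _ | no _ = cong suc (to-cong p)
  fg : ∀ y → f (g y) ≡ y
  fg zero with a ≟ a
  ... | yes _ = refl
  ... | no ¬q = ⊥-elim (¬q (S.refl S))
  fg (suc i) with proj₁ (from i) ≟ a
  ... | yes q = ⊥-elim (proj₂ (from i) q)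
  ... | no ¬q = cong suc (trans (to-cong {_ , ¬q} {from i} (S.refl S)) (strictlyInverseˡ i))
  gf : ∀ x → S._≈_ S (g (f x)) x
  gf x with x ≟ a
  ... | yes p = S.sym S p
  ... | no p = strictlyInverseʳ (x , p)

Step : {A : Set} → (A → A) → Rel A 0ℓ
Step f x y = f x ≡ y

EqC-isEquivalence : {A : Set} {R : Rel A 0ℓ} → IsEquivalence (EqClosure R)
EqC-isEquivalence {R = R} = EqC.isEquivalence R

step : {A : Set} {f : A → A} (x : A) → EqClosure (Step f) x (f x)
step x = EqC.return refl

~sym : {A : Set} {R : Rel A 0ℓ} {x y : A} → EqClosure R x y → EqClosure R y x
~sym {R = R} = EqC.symmetric R

~trans : {A : Set} {R : Rel A 0ℓ} {x y z : A} → EqClosure R x y → EqClosure R y z → EqClosure R x z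
~trans {R = R} = EqC.transitive R

~refl : {A : Set} {R : Rel A 0ℓ} {x : A} → EqClosure R x x
~refl {R = R} = EqC.reflexive R

≡⇒~ : {A : Set} {R : Rel A 0ℓ} {x y : A} → x ≡ y → EqClosure R x y
≡⇒~ refl = ~refl

fold-suc : {A : Set} (f : A → A) (x : A) (k : ℕ) → fold (f x) f k ≡ f (fold x f k)
fold-suc f x zero = refl
fold-suc f x (suc k) = cong f (fold-suc f x k)

fold~ : {A : Set} (f : A → A) (x : A) (k : ℕ) → EqClosure (Step f) x (fold x f k)
fold~ f x zero = ~refl
fold~ f x (suc k) = ~trans (fold~ f x k) (step _)

Injects : {A B : Set} → (A → B) → Set
Injects f = ∀ {x y} → f x ≡ f y → x ≡ y

fold-injects : {A : Set} {f : A → A} → Injects f → ∀ k {x y} → fold x f k ≡ fold y f k → x ≡ y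
fold-injects inj zero p = p
fold-injects inj (suc k) p = fold-injects inj k (inj p)

module Orbit {m : ℕ} (f : Fin m → Fin m) (inj : Injects f) where

  -- Two of the first m + 1 iterates coincide, and injectivity cancels the common initial segment,
  -- so the orbit closes up at `x` itself.
  period : ∀ x → ∃ λ p → suc p ≤ m × fold x f (suc p) ≡ x
  period x with Finₚ.pigeonhole (ℕₚ.n<1+n m) (λ i → fold x f (toℕ i))
  ... | i , j , i<j , eq = toℕ j ∸ suc (toℕ i) , ≤m , fold-injects inj (toℕ i) (begin
      fold (fold x f (suc k)) f (toℕ i)  ≡⟨ fold-+ x f (toℕ i) ⟨
      fold x f (toℕ i + suc k)           ≡⟨ cong (fold x f) i+k ⟩
      fold x f (toℕ j)                   ≡⟨ eq ⟨
      fold x f (toℕ i)                   ∎)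
    where
    open ≡.≡-Reasoning
    k = toℕ j ∸ suc (toℕ i)
    i+k : toℕ i + suc k ≡ toℕ j
    i+k = trans (ℕₚ.+-suc (toℕ i) k) (ℕₚ.m+[n∸m]≡n i<j)
    ≤m : suc k ≤ m
    ≤m = ℕₚ.≤-trans (ℕₚ.m≤n+m (suc k) (toℕ i))
           (ℕₚ.≤-trans (ℕₚ.≤-reflexive i+k) (ℕₚ.≤-pred (Finₚ.toℕ<n j)))

  Reaches : Rel (Fin m) 0ℓ
  Reaches x y = ∃ λ k → fold x f k ≡ y

  reaches-trans : ∀ {x y z} → Reaches x y → Reaches y z → Reaches x z
  reaches-trans {x} (k , refl) (l , q) = l + k , trans (fold-+ x f l) q

  reaches-sym : ∀ {x y} → Reaches x y → Reaches y x
  reaches-sym {x} (zero , refl) = 0 , refl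
  reaches-sym {x} (suc k , refl) = reaches-trans back (reaches-sym (k , refl))
    where
    back : Reaches (f (fold x f k)) (fold x f k)
    back with period (fold x f k)
    ... | p , _ , eq = p , trans (fold-suc f _ p) eq

  ~⇒reaches : ∀ {x y} → EqClosure (Step f) x y → Reaches x y
  ~⇒reaches = EqC.fold (record { refl = 0 , refl ; sym = reaches-sym ; trans = reaches-trans })
    (λ p → 1 , p)

  fold-multiple : ∀ x p q → fold x f p ≡ x → fold x f (q * p) ≡ x
  fold-multiple x p zero eq = refl
  fold-multiple x p (suc q) eq =
    trans (fold-+ x f p) (trans (cong (λ y → fold y f p) (fold-multiple x p q eq)) eq)

  -- Reduction modulo the period. The bound turns the orbit relation into a finite search, and later
  -- limits how long a tour has to be explored.
  reaches-< : ∀ {x y} → Reaches x y → ∃ λ k → k < m × fold x f k ≡ y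
  reaches-< {x} {y} (k , refl) with period x
  ... | p , p≤m , eq = k % suc p , ℕₚ.<-≤-trans (m%n<n k (suc p)) p≤m , sym (begin
      fold x f k                                   ≡⟨ cong (fold x f) (m≡m%n+[m/n]*n k (suc p)) ⟩
      fold x f (k % suc p + k / suc p * suc p)   ≡⟨ fold-+ x f (k % suc p) ⟩
      fold (fold x f (k / suc p * suc p)) f (k % suc p)
        ≡⟨ cong (λ y → fold y f (k % suc p)) (fold-multiple x (suc p) (k / suc p) eq) ⟩
      fold x f (k % suc p)                         ∎)
    where open ≡.≡-Reasoning

  _~?_ : Decidable (EqClosure (Step f))
  x ~? y with Finₚ.any? (λ i → fold x f (toℕ {m} i) Finₚ.≟ y)
  ... | yes (i , refl) = yes (fold~ f x (toℕ i))
  ... | no ¬p = no λ q → let k , k<m , eq = reaches-< (~⇒reaches q) in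
          ¬p (fromℕ< k<m , trans (cong (fold x f) (Finₚ.toℕ-fromℕ< k<m)) eq)

perm-injects : ∀ {m n} (π : Permutation m n) → Injects (π ⟨$⟩ʳ_)
perm-injects π = Injection.injective (↔⇒↣ π)

abstract
  cycles-size : ∀ {m} (π : Permutation′ m) → ∃ (HasSize (cycles π))
  cycles-size {m} π = enumerable⇒hasSize m (cycles π) _~?_ just (λ s → s , s , refl , ~refl)
    where open Orbit (π ⟨$⟩ʳ_) (perm-injects π)

cycleCount : ∀ {m} → Permutation′ m → ℕ
cycleCount π = proj₁ (cycles-size π)

cycleCount-unique : ∀ {m} (π : Permutation′ m) {k} → HasSize (cycles π) k → cycleCount π ≡ k
cycleCount-unique π = hasSize-unique (proj₂ (cycles-size π))

orbits : {A : Set} → (A → A) → Setoid 0ℓ 0ℓ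
orbits f = EqC.setoid (Step f)

-- The maps `p` and `ι` need not commute with `f` and `g`; a step of one side only has to stay
-- within an orbit of the other. So `p` may collapse elements without counterpart, such as the leg
-- or all half-edges of a piece but one.
orbits-inverse : {A B : Set} {f : A → A} {g : B → B} (p : A → B) (ι : B → A) →
  (∀ x → EqClosure (Step g) (p (f x)) (p x)) →
  (∀ y → EqClosure (Step f) (ι (g y)) (ι y)) →
  (∀ y → p (ι y) ≡ y) → (∀ x → EqClosure (Step f) (ι (p x)) x) →
  Inverse (orbits f) (orbits g)
orbits-inverse {f = f} {g} p ι pf ιg pι ιp = mkInverse {orbits f} {orbits g} p ι
  (EqC.gfold EqC-isEquivalence p λ { {x} refl → ~sym (pf x) })
  (EqC.gfold EqC-isEquivalence ι λ { {y} refl → ~sym (ιg y) })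
  (λ y → ≡⇒~ (pι y)) ιp

injects⇒surjects : ∀ {n} (f : Fin n → Fin n) → Injects f → ∀ y → ∃ λ x → f x ≡ y
injects⇒surjects {suc n} f inj y with Finₚ.any? (λ x → f x Finₚ.≟ y)
... | yes p = p
... | no ¬p = contradiction
    (Finₚ.injective⇒≤ {f = λ x → punchOut {i = y} {f x} (λ q → ¬p (x , sym q))}
      (λ {a} {b} q → inj (Finₚ.punchOut-injective {i = y} _ _ q)))
    ℕₚ.1+n≰n

surjects⇒injects : ∀ {n} (f : Fin n → Fin n) → (∀ y → ∃ λ x → f x ≡ y) → Injects f
surjects⇒injects {n} f sur {x} {y} p =
  trans (sym (gf x)) (trans (cong g p) (gf y))
  where
  g : Fin n → Fin n
  g = proj₁ ∘ sur
  fg : ∀ y → f (g y) ≡ y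
  fg = proj₂ ∘ sur
  g-injects : Injects g
  g-injects {a} {b} q = trans (sym (fg a)) (trans (cong f q) (fg b))
  gf : ∀ x → g (f x) ≡ x
  gf x with injects⇒surjects g g-injects x
  ... | z , refl = cong g (fg z)

bijection : {A B : Set} (f : A → B) → Injects f → (∀ y → ∃ λ x → f x ≡ y) → A ↔ B
bijection f inj sur = mk↔ₛ′ f (proj₁ ∘ sur) (proj₂ ∘ sur) (λ x → inj (proj₂ (sur (f x))))

injection⇒permutation : ∀ {n} (f : Fin n → Fin n) → Injects f → Permutation′ n
injection⇒permutation f inj = bijection f inj (injects⇒surjects f inj)

↔-injects : {A B : Set} (e : A ↔ B) → Injects (Inverse.to e)
↔-injects e = Injection.injective (↔⇒↣ e)

least : {P : ℕ → Set} → (∀ k → Dec (P k)) → ∀ n → P n → ∃ λ k → P k × (∀ j → j < k → ¬ P j)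
least P? zero p = 0 , p , λ _ ()
least {P} P? (suc n) p with P? 0
... | yes q = 0 , q , λ _ ()
... | no ¬q with least (P? ∘ suc) n p
... | k , pk , min = suc k , pk , λ { zero _ → ¬q ; (suc j) (s≤s lt) → min j lt }

bounded : ∀ {n} (f : Fin n → ℕ) → ∃ λ b → ∀ i → f i ≤ b
bounded {zero} f = 0 , λ ()
bounded {suc n} f with bounded (f ∘ suc)
... | b , p = f zero ⊔ b , λ { zero → ℕₚ.m≤m⊔n (f zero) b
                              ; (suc i) → ℕₚ.≤-trans (p i) (ℕₚ.m≤n⊔m (f zero) b) }

-- Covered maps as legged maps

-- The leg 0 is inserted in the cycle of π just before the root corner.
leg : ∀ {m} → Permutation′ m → Corner m → Permutation′ (suc m)
leg {zero} π c = Perm.id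
leg {suc m} π c = lift₀ π ∘ₚ transpose zero (suc c)

leg-zero : ∀ {m} (π : Permutation′ m) {c} h → corner h ≡ c → leg π c ⟨$⟩ʳ zero ≡ suc h
leg-zero {suc m} π h refl = refl

leg-root : ∀ {m} (π : Permutation′ m) {c} h → corner (π ⟨$⟩ʳ h) ≡ c → leg π c ⟨$⟩ʳ suc h ≡ zero
leg-root {suc m} π h refl with π ⟨$⟩ʳ h Finₚ.≟ π ⟨$⟩ʳ h
... | yes _ = refl
... | no ¬p = ⊥-elim (¬p refl)

leg-other : ∀ {m} (π : Permutation′ m) {c} h → corner (π ⟨$⟩ʳ h) ≢ c →
  leg π c ⟨$⟩ʳ suc h ≡ suc (π ⟨$⟩ʳ h)
leg-other {suc m} π {c} h ≢c with π ⟨$⟩ʳ h Finₚ.≟ c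
... | yes p = ⊥-elim (≢c p)
... | no _ = refl

-- The leg is inserted by a transposition that is applied last, so composing beforehand does not
-- interfere. With `ρ` the edge involution, the faces of the legged map are the faces of the map
-- with the leg inserted at the same corner.
leg-∘ : ∀ {m} (ρ π : Permutation′ m) c x →
  leg (ρ ∘ₚ π) c ⟨$⟩ʳ x ≡ leg π c ⟨$⟩ʳ (lift₀ ρ ⟨$⟩ʳ x)
leg-∘ {zero} ρ π c zero = refl
leg-∘ {suc m} ρ π c zero = refl
leg-∘ {suc m} ρ π c (suc x) = refl

-- The leg joins the cycle of the root corner. When there is no half-edge it is itself the one cycle
-- that `cells` supplies by convention, so from here on the empty map is no exception.
legged-cells : ∀ {m} (π : Permutation′ m) c → Inverse (cycles (leg π c)) (cells π)
legged-cells {zero} π c = mkInverse {cycles (leg π c)} {cells π} (λ _ → tt) (λ _ → zero)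
  (λ _ → refl) (λ _ → ~refl) (λ _ → refl) (λ { zero → ~refl })
legged-cells {suc m} π c = orbits-inverse {f = leg π c ⟨$⟩ʳ_} {g = π ⟨$⟩ʳ_} p suc pf ιg (λ _ → refl) ιp
  where
  p : Fin (suc (suc m)) → Fin (suc m)
  p zero = c
  p (suc h) = h
  pf : ∀ x → EqClosure (Step (π ⟨$⟩ʳ_)) (p (leg π c ⟨$⟩ʳ x)) (p x)
  pf zero = ~refl
  pf (suc h) with π ⟨$⟩ʳ h Finₚ.≟ c
  ... | yes q = ~sym (EqC.return q)
  ... | no _ = ~sym (step h)
  ιp : ∀ x → EqClosure (Step (leg π c ⟨$⟩ʳ_)) (suc (p x)) x
  ιp zero = ~sym (step zero)
  ιp (suc h) = ~refl
  ιg : ∀ h → EqClosure (Step (leg π c ⟨$⟩ʳ_)) (suc (π ⟨$⟩ʳ h)) (suc h)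
  ιg h with π ⟨$⟩ʳ h Finₚ.≟ c in eq
  ... | yes q = ~trans (≡⇒~ (cong suc q))
        (~trans (ιp zero) (~sym (EqC.return (leg-root π h q))))
  ... | no ¬q = ~sym (EqC.return (leg-other π h ¬q))

one-cell : ∀ {m} (π : Permutation′ m) → Connected (Graph π) → HasSize (cells π) 1
one-cell {zero} π con = size-one {cells π} tt (λ _ _ → refl)
one-cell {suc m} π con = size-one {cells π} zero con

one-cell⁻¹ : ∀ {m} (π : Permutation′ m) → HasSize (cells π) 1 → Connected (Graph π)
one-cell⁻¹ {suc m} π one = size-one⁻¹ one

leg-connected : ∀ {m} (π : Permutation′ m) c → Connected (Graph π) ⇔ Connected (Graph (leg π c))
leg-connected π c = mk⇔
  (λ con → size-one⁻¹ (hasSize-resp (legged-cells π c) (one-cell π con)))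
  (λ con → one-cell⁻¹ π (hasSize-resp (invSym (legged-cells π c)) (size-one {cycles (leg π c)} zero con)))

partOf : {A : Set} → (A → A) → (A → Bool) → A → A
partOf α s x = if s x then α x else x

module _ {A : Set} (α : A → A) (s : A → Bool) where

  part-in : ∀ {x} → s x ≡ true → partOf α s x ≡ α x
  part-in p rewrite p = refl

  part-out : ∀ {x} → s x ≡ false → partOf α s x ≡ x
  part-out p rewrite p = refl

  part-involutive : (∀ x → α (α x) ≡ x) → (∀ x → s (α x) ≡ s x) →
    ∀ x → partOf α s (partOf α s x) ≡ x
  part-involutive inv st x with s x in eq
  ... | true = trans (part-in (trans (st x) eq)) (inv x)
  ... | false = part-out eq

involution : ∀ {m} (f : Fin m → Fin m) → (∀ x → f (f x) ≡ x) → Permutation′ m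
involution f inv = mk↔ₛ′ f f inv inv

∈⇔lookup : ∀ {m} (S : Subset m) h → h ∈ S ⇔ lookup S h ≡ true
∈⇔lookup S h = mk⇔ Vecₚ.[]=⇒lookup (Vecₚ.lookup⇒[]= h S)

bool-iff : ∀ {a b} → (a ≡ true → b ≡ true) → (b ≡ true → a ≡ true) → a ≡ b
bool-iff {true} f g = sym (f refl)
bool-iff {false} {false} f g = refl
bool-iff {false} {true} f g = g refl

≢true : ∀ {b} → b ≢ true → b ≡ false
≢true {true} p = ⊥-elim (p refl)
≢true {false} p = refl

true≢false : ∀ {b : Bool} → b ≡ true → b ≡ false → ⊥
true≢false refl ()

lookup-∉ : ∀ {m} {S : Subset m} {h} → h ∉ S → lookup S h ≡ false
lookup-∉ {S = S} {h} ∉S = ≢true (∉S ∘ Equivalence.from (∈⇔lookup S h))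

-- The motion follows the border of the submap and passes over the half-edges outside it.
module Motion (M : RootedMap) (S : Subset (RootedMap.size M))
  (stable : ∀ h → h ∈ S → (RootedMap.α M ⟨$⟩ʳ h) ∈ S) where

  open RootedMap M
  private
    σ′ α′ : Fin size → Fin size
    σ′ = σ ⟨$⟩ʳ_
    α′ = α ⟨$⟩ʳ_

  stable-lookup : ∀ h → lookup S (α′ h) ≡ lookup S h
  stable-lookup h = bool-iff
    (λ p → to′ (subst (_∈ S) (α-involutive h) (stable _ (from′ p))))
    (λ p → to′ (stable _ (from′ p)))
    where
    to′ : ∀ {h} → h ∈ S → lookup S h ≡ true
    to′ = Equivalence.to (∈⇔lookup S _)
    from′ : ∀ {h} → lookup S h ≡ true → h ∈ S
    from′ = Equivalence.from (∈⇔lookup S _)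

  motion : Permutation′ size
  motion = involution (partOf α′ (lookup S)) (part-involutive α′ (lookup S) α-involutive stable-lookup) ∘ₚ σ

  θ : Fin size → Fin size
  θ = motion ⟨$⟩ʳ_

  θ-in : ∀ {h} → h ∈ S → θ h ≡ σ′ (α′ h)
  θ-in p = cong σ′ (part-in α′ (lookup S) (Equivalence.to (∈⇔lookup S _) p))

  θ-out : ∀ {h} → h ∉ S → θ h ≡ σ′ h
  θ-out p = cong σ′ (part-out α′ (lookup S) (lookup-∉ p))

  private
    _~_ = EqClosure (Step θ)
    Return : Rel ⟨ S ⟩ 0ℓ
    Return x y = ∃ λ z → (α ↾ S) x z × (σ ↾ S) z y

  reachesS : ∀ k h → fold h σ′ k ∈ S → ∃ λ s → s ∈ S × h ~ s
  reachesS k h p with h Subsetₚ.∈? S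
  ... | yes q = h , q , ~refl
  reachesS zero h p | no ¬q = ⊥-elim (¬q p)
  reachesS (suc k) h p | no ¬q with reachesS k (σ′ h) (subst (_∈ S) (sym (fold-suc σ′ h k)) p)
  ... | s , s∈S , r = s , s∈S , ~trans (EqC.return (θ-out ¬q)) r

  return-motion : ∀ {x z y} → θ x ≡ σ′ z → FirstReturn σ S z y → x ~ y
  return-motion eq (stop _) = EqC.return eq
  return-motion eq (skip ∉S r) = ~trans (EqC.return eq) (return-motion (θ-out ∉S) r)

  α-return : ∀ {x z} → x ∈ S → FirstReturn α S x z → z ≡ α′ x
  α-return x∈S (stop _) = refl
  α-return x∈S (skip ∉S _) = ⊥-elim (∉S (stable _ x∈S))

  σ-toS : ∀ h → (∃ λ s → s ∈ S × EqClosure (Graph σ) h s) → ∃ λ s → s ∈ S × h ~ s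
  σ-toS h (s , s∈S , h~s) with k , refl ← Orbit.~⇒reaches σ′ (perm-injects σ) h~s = reachesS k h s∈S

  -- Off `S` the motion is `σ`, so by `connecting` every half-edge is carried into `S`. From one
  -- visit of `S` to the next, the motion makes one step of the face permutation of the submap,
  -- which is cyclic. If `S` is empty, the motion is `σ`, and the map has one vertex.
  covers⇒connected : Covers M S → Connected (Step θ)
  covers⇒connected cov = go (Covers.connecting cov)
    where
    unicellular′ : ∀ x y → EqClosure Return x y → proj₁ x ~ proj₁ y
    unicellular′ x y = EqC.gfold EqC-isEquivalence proj₁
      λ { {x , x∈S} (z , a , r) → return-motion (trans (θ-in x∈S) (cong σ′ (sym (α-return x∈S a)))) r }
    go : _ → Connected (Step θ)
    go (inj₁ con) x y
      with s , s∈S , x~s ← σ-toS x (con x) | t , t∈S , y~t ← σ-toS y (con y) =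
        ~trans x~s (~trans (unicellular′ (s , s∈S) (t , t∈S) (Covers.unicellular cov _ _)) (~sym y~t))
    go (inj₂ (S≡⊥ , one)) x y = EqC.map (λ {h} p → trans (θ-out (subst (h ∉_) (sym S≡⊥) Subsetₚ.∉⊥)) p)
      (one-cell⁻¹ σ one x y)

  open Orbit θ (perm-injects motion) using (~⇒reaches)

  σ-reachesS : ∀ k h → fold h θ k ∈ S → ∃ λ s → s ∈ S × EqClosure (Graph σ) h s
  σ-reachesS k h p with h Subsetₚ.∈? S
  ... | yes q = h , q , ~refl
  σ-reachesS zero h p | no ¬q = ⊥-elim (¬q p)
  σ-reachesS (suc k) h p | no ¬q
    with σ-reachesS k (σ′ h) (subst (_∈ S) (trans (sym (fold-suc θ h k)) (cong (λ x → fold x θ k) (θ-out ¬q))) p)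
  ... | s , s∈S , r = s , s∈S , ~trans (EqC.return refl) r

  firstReturn : ∀ k w → fold (σ′ w) θ k ∈ S →
    ∃ λ y → y ∈ S × FirstReturn σ S w y × ∃ λ j → j ≤ k × fold y θ j ≡ fold (σ′ w) θ k
  firstReturn k w p with σ′ w Subsetₚ.∈? S
  ... | yes q = σ′ w , q , stop q , k , ℕₚ.≤-refl , refl
  firstReturn zero w p | no ¬q = ⊥-elim (¬q p)
  firstReturn (suc k) w p | no ¬q
    with eq ← trans (sym (fold-suc θ (σ′ w) k)) (cong (λ x → fold x θ k) (θ-out ¬q))
    with firstReturn k (σ′ w) (subst (_∈ S) eq p)
  ... | y , y∈S , r , j , j≤k , e = y , y∈S , skip ¬q r , j , ℕₚ.m≤n⇒m≤1+n j≤k , trans e (sym eq)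

  -- A walk of the motion between two elements of `S` splits at its visits to `S`. Each return
  -- consumes an unknown number of steps, so the induction is on the bound `b` rather than on `k`.
  returns : ∀ b k → k ≤ b → ∀ {x y} (x∈S : x ∈ S) (y∈S : y ∈ S) → fold x θ k ≡ y →
    EqClosure Return (x , x∈S) (y , y∈S)
  returns b zero k≤b x∈S y∈S refl = ≡⇒~ (cong (_ ,_) (Vecᴷ.[]=-irrelevant x∈S y∈S))
  returns (suc b) (suc k) (s≤s k≤b) {x} x∈S y∈S refl
    with eq ← trans (sym (fold-suc θ x k)) (cong (λ x → fold x θ k) (θ-in x∈S))
    with firstReturn k (α′ x) (subst (_∈ S) eq y∈S)
  ... | z , z∈S , r , j , j≤k , e = ~trans
        (EqC.return {y = z , z∈S} ((α′ x , stable x x∈S) , stop (stable x x∈S) , r))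
        (returns b j (ℕₚ.≤-trans j≤k k≤b) z∈S y∈S (trans e (sym eq)))

  connected⇒covers : Connected (Step θ) → Covers M S
  connected⇒covers con = record
    { α-stable = stable
    ; transitiveₛ = λ x y → EqC.fold {S = EqClosure ((σ ↾ S) ∪ (α ↾ S))} {R = Return} EqC-isEquivalence
        (λ { {x} {y} (z , a , r) → ~trans {y = z} (EqC.return (inj₂ a)) (EqC.return (inj₁ r)) }) (uni x y)
    ; connecting = connecting
    ; unicellular = uni
    }
    where
    uni : Connected Return
    uni (x , x∈S) (y , y∈S) with k , eq ← ~⇒reaches (con x y) = returns k k ℕₚ.≤-refl x∈S y∈S eq
    connecting : _
    connecting with Finₚ.any? (Subsetₚ._∈? S)
    ... | yes (s , s∈S) = inj₁ λ h → let k , eq = ~⇒reaches (con h s) in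
            σ-reachesS k h (subst (_∈ S) (sym eq) s∈S)
    ... | no ¬ne = inj₂ (Subsetₚ.Empty-unique ¬ne
            , one-cell σ (λ x y → EqC.map (λ {h} p → trans (sym (θ-out (λ q → ¬ne (h , q)))) p) (con x y)))

-- The orientation of a legged map defined by a submap

-- Times are measured backwards: `δ` counts the steps that remain before reaching `r`, so a larger
-- value means an earlier visit on the tour that sets out from `r`.
record Distance {A : Set} (θ : A → A) (r : A) : Set where
  field
    δ : A → ℕ
    δ-base : δ r ≡ 0
    δ-step : ∀ {x} → x ≢ r → δ x ≡ suc (δ (θ x))
    δ-max : ∀ x → δ x ≤ δ (θ r)

distance : ∀ {N} (θ : Fin N → Fin N) → Injects θ → Connected (Step θ) → ∀ r → Distance θ r
distance {N} θ inj con r = record { δ = δ ; δ-base = δ-base ; δ-step = δ-step ; δ-max = δ-max }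
  where
  open Orbit θ inj
  first : ∀ x → ∃ λ k → fold x θ k ≡ r × (∀ j → j < k → fold x θ j ≢ r)
  first x with k , eq ← ~⇒reaches (con x r) = least (λ k → fold x θ k Finₚ.≟ r) k eq
  δ : Fin N → ℕ
  δ x = proj₁ (first x)
  δ-unique : ∀ x k → fold x θ k ≡ r → (∀ j → j < k → fold x θ j ≢ r) → δ x ≡ k
  δ-unique x k p q with first x
  ... | l , p′ , q′ with ℕₚ.<-cmp l k
  ... | tri< l<k _ _ = contradiction p′ (q l l<k)
  ... | tri≈ _ l≡k _ = l≡k
  ... | tri> _ _ k<l = contradiction p (q′ k k<l)
  δ-base : δ r ≡ 0
  δ-base = δ-unique r 0 refl (λ _ ())
  δ-step : ∀ {x} → x ≢ r → δ x ≡ suc (δ (θ x))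
  δ-step {x} x≢r = δ-unique x (suc (δ (θ x)))
    (trans (sym (fold-suc θ x (δ (θ x)))) (proj₁ (proj₂ (first (θ x)))))
    λ { zero _ → x≢r
      ; (suc j) (s≤s j<) p → proj₂ (proj₂ (first (θ x))) j j< (trans (fold-suc θ x j) p) }
  δ-decr : ∀ j → δ (fold (θ r) θ j) ≤ δ (θ r)
  δ-decr zero = ℕₚ.≤-refl
  δ-decr (suc j) with fold (θ r) θ j Finₚ.≟ r
  ... | yes p = ℕₚ.≤-reflexive (cong (δ ∘ θ) p)
  ... | no ¬p = ℕₚ.≤-trans (ℕₚ.n≤1+n _) (ℕₚ.≤-trans (ℕₚ.≤-reflexive (sym (δ-step ¬p))) (δ-decr j))
  δ-max : ∀ x → δ x ≤ δ (θ r)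
  δ-max x with k , refl ← ~⇒reaches (con (θ r) x) = δ-decr k

module DistanceLemmas {A : Set} {θ : A → A} {r : A} (_≟_ : Decidable (_≡_ {A = A}))
  (inj : Injects θ) (D : Distance θ r) where
  open Distance D

  δ-zero : ∀ {x} → δ x ≡ 0 → x ≡ r
  δ-zero {x} p with x ≟ r
  ... | yes q = q
  ... | no ¬q with () ← trans (sym p) (δ-step ¬q)

  δ-injective : ∀ k {x y} → δ x ≡ k → δ x ≡ δ y → x ≡ y
  δ-injective zero p q = trans (δ-zero p) (sym (δ-zero (trans (sym q) p)))
  δ-injective (suc k) {x} {y} p q = inj (δ-injective k
    (ℕₚ.suc-injective (trans (sym (δ-step (≢r p))) p))
    (ℕₚ.suc-injective (trans (sym (δ-step (≢r p))) (trans q (δ-step (≢r (trans (sym q) p)))))))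
    where
    ≢r : ∀ {x} → δ x ≡ suc k → x ≢ r
    ≢r p refl with () ← trans (sym δ-base) p

  -- On the tour from `r`, `δ` starts with its maximum at `θ r` and falls by one at each step, so no
  -- value above the present one has been skipped; `δ` being injective, the element with that value
  -- has been met.
  farther-visited : ∀ k {y} → fold r θ k ≢ r → δ (fold r θ k) < δ y → ∃ λ j → j < k × fold r θ j ≡ y
  farther-visited zero ≢r _ = ⊥-elim (≢r refl)
  farther-visited (suc k) {y} ≢r lt with fold r θ k ≟ y
  ... | yes p = k , ℕₚ.≤-refl , p
  ... | no ¬p with fold r θ k ≟ r
  ... | yes p = contradiction (δ-max y) (ℕₚ.<⇒≱ (subst (λ z → δ (θ z) < δ y) p lt))
  ... | no ¬q with farther-visited k ¬q
        (ℕₚ.≤∧≢⇒< (subst (_≤ δ y) (sym (δ-step ¬q)) lt) (¬p ∘ δ-injective _ refl))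
  ... | j , j<k , e = j , ℕₚ.m≤n⇒m≤1+n j<k , e

distance-natural : {A B : Set} {θ : A → A} {θ′ : B → B} {r : A} {r′ : B} →
  Decidable (_≡_ {A = A}) → (D : Distance θ r) (D′ : Distance θ′ r′) (φ : A → B) → Injects φ →
  φ r ≡ r′ → (∀ x → φ (θ x) ≡ θ′ (φ x)) → ∀ x → Distance.δ D′ (φ x) ≡ Distance.δ D x
distance-natural {θ = θ} {θ′} {r = r} _≟_ D D′ φ inj φr φθ x = go (D.δ x) x refl
  where
  module D = Distance D
  module D′ = Distance D′
  go : ∀ k x → D.δ x ≡ k → D′.δ (φ x) ≡ D.δ x
  go k x eq with x ≟ r
  go k x eq | yes refl = trans (cong D′.δ φr) (trans D′.δ-base (sym D.δ-base))
  go zero x eq | no x≢r with () ← trans (sym (D.δ-step x≢r)) eq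
  go (suc k) x eq | no x≢r = begin
    D′.δ (φ x)             ≡⟨ D′.δ-step (λ p → x≢r (inj (trans p (sym φr)))) ⟩
    suc (D′.δ (θ′ (φ x)))  ≡⟨ cong (suc ∘ D′.δ) (φθ x) ⟨
    suc (D′.δ (φ (θ x)))   ≡⟨ cong suc (go k (θ x) (ℕₚ.suc-injective (trans (sym (D.δ-step x≢r)) eq))) ⟩
    suc (D.δ (θ x))        ≡⟨ D.δ-step x≢r ⟨
    D.δ x                  ∎
    where open ≡.≡-Reasoning

choose : {P A : Set} → Dec P → A → A → A
choose (yes _) a b = a
choose (no _) a b = b

choose-yes : {P A : Set} (P? : Dec P) {a b : A} → P → choose P? a b ≡ a
choose-yes (yes _) p = refl
choose-yes (no ¬p) p = ⊥-elim (¬p p)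

choose-no : {P A : Set} (P? : Dec P) {a b : A} → ¬ P → choose P? a b ≡ b
choose-no (yes p) ¬p = ⊥-elim (¬p p)
choose-no (no _) ¬p = refl

record Legged (N : ℕ) : Set where
  field
    σ : Permutation′ N
    α : Fin N → Fin N
    r : Fin N
    α-involutive : ∀ x → α (α x) ≡ x
    α-r : α r ≡ r
    α-fixed : ∀ {x} → α x ≡ x → x ≡ r

  α≢r : ∀ {x} → x ≢ r → α x ≢ r
  α≢r {x} x≢r p = x≢r (trans (sym (α-involutive x)) (trans (cong α p) α-r))

  α-injects : Injects α
  α-injects {x} {y} p = trans (sym (α-involutive x)) (trans (cong α p) (α-involutive y))

  record Sub : Set where
    field
      s : Fin N → Bool
      stable : ∀ x → s (α x) ≡ s x
      s-r : s r ≡ false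

    sw : Fin N → Fin N
    sw = partOf α s

    sw-involutive : ∀ x → sw (sw x) ≡ x
    sw-involutive = part-involutive α s α-involutive stable

    motion : Permutation′ N
    motion = involution sw sw-involutive ∘ₚ σ

    θ : Fin N → Fin N
    θ = motion ⟨$⟩ʳ_

    θ-in : ∀ {x} → s x ≡ true → θ x ≡ σ ⟨$⟩ʳ (α x)
    θ-in p = cong (σ ⟨$⟩ʳ_) (part-in α s p)

    θ-out : ∀ {x} → s x ≡ false → θ x ≡ σ ⟨$⟩ʳ x
    θ-out p = cong (σ ⟨$⟩ʳ_) (part-out α s p)

    θ-sw : ∀ x → θ (sw x) ≡ σ ⟨$⟩ʳ x
    θ-sw x = cong (σ ⟨$⟩ʳ_) (sw-involutive x)

    θ-injects : Injects θ
    θ-injects = perm-injects motion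

  record Orientation : Set where
    field
      out : Fin N → Bool
      out-r : out r ≡ false
      out-α : ∀ {x} → x ≢ r → out (α x) ≡ not (out x)

    out≢r : ∀ {x} → out x ≡ true → x ≢ r
    out≢r p refl = true≢false p out-r

    α-in : ∀ {x} → out x ≡ true → out (α x) ≡ false
    α-in {x} p = trans (out-α (out≢r p)) (cong not p)

    α-out : ∀ {x} → x ≢ r → out x ≡ false → out (α x) ≡ true
    α-out {x} ≢r p = trans (out-α ≢r) (cong not p)

    -- The pieces of the vertices cut after each half-edge that is not out form a tree.
    Ranked : (Fin N → ℕ) → Set
    Ranked d = ∀ {x} → out x ≡ true → d (σ ⟨$⟩ʳ x) < d x × d (σ ⟨$⟩ʳ x) < d (α x)

  module FromSub (S : Sub) (D : Distance (Sub.θ S) r) where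
    open Sub S
    open Distance D
    open DistanceLemmas Finₚ._≟_ θ-injects D

    -- As `δ` decreases in time, an edge of the submap is outgoing at the half-edge visited first,
    -- and any other edge at the half-edge visited last.
    out : Fin N → Bool
    out x = s x xor does (δ x <? δ (α x))

    out-s : ∀ {x} → ¬ (δ x < δ (α x)) → out x ≡ s x
    out-s {x} p rewrite dec-false (δ x <? δ (α x)) p = Boolₚ.xor-identityʳ (s x)

    out-not-s : ∀ {x} → δ x < δ (α x) → out x ≡ not (s x)
    out-not-s {x} p rewrite dec-true (δ x <? δ (α x)) p = Boolₚ.xor-comm (s x) true

    compare : ∀ {x} → x ≢ r → (δ x < δ (α x)) ⊎ (δ (α x) < δ x)
    compare {x} x≢r with ℕₚ.<-cmp (δ x) (δ (α x))
    ... | tri< lt _ _ = inj₁ lt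
    ... | tri≈ _ eq _ = ⊥-elim (x≢r (α-fixed (sym (δ-injective _ refl eq))))
    ... | tri> _ _ gt = inj₂ gt

    orientation : Orientation
    orientation = record { out = out ; out-r = out-r ; out-α = out-α }
      where
      out-r : out r ≡ false
      out-r = trans (out-s (λ lt → ℕₚ.<-irrefl (cong δ (sym α-r)) lt)) s-r
      out-α : ∀ {x} → x ≢ r → out (α x) ≡ not (out x)
      out-α {x} x≢r with compare x≢r
      ... | inj₁ lt = begin
        out (α x)      ≡⟨ out-s (λ lt′ → ℕₚ.<-asym lt (subst (δ (α x) <_) (cong δ (α-involutive x)) lt′)) ⟩
        s (α x)        ≡⟨ stable x ⟩
        s x            ≡⟨ Boolₚ.not-involutive (s x) ⟨
        not (not (s x)) ≡⟨ cong not (out-not-s lt) ⟨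
        not (out x)    ∎
        where open ≡.≡-Reasoning
      ... | inj₂ gt = begin
        out (α x)      ≡⟨ out-not-s (subst (δ (α x) <_) (cong δ (sym (α-involutive x))) gt) ⟩
        not (s (α x))  ≡⟨ cong not (stable x) ⟩
        not (s x)      ≡⟨ cong not (out-s (ℕₚ.<-asym gt)) ⟨
        not (out x)    ∎
        where open ≡.≡-Reasoning

    -- In `S`, the later half-edge is `α x`, and `θ (α x)` is `σ x`. Off `S`, the later half-edge is
    -- `x`, and `θ x` is `σ x`. Either way `σ x` follows the later one immediately.
    ranked : Orientation.Ranked orientation δ
    ranked {x} o with x≢r ← Orientation.out≢r orientation o with s x in eq | compare x≢r
    ... | true | inj₁ lt with () ← trans (sym o) (trans (cong (true xor_) (dec-true (δ x <? δ (α x)) lt)) refl)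
    ... | true | inj₂ gt = ℕₚ.<-trans lt gt , lt
      where
      lt : δ (σ ⟨$⟩ʳ x) < δ (α x)
      lt = ℕₚ.≤-reflexive (sym (trans (δ-step (α≢r x≢r))
        (cong (suc ∘ δ) (trans (θ-in (trans (stable x) eq)) (cong (σ ⟨$⟩ʳ_) (α-involutive x))))))
    ... | false | inj₂ gt with () ← trans (sym o) (dec-false (δ x <? δ (α x)) (ℕₚ.<-asym gt))
    ... | false | inj₁ lt = lt′ , ℕₚ.<-trans lt′ lt
      where
      lt′ : δ (σ ⟨$⟩ʳ x) < δ x
      lt′ = ℕₚ.≤-reflexive (sym (trans (δ-step x≢r) (cong (suc ∘ δ) (θ-out eq))))

    -- A half-edge met before its opposite has the larger `δ`, so there the comparison in `out` is
    -- false and `out` shows membership. This is how the orientation decides, during a tour, whether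
    -- to follow a newly met edge.
    first-visit : ∀ k → fold r θ k ≢ r → (∀ j → j < k → fold r θ j ≢ α (fold r θ k)) →
      out (fold r θ k) ≡ s (fold r θ k)
    first-visit k ≢r new = out-s λ lt → let j , j<k , e = farther-visited k ≢r lt in new j j<k e

  -- The two tours agree step by step. At the first visit of an edge its membership is read from the
  -- common orientation; at the second visit it is inherited from the first by stability.
  sub-unique : (S₁ S₂ : Sub) (D₁ : Distance (Sub.θ S₁) r) (D₂ : Distance (Sub.θ S₂) r) →
    Connected (Step (Sub.θ S₁)) →
    (∀ x → FromSub.out S₁ D₁ x ≡ FromSub.out S₂ D₂ x) → ∀ x → Sub.s S₁ x ≡ Sub.s S₂ x
  sub-unique S₁ S₂ D₁ D₂ con same x
    with k , refl ← Orbit.~⇒reaches (Sub.θ S₁) (Sub.θ-injects S₁) (con r x) = proj₂ (agree k k ℕₚ.≤-refl)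
    where
    module S₁ = Sub S₁
    module S₂ = Sub S₂
    seq₁ seq₂ : ℕ → Fin N
    seq₁ = fold r S₁.θ
    seq₂ = fold r S₂.θ
    agree : ∀ b k → k ≤ b → seq₁ k ≡ seq₂ k × S₁.s (seq₁ k) ≡ S₂.s (seq₁ k)
    agree b zero _ = refl , trans S₁.s-r (sym S₂.s-r)
    agree (suc b) (suc k) (s≤s k≤b) = eq , same-s
      where
      earlier : ∀ j → j < suc k → seq₁ j ≡ seq₂ j × S₁.s (seq₁ j) ≡ S₂.s (seq₁ j)
      earlier j (s≤s j≤k) = agree b j (ℕₚ.≤-trans j≤k k≤b)
      x′ = seq₁ (suc k)
      eq : seq₁ (suc k) ≡ seq₂ (suc k)
      eq with e , p ← earlier k ℕₚ.≤-refl =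
        trans (cong (λ b → σ ⟨$⟩ʳ (if b then α (seq₁ k) else seq₁ k)) p) (cong S₂.θ e)
      same-s : S₁.s x′ ≡ S₂.s x′
      same-s with x′ Finₚ.≟ r
      ... | yes p = trans (cong S₁.s p) (trans S₁.s-r (trans (sym S₂.s-r) (cong S₂.s (sym p))))
      ... | no x′≢r with Finₚ.any? {n = suc k} (λ j → seq₁ (toℕ j) Finₚ.≟ α x′)
      ... | yes (j , p) = begin
        S₁.s x′             ≡⟨ S₁.stable x′ ⟨
        S₁.s (α x′)         ≡⟨ cong S₁.s p ⟨
        S₁.s (seq₁ (toℕ j)) ≡⟨ proj₂ (earlier (toℕ j) (Finₚ.toℕ<n j)) ⟩
        S₂.s (seq₁ (toℕ j)) ≡⟨ cong S₂.s p ⟩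
        S₂.s (α x′)         ≡⟨ S₂.stable x′ ⟩
        S₂.s x′             ∎
        where open ≡.≡-Reasoning
      ... | no ¬p = begin
        S₁.s x′              ≡⟨ FromSub.first-visit S₁ D₁ (suc k) x′≢r new ⟨
        FromSub.out S₁ D₁ x′ ≡⟨ same x′ ⟩
        FromSub.out S₂ D₂ x′ ≡⟨ cong (FromSub.out S₂ D₂) eq ⟩
        FromSub.out S₂ D₂ (seq₂ (suc k))
          ≡⟨ FromSub.first-visit S₂ D₂ (suc k) (x′≢r ∘ trans eq)
               (λ j j< q → new j j< (trans (proj₁ (earlier j j<)) (trans q (cong α (sym eq))))) ⟩
        S₂.s (seq₂ (suc k))  ≡⟨ cong S₂.s eq ⟨
        S₂.s x′              ∎
        where
        open ≡.≡-Reasoning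
        new : ∀ j → j < suc k → seq₁ j ≢ α x′
        new j j< q = ¬p (fromℕ< j< , trans (cong seq₁ (Finₚ.toℕ-fromℕ< j<)) q)

  -- Conversely, following σ from r and putting an edge in S exactly when it is first met at
  -- its out half-edge recovers the submap.
  module Explore (O : Orientation) where
    open Orientation O

    -- Correctness during the first `k` steps only, and only where the tour meets an edge for the
    -- first time. The tour depends on the submap being built, so nothing can be asked of later
    -- steps yet.
    Good : Sub → ℕ → Set
    Good S k = ∀ j → j < k → let x = fold r (Sub.θ S) j in
      (∀ i → i < j → fold r (Sub.θ S) i ≢ x × fold r (Sub.θ S) i ≢ α x) → Sub.s S x ≡ out x

    touches? : ∀ x y → Dec (y ≡ x ⊎ y ≡ α x)
    touches? x y = (y Finₚ.≟ x) ⊎-dec (y Finₚ.≟ α x)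

    set : Sub → Fin N → Sub
    set S x = record { s = s′ ; stable = stable′ ; s-r = s′-r }
      where
      open Sub S
      s′ : Fin N → Bool
      s′ y = choose (touches? x y) (out x) (s y)
      stable′ : ∀ y → s′ (α y) ≡ s′ y
      stable′ y with touches? x y
      ... | yes (inj₁ refl) = choose-yes (touches? y (α y)) (inj₂ refl)
      ... | yes (inj₂ refl) = choose-yes (touches? x (α (α x))) (inj₁ (α-involutive x))
      ... | no ¬t = trans (choose-no (touches? x (α y)) λ
              { (inj₁ p) → ¬t (inj₂ (trans (sym (α-involutive y)) (cong α p)))
              ; (inj₂ p) → ¬t (inj₁ (α-injects p)) }) (stable y)
      s′-r : s′ r ≡ false
      s′-r with touches? x r
      ... | yes (inj₁ refl) = out-r
      ... | yes (inj₂ p) = trans (cong out (trans (sym (α-involutive x)) (trans (cong α (sym p)) α-r))) out-r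
      ... | no _ = s-r

    set-at : ∀ S x → Sub.s (set S x) x ≡ out x
    set-at S x = choose-yes (touches? x x) (inj₁ refl)

    set-off : ∀ S x {y} → y ≢ x → y ≢ α x → Sub.s (set S x) y ≡ Sub.s S y
    set-off S x {y} p q = choose-no (touches? x y) (λ { (inj₁ e) → p e ; (inj₂ e) → q e })

    -- If the edge at step `k` has been met before, nothing is to be done. If it is new, its
    -- membership has not influenced the tour up to this step, so it can be reset without disturbing
    -- what was achieved.
    improve : ∀ S k → Good S k → ∃ λ S′ → Good S′ (suc k)
    improve S k good with Finₚ.any? {n = k} (λ i → touches? x (fold r (Sub.θ S) (toℕ i)))
      where x = fold r (Sub.θ S) k
    ... | yes (i , t) = S , good′
      where
      good′ : Good S (suc k)
      good′ j (s≤s j≤k) new with ℕₚ.m≤n⇒m<n∨m≡n j≤k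
      ... | inj₁ j<k = good j j<k new
      ... | inj₂ refl = ⊥-elim (clash t (new (toℕ i) (Finₚ.toℕ<n i)))
        where
        clash : ∀ {y z w : Fin N} → y ≡ z ⊎ y ≡ w → y ≢ z × y ≢ w → ⊥
        clash (inj₁ e) (p , _) = p e
        clash (inj₂ e) (_ , p) = p e
    ... | no ¬t = S′ , good′
      where
      x = fold r (Sub.θ S) k
      S′ = set S x
      seq seq′ : ℕ → Fin N
      seq = fold r (Sub.θ S)
      seq′ = fold r (Sub.θ S′)
      off : ∀ i → i < k → seq i ≢ x × seq i ≢ α x
      off i i<k = (λ p → touch (inj₁ p)) , (λ p → touch (inj₂ p))
        where
        touch : ¬ (seq i ≡ x ⊎ seq i ≡ α x)
        touch p = ¬t (fromℕ< i<k ,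
          subst (λ j → seq j ≡ x ⊎ seq j ≡ α x) (sym (Finₚ.toℕ-fromℕ< i<k)) p)
      same : ∀ i → i ≤ k → seq′ i ≡ seq i
      same zero _ = refl
      same (suc i) i<k rewrite same i (ℕₚ.<⇒≤ i<k) =
        cong (λ b → σ ⟨$⟩ʳ (if b then α (seq i) else seq i))
          (set-off S x (proj₁ (off i i<k)) (proj₂ (off i i<k)))
      good′ : Good S′ (suc k)
      good′ j (s≤s j≤k) new with ℕₚ.m≤n⇒m<n∨m≡n j≤k
      ... | inj₂ refl rewrite same k ℕₚ.≤-refl = set-at S x
      ... | inj₁ j<k rewrite same j j≤k = trans (set-off S x (proj₁ (off j j<k)) (proj₂ (off j j<k)))
            (good j j<k λ i i<j →
              subst (λ z → z ≢ seq j × z ≢ α (seq j)) (same i (ℕₚ.≤-trans (ℕₚ.<⇒≤ i<j) j≤k)) (new i i<j))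

    abstract
      explored : ∀ k → ∃ λ S → Good S k
      explored zero = record { s = λ _ → false ; stable = λ _ → refl ; s-r = refl } , λ _ ()
      explored (suc k) = let S , good = explored k in improve S k good

    -- `N` steps suffice: everything in the orbit of `r` is reached in fewer, so every first visit
    -- falls into the controlled range.
    S : Sub
    S = proj₁ (explored N)

    open Sub S
    open Orbit θ θ-injects

    seq : ℕ → Fin N
    seq = fold r θ

    Visited : Fin N → Set
    Visited x = Reaches r x

    FirstMet : Fin N → Fin N → Set
    FirstMet x y = ∃ λ k → seq k ≡ x × (∀ j → j < k → seq j ≢ y)

    first-met : ∀ {o} → out o ≡ true → Visited o ⊎ Visited (α o) →
      (s o ≡ true × FirstMet o (α o)) ⊎ (s o ≡ false × FirstMet (α o) o)
    first-met {o} out-o v with visit v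
      where
      visit : Visited o ⊎ Visited (α o) → ∃ λ k → k < N × (seq k ≡ o ⊎ seq k ≡ α o)
      visit (inj₁ p) = let k , k< , e = reaches-< p in k , k< , inj₁ e
      visit (inj₂ p) = let k , k< , e = reaches-< p in k , k< , inj₂ e
    ... | K , K<N , p with least (λ k → touches? o (seq k)) K p
    ... | k , t , min = result t
      where
      k<N : k < N
      k<N with k <? N
      ... | yes lt = lt
      ... | no ≮ = contradiction p (min K (ℕₚ.<-≤-trans K<N (ℕₚ.≮⇒≥ ≮)))
      good : (∀ i → i < k → seq i ≢ seq k × seq i ≢ α (seq k)) → s (seq k) ≡ out (seq k)
      good = proj₂ (explored N) k k<N
      result : seq k ≡ o ⊎ seq k ≡ α o → _
      result (inj₁ e) = inj₁
        ( trans (cong s (sym e)) (trans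
            (good λ i i<k → (λ q → min i i<k (inj₁ (trans q e)))
                          , (λ q → min i i<k (inj₂ (trans q (cong α e)))))
            (trans (cong out e) out-o))
        , k , e , λ j j<k q → min j j<k (inj₂ q))
      result (inj₂ e) = inj₂
        ( trans (sym (stable o)) (trans (cong s (sym e)) (trans
            (good λ i i<k → (λ q → min i i<k (inj₂ (trans q e)))
                          , (λ q → min i i<k (inj₁ (trans q (trans (cong α e) (α-involutive o))))))
            (trans (cong out e) (α-in out-o))))
        , k , e , λ j j<k q → min j j<k (inj₁ q))

    -- `sw o` precedes `σ o` on the tour, so it has been visited. The half-edge of this edge that is
    -- met first is the other one: `o` if the edge is in `S`, where `sw o` is `α o`, and `α o` if it
    -- is not, where `sw o` is `o`.
    visited-back : ∀ {o} → out o ≡ true → Visited (σ ⟨$⟩ʳ o) → Visited o × Visited (α o)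
    visited-back {o} out-o v = go (reaches-trans v (reaches-sym (1 , θ-sw o)))
      where
      both : Visited o ⊎ Visited (α o) → Visited (sw o) → Visited o × Visited (α o)
      both v v′ with first-met out-o v
      ... | inj₁ (in-s , k , e , _) = (k , e) , subst Visited (part-in α s in-s) v′
      ... | inj₂ (off-s , k , e , _) = subst Visited (part-out α s off-s) v′ , (k , e)
      go : Visited (sw o) → Visited o × Visited (α o)
      go v with s o in eq
      ... | true = both (inj₂ v) (subst Visited (sym (part-in α s eq)) v)
      ... | false = both (inj₁ v) (subst Visited (sym (part-out α s eq)) v)

    module _ (d : Fin N → ℕ) (ranked : Ranked d) where

      -- Induction on the rank: for the outgoing half-edge of the edge of `x`, the image under `σ`
      -- has smaller rank, hence is visited, and `visited-back` then gives both half-edges.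
      all-visited : ∀ k x → d x ≤ k → Visited x
      all-visited k x le with x Finₚ.≟ r | out x in eq
      all-visited k x le | yes refl | _ = 0 , refl
      all-visited zero x le | no x≢r | true =
        contradiction (ℕₚ.<-≤-trans (proj₁ (ranked eq)) le) λ ()
      all-visited (suc k) x le | no x≢r | true = proj₁ (visited-back eq
        (all-visited k (σ ⟨$⟩ʳ x) (ℕₚ.≤-pred (ℕₚ.<-≤-trans (proj₁ (ranked eq)) le))))
      all-visited k x le | no x≢r | false
        with o ← α-out x≢r eq
        with lt ← subst (λ y → d (σ ⟨$⟩ʳ (α x)) < d y) (α-involutive x) (proj₂ (ranked o)) with k
      ... | zero = contradiction (ℕₚ.<-≤-trans lt le) λ ()
      ... | suc k′ = subst Visited (α-involutive x) (proj₂ (visited-back o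
              (all-visited k′ (σ ⟨$⟩ʳ (α x)) (ℕₚ.≤-pred (ℕₚ.<-≤-trans lt le)))))

      connected : Connected (Step θ)
      connected x y = ~trans (~sym (path x)) (path y)
        where
        path : ∀ x → EqClosure (Step θ) r x
        path x with k , refl ← all-visited (d x) x ℕₚ.≤-refl = fold~ θ r k

      -- `first-met` tells which half-edge of an edge the tour meets first, and this is the
      -- comparison of distances that enters the orientation defined by the submap. Since both
      -- orientations reverse under `α`, the outgoing half-edges decide everything.
      out-explored : (D : Distance θ r) → ∀ x → FromSub.out S D x ≡ out x
      out-explored D = λ x → check x (x Finₚ.≟ r) (out x) refl
        where
        open FromSub S D using (orientation; out-s; out-not-s; compare) renaming (out to out′)
        open Distance D
        open DistanceLemmas Finₚ._≟_ θ-injects D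
        at-out : ∀ {o} → out o ≡ true → out′ o ≡ true
        at-out {o} p with first-met p (inj₁ (all-visited (d o) o ℕₚ.≤-refl))
        ... | inj₁ (in-s , k , refl , new) = trans (out-s λ lt →
                let j , j<k , e = farther-visited k (out≢r p) lt in new j j<k e) in-s
        ... | inj₂ (off-s , k , e , new) = trans (out-not-s lt) (cong not off-s)
          where
          lt : δ o < δ (α o)
          lt with compare (out≢r p)
          ... | inj₁ lt = lt
          ... | inj₂ gt = let j , j<k , e′ = farther-visited k
                                 (λ q → α≢r (out≢r p) (trans (sym e) q))
                                 (subst (λ z → δ z < δ o) (sym e) gt)
                          in ⊥-elim (new j j<k e′)
        check : ∀ x → Dec (x ≡ r) → ∀ b → out x ≡ b → out′ x ≡ out x
        check x (yes refl) b _ = trans (Orientation.out-r orientation) (sym out-r)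
        check x (no _) true eq = trans (at-out eq) (sym eq)
        check x (no x≢r) false eq = begin
          out′ x              ≡⟨ cong out′ (α-involutive x) ⟨
          out′ (α (α x))      ≡⟨ Orientation.out-α orientation (α≢r x≢r) ⟩
          not (out′ (α x))    ≡⟨ cong not (at-out (α-out x≢r eq)) ⟩
          false               ≡⟨ eq ⟨
          out x               ∎
          where open ≡.≡-Reasoning

-- The rotation of a finite cycle

rotate : ∀ {n} → Fin (suc n) → Fin (suc n)
rotate {n} i with toℕ i <? n
... | yes lt = fromℕ< (s≤s lt)
... | no _ = zero

rotate-suc : ∀ {n} {i : Fin (suc n)} → toℕ i < n → toℕ (rotate i) ≡ suc (toℕ i)
rotate-suc {n} {i} lt with toℕ i <? n
... | yes lt′ = Finₚ.toℕ-fromℕ< (s≤s lt′)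
... | no ≮ = ⊥-elim (≮ lt)

rotate-last : ∀ {n} {i : Fin (suc n)} → toℕ i ≡ n → rotate i ≡ zero
rotate-last {n} {i} eq with toℕ i <? n
... | yes lt = contradiction eq (ℕₚ.<⇒≢ lt)
... | no _ = refl

last-or : ∀ {n} (i : Fin (suc n)) → toℕ i < n ⊎ toℕ i ≡ n
last-or i = ℕₚ.m≤n⇒m<n∨m≡n (ℕₚ.≤-pred (Finₚ.toℕ<n i))

rotate-injects : ∀ {n} → Injects (rotate {n})
rotate-injects {n} {i} {j} eq with last-or i | last-or j
... | inj₁ p | inj₁ q = Finₚ.toℕ-injective (ℕₚ.suc-injective
      (trans (sym (rotate-suc p)) (trans (cong toℕ eq) (rotate-suc q))))
... | inj₁ p | inj₂ q with () ← trans (sym (rotate-suc p)) (cong toℕ (trans eq (rotate-last q)))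
... | inj₂ p | inj₁ q with () ← trans (sym (rotate-suc q)) (cong toℕ (trans (sym eq) (rotate-last p)))
... | inj₂ p | inj₂ q = Finₚ.toℕ-injective (trans p (sym q))

rot : ∀ n → Permutation′ (suc n)
rot n = injection⇒permutation rotate rotate-injects

-- Plane trees, encoded by binary trees

data Bin : Set where
  leaf : Bin
  bin : Bin → Bin → Bin

nodes : Bin → ℕ
nodes leaf = 0
nodes (bin f g) = suc (nodes f + nodes g)

data Node : Bin → Set where
  here : ∀ {f g} → Node (bin f g)
  left : ∀ {f g} → Node f → Node (bin f g)
  right : ∀ {f g} → Node g → Node (bin f g)

-- Each node k carries an edge of the plane tree with half-edges (k , true), at the parent, and
-- (k , false), at the child; nothing is the leg, at the root vertex. Right descendants continue
-- with the edges at the same parent, left descendants with those at the child.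
Half : Bin → Set
Half t = Maybe (Node t × Bool)

Vertex : Bin → Set
Vertex t = Maybe (Node t)

-- The leg of a subtree marks where its root vertex is attached. For the left subtree this is the
-- child end of the top edge; the right subtree shares the root vertex of the whole tree and keeps
-- its leg.
embL : ∀ {f g} → Half f → Half (bin f g)
embL nothing = just (here , false)
embL (just (k , b)) = just (left k , b)

embR : ∀ {f g} → Half g → Half (bin f g)
embR nothing = nothing
embR (just (k , b)) = just (right k , b)

top : ∀ t → Half t
top leaf = nothing
top (bin f g) = just (here , true)

next : ∀ {t} → Node t → Bool → Half t
next {bin f g} here true = embR (top g)
next {bin f g} here false = embL (top f)
next (left k) b = embL (next k b)
next (right k) b = embR (next k b)

τ : ∀ {t} → Half t → Half t
τ {t} nothing = top t
τ (just (k , b)) = next k b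

opp : ∀ {t} → Half t → Half t
opp nothing = nothing
opp (just (k , b)) = just (k , not b)

outward : ∀ {t} → Half t → Bool
outward nothing = false
outward (just (_ , b)) = b

-- A vertex other than the root is named by the edge to its parent. `ιI a` lies at `a` and ends its
-- piece, while `ιO a` is the half-edge at the parent from which the contour goes down to `a`. For
-- the root vertex both are the leg.
ιI ιO : ∀ {t} → Vertex t → Half t
ιI nothing = nothing
ιI (just k) = just (k , false)
ιO nothing = nothing
ιO (just k) = just (k , true)

opp-ιO : ∀ {t} (a : Vertex t) → opp (ιO a) ≡ ιI a
opp-ιO nothing = refl
opp-ιO (just _) = refl

-- The variant of `embR` for predecessors: what follows the leg in the right subtree follows the
-- parent end of the top edge in the whole tree.
upR : ∀ {f g} → Half g → Half (bin f g)
upR nothing = just (here , true)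
upR (just (k , b)) = just (right k , b)

τ-embL : ∀ {f g} (x : Half f) → τ {bin f g} (embL x) ≡ embL (τ x)
τ-embL nothing = refl
τ-embL (just _) = refl

τ-upR : ∀ {f g} (x : Half g) → τ {bin f g} (upR x) ≡ embR (τ x)
τ-upR nothing = refl
τ-upR (just _) = refl

prev : ∀ {t} → Half t → Half t
prev {leaf} _ = nothing
prev {bin f g} nothing = upR (prev nothing)
prev {bin f g} (just (here , true)) = nothing
prev {bin f g} (just (here , false)) = embL (prev nothing)
prev {bin f g} (just (left k , b)) = embL (prev (just (k , b)))
prev {bin f g} (just (right k , b)) = upR (prev (just (k , b)))

prev-embL : ∀ {f g} (x : Half f) → prev {bin f g} (embL x) ≡ embL (prev x)
prev-embL nothing = refl
prev-embL (just _) = refl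

prev-embR : ∀ {f g} (x : Half g) → prev {bin f g} (embR x) ≡ upR (prev x)
prev-embR nothing = refl
prev-embR (just _) = refl

prev-top : ∀ t → prev (top t) ≡ nothing
prev-top leaf = refl
prev-top (bin f g) = refl

prev-next : ∀ {t} (k : Node t) b → prev (next k b) ≡ just (k , b)
prev-next {bin f g} here true = trans (prev-embR (top g)) (cong upR (prev-top g))
prev-next {bin f g} here false = trans (prev-embL (top f)) (cong embL (prev-top f))
prev-next (left k) b = trans (prev-embL (next k b)) (cong embL (prev-next k b))
prev-next (right k) b = trans (prev-embR (next k b)) (cong upR (prev-next k b))

prev-τ : ∀ {t} (x : Half t) → prev (τ x) ≡ x
prev-τ {t} nothing = prev-top t
prev-τ (just (k , b)) = prev-next k b

τ-prev : ∀ {t} (x : Half t) → τ (prev x) ≡ x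
τ-prev {leaf} nothing = refl
τ-prev {leaf} (just (() , _))
τ-prev {bin f g} nothing = trans (τ-upR (prev nothing)) (cong embR (τ-prev nothing))
τ-prev {bin f g} (just (here , true)) = refl
τ-prev {bin f g} (just (here , false)) = trans (τ-embL (prev nothing)) (cong embL (τ-prev nothing))
τ-prev {bin f g} (just (left k , b)) =
  trans (τ-embL (prev (just (k , b)))) (cong embL (τ-prev (just (k , b))))
τ-prev {bin f g} (just (right k , b)) =
  trans (τ-upR (prev (just (k , b)))) (cong embR (τ-prev (just (k , b))))

τ-injects : ∀ {t} → Injects (τ {t})
τ-injects {x = x} {y} p = trans (sym (prev-τ x)) (trans (cong prev p) (prev-τ y))

vL : ∀ {f g} → Vertex f → Vertex (bin f g)
vL nothing = just here
vL (just k) = just (left k)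

vR : ∀ {f g} → Vertex g → Vertex (bin f g)
vR nothing = nothing
vR (just k) = just (right k)

owner : ∀ {t} → Node t → Bool → Vertex t
owner here true = nothing
owner here false = just here
owner (left k) b = vL (owner k b)
owner (right k) b = vR (owner k b)

vertex : ∀ {t} → Half t → Vertex t
vertex nothing = nothing
vertex (just (k , b)) = owner k b

vertex-embL : ∀ {f g} (x : Half f) → vertex {bin f g} (embL x) ≡ vL (vertex x)
vertex-embL nothing = refl
vertex-embL (just _) = refl

vertex-embR : ∀ {f g} (x : Half g) → vertex {bin f g} (embR x) ≡ vR (vertex x)
vertex-embR nothing = refl
vertex-embR (just _) = refl

vertex-top : ∀ t → vertex (top t) ≡ nothing
vertex-top leaf = refl
vertex-top (bin f g) = refl

vertex-next : ∀ {t} (k : Node t) b → vertex (next k b) ≡ owner k b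
vertex-next {bin f g} here true = trans (vertex-embR (top g)) (cong vR (vertex-top g))
vertex-next {bin f g} here false = trans (vertex-embL (top f)) (cong vL (vertex-top f))
vertex-next (left k) b = trans (vertex-embL (next k b)) (cong vL (vertex-next k b))
vertex-next (right k) b = trans (vertex-embR (next k b)) (cong vR (vertex-next k b))

vertex-ιI : ∀ {t} (a : Vertex t) → vertex (ιI a) ≡ a
vertex-ιI nothing = refl
vertex-ιI (just k) = go k
  where
  go : ∀ {t} (k : Node t) → owner k false ≡ just k
  go here = refl
  go (left k) rewrite go k = refl
  go (right k) rewrite go k = refl

vertex-τ : ∀ {t} (x : Half t) → vertex (τ x) ≡ vertex x
vertex-τ {t} nothing = vertex-top t
vertex-τ (just (k , b)) = vertex-next k b

ιI-vL : ∀ {f g} (a : Vertex f) → ιI {bin f g} (vL a) ≡ embL (ιI a)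
ιI-vL nothing = refl
ιI-vL (just _) = refl

ιI-vR : ∀ {f g} (a : Vertex g) → ιI {bin f g} (vR a) ≡ embR (ιI a)
ιI-vR nothing = refl
ιI-vR (just _) = refl

ιO-vR : ∀ {f g} (a : Vertex g) → ιO {bin f g} (vR a) ≡ embR (ιO a)
ιO-vR nothing = refl
ιO-vR (just _) = refl

-- The half-edges at a vertex form a chain of outward ones that runs into `ιI`. The equivalence is
-- left arbitrary so that the induction can pull it back along `embL` and `embR`; it is later the
-- orbit relation of the glued `σ`.
vertex-related : ∀ {t} {_~_ : Rel (Half t) 0ℓ} → IsEquivalence _~_ →
  (∀ k → just (k , true) ~ next k true) → ∀ x → ιI (vertex x) ~ x
vertex-related {t} {_~_} eqv rel nothing = IsEquivalence.refl eqv
vertex-related {t} {_~_} eqv rel (just (k , b)) = go t k b _~_ eqv rel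
  where
  go : ∀ t (k : Node t) b (_~_ : Rel (Half t) 0ℓ) → IsEquivalence _~_ →
    (∀ k → just (k , true) ~ next k true) → ιI (owner k b) ~ just (k , b)
  goV : ∀ t x (_~_ : Rel (Half t) 0ℓ) → IsEquivalence _~_ →
    (∀ k → just (k , true) ~ next k true) → ιI (vertex x) ~ x
  goR : ∀ {f g} x (_~_ : Rel (Half (bin f g)) 0ℓ) → IsEquivalence _~_ →
    (∀ k → just (k , true) ~ next k true) → ιI (vR (vertex {g} x)) ~ embR x
  goL : ∀ {f g} x (_~_ : Rel (Half (bin f g)) 0ℓ) → IsEquivalence _~_ →
    (∀ k → just (k , true) ~ next k true) → ιI (vL (vertex {f} x)) ~ embL x
  goR {f} {g} x _~_ eqv rel rewrite ιI-vR {f} {g} (vertex x) =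
    goV g x (λ y z → embR y ~ embR z) (On.isEquivalence embR eqv) (rel ∘ right)
  goL {f} {g} x _~_ eqv rel rewrite ιI-vL {f} {g} (vertex x) =
    goV f x (λ y z → embL y ~ embL z) (On.isEquivalence embL eqv) (rel ∘ left)
  goV t nothing _~_ eqv rel = IsEquivalence.refl eqv
  goV t (just (k , b)) = go t k b
  go (bin f g) here true _~_ eqv rel = IsEquivalence.sym eqv
    (IsEquivalence.trans eqv (rel here)
      (IsEquivalence.sym eqv (subst (λ a → ιI (vR a) ~ embR (top g)) (vertex-top g) (goR (top g) _~_ eqv rel))))
  go (bin f g) here false _~_ eqv rel = IsEquivalence.refl eqv
  go (bin f g) (left k) b _~_ eqv rel = goL (just (k , b)) _~_ eqv rel
  go (bin f g) (right k) b _~_ eqv rel = goR (just (k , b)) _~_ eqv rel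

-- met x is the first outward half-edge at or after x on the contour τ ∘ opp.
ahead : ∀ {t} → Node t → Vertex t
met : ∀ {t} → Half t → Vertex t

-- A contour that leaves the left subtree without meeting an outward half-edge arrives at the child
-- end of the top edge, crosses it, and goes on with the right subtree.
aheadL : ∀ {f g} → Vertex f → Vertex (bin f g)
aheadL {f} {g} nothing = vR (met (top g))
aheadL (just k) = just (left k)

ahead {bin f g} here = vR (met (top g))
ahead (left k) = aheadL (ahead k)
ahead (right k) = vR (ahead k)

met nothing = nothing
met (just (k , true)) = just k
met (just (k , false)) = ahead k

met-embL : ∀ {f g} (x : Half f) → met {bin f g} (embL x) ≡ aheadL (met x)
met-embL nothing = refl
met-embL (just (k , true)) = refl
met-embL (just (k , false)) = refl

met-embR : ∀ {f g} (x : Half g) → met {bin f g} (embR x) ≡ vR (met x)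
met-embR nothing = refl
met-embR (just (k , true)) = refl
met-embR (just (k , false)) = refl

met-next : ∀ {t} (k : Node t) → met (next k true) ≡ ahead k
met-next {bin f g} here = met-embR (top g)
met-next (left k) = trans (met-embL (next k true)) (cong aheadL (met-next k))
met-next (right k) = trans (met-embR (next k true)) (cong vR (met-next k))

met-ιO : ∀ {t} (a : Vertex t) → met (ιO a) ≡ a
met-ιO nothing = refl
met-ιO (just _) = refl

met-related : ∀ {t} {_~_ : Rel (Half t) 0ℓ} → IsEquivalence _~_ →
  (∀ k → just (k , false) ~ next k true) → ∀ x → ιO (met x) ~ x
met-related {t} {_~_} = λ eqv rel x → go t x _~_ eqv rel
  where
  go : ∀ t x (_~_ : Rel (Half t) 0ℓ) → IsEquivalence _~_ →
    (∀ k → just (k , false) ~ next k true) → ιO (met x) ~ x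
  goR : ∀ {f g} x (_~_ : Rel (Half (bin f g)) 0ℓ) → IsEquivalence _~_ →
    (∀ k → just (k , false) ~ next k true) → ιO (vR (met {g} x)) ~ embR x
  goHere : ∀ {f g} (_~_ : Rel (Half (bin f g)) 0ℓ) → IsEquivalence _~_ →
    (∀ k → just (k , false) ~ next k true) → ιO (vR (met (top g))) ~ just (here , false)
  goR {f} {g} x _~_ eqv rel rewrite ιO-vR {f} {g} (met x) =
    go g x (λ y z → embR y ~ embR z) (On.isEquivalence embR eqv) (rel ∘ right)
  goHere {g = g} _~_ eqv rel =
    IsEquivalence.trans eqv (goR (top g) _~_ eqv rel) (IsEquivalence.sym eqv (rel here))
  go t nothing _~_ eqv rel = IsEquivalence.refl eqv
  go t (just (k , true)) _~_ eqv rel = IsEquivalence.refl eqv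
  go (bin f g) (just (here , false)) = goHere
  go (bin f g) (just (right k , false)) _~_ eqv rel = goR (just (k , false)) _~_ eqv rel
  go (bin f g) (just (left k , false)) _~_ eqv rel with ahead k
       | go f (just (k , false)) (λ y z → embL y ~ embL z) (On.isEquivalence embL eqv) (rel ∘ left)
  ... | nothing | r = IsEquivalence.trans eqv (goHere _~_ eqv rel) r
  ... | just k′ | r = r

-- The next vertex in the order of first visits along the contour, which is preorder; the last
-- vertex is followed by the root.
ζ : ∀ {t} → Vertex t → Vertex t
ζ a = met (τ (ιI a))

ζ-vL : ∀ {f g} (a : Vertex f) → ζ {bin f g} (vL a) ≡ aheadL (ζ a)
ζ-vL {f} {g} a = begin
  met (τ (ιI (vL a)))    ≡⟨ cong (met ∘ τ) (ιI-vL a) ⟩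
  met (τ (embL (ιI a)))  ≡⟨ cong met (τ-embL (ιI a)) ⟩
  met (embL (τ (ιI a)))  ≡⟨ met-embL (τ (ιI a)) ⟩
  aheadL (ζ a)           ∎
  where open ≡.≡-Reasoning

-- Preorder of the binary tree is also preorder of the plane tree: the descendants of a child are on
-- the left, its later siblings on the right. With the root vertex numbered zero, `ζ` becomes
-- `rotate` for every tree.
index : ∀ {t} → Node t → Fin (nodes t)
index {bin f g} here = zero
index {bin f g} (left k) = suc (index k ↑ˡ nodes g)
index {bin f g} (right k) = suc (nodes f ↑ʳ index k)

nodeAt : ∀ {t} → Fin (nodes t) → Node t
nodeAt {bin f g} zero = here
nodeAt {bin f g} (suc i) = [ left ∘ nodeAt , right ∘ nodeAt ] (splitAt (nodes f) i)

nodeAt-index : ∀ {t} (k : Node t) → nodeAt (index k) ≡ k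
nodeAt-index {bin f g} here = refl
nodeAt-index {bin f g} (left k) rewrite Finₚ.splitAt-↑ˡ (nodes f) (index k) (nodes g) = cong left (nodeAt-index k)
nodeAt-index {bin f g} (right k) rewrite Finₚ.splitAt-↑ʳ (nodes f) (nodes g) (index k) = cong right (nodeAt-index k)

index-nodeAt : ∀ {t} (i : Fin (nodes t)) → index {t} (nodeAt i) ≡ i
index-nodeAt {bin f g} zero = refl
index-nodeAt {bin f g} (suc i) with splitAt (nodes f) i in eq
... | inj₁ j = cong suc (trans (cong (_↑ˡ nodes g) (index-nodeAt j)) (Finₚ.splitAt⁻¹-↑ˡ eq))
... | inj₂ j = cong suc (trans (cong (nodes f ↑ʳ_) (index-nodeAt j)) (Finₚ.splitAt⁻¹-↑ʳ {nodes f} eq))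

χ : ∀ {t} → Vertex t → Fin (suc (nodes t))
χ nothing = zero
χ (just k) = suc (index k)

χ⁻¹ : ∀ {t} → Fin (suc (nodes t)) → Vertex t
χ⁻¹ zero = nothing
χ⁻¹ (suc i) = just (nodeAt i)

χ⁻¹-χ : ∀ {t} (a : Vertex t) → χ⁻¹ (χ a) ≡ a
χ⁻¹-χ nothing = refl
χ⁻¹-χ (just k) = cong just (nodeAt-index k)

χ-χ⁻¹ : ∀ {t} (i : Fin (suc (nodes t))) → χ {t} (χ⁻¹ i) ≡ i
χ-χ⁻¹ zero = refl
χ-χ⁻¹ {t} (suc i) = cong suc (index-nodeAt {t} i)

pos : ∀ {t} → Vertex t → ℕ
pos a = toℕ (χ a)

pos-vL : ∀ {f g} (a : Vertex f) → pos {bin f g} (vL a) ≡ suc (pos a)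
pos-vL nothing = refl
pos-vL {g = g} (just k) = cong (2 +_) (Finₚ.toℕ-↑ˡ (index k) (nodes g))

pos-vR : ∀ {f g} (k : Node g) → pos {bin f g} (just (right k)) ≡ suc (nodes f) + pos (just k)
pos-vR {f} k = trans (cong (2 +_) (Finₚ.toℕ-↑ʳ (nodes f) (index k))) (cong suc (sym (ℕₚ.+-suc (nodes f) _)))

Advances : ∀ {t} → Vertex t → Vertex t → Set
Advances {t} a b = pos b ≡ suc (pos a) ⊎ (pos a ≡ nodes t × b ≡ nothing)

advances-vR : ∀ {f g} (k : Node g) {b} → Advances (just k) b → Advances {bin f g} (just (right k)) (vR b)
advances-vR {f} k (inj₂ (p , refl)) = inj₂ (trans (pos-vR {f} k) (cong (suc (nodes f) +_) p) , refl)
advances-vR {f} k {just k′} (inj₁ p) = inj₁ (begin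
  pos (just (right {f} k′))             ≡⟨ pos-vR {f} k′ ⟩
  suc (nodes f) + pos (just k′)         ≡⟨ cong (suc (nodes f) +_) p ⟩
  suc (nodes f) + suc (pos (just k))    ≡⟨ ℕₚ.+-suc (suc (nodes f)) _ ⟩
  suc (suc (nodes f) + pos (just k))    ≡⟨ cong suc (pos-vR {f} k) ⟨
  suc (pos (just (right {f} k)))        ∎)
  where open ≡.≡-Reasoning

advances-end : ∀ {f g} (a : Vertex f) {b : Vertex g} → pos a ≡ nodes f → Advances nothing b →
  Advances {bin f g} (vL a) (vR b)
advances-end {f} {g} a q (inj₂ (p , refl)) = inj₂ (trans (pos-vL {g = g} a)
  (cong suc (trans q (trans (sym (ℕₚ.+-identityʳ _)) (cong (nodes f +_) p)))) , refl)
advances-end {f} {g} a {just k} q (inj₁ p) = inj₁ (begin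
  pos (just (right {f} k))       ≡⟨ pos-vR {f} k ⟩
  suc (nodes f) + pos (just k)   ≡⟨ cong₂ (λ u v → suc u + v) (sym q) p ⟩
  suc (pos a) + 1                ≡⟨ ℕₚ.+-comm (suc (pos a)) 1 ⟩
  suc (suc (pos a))              ≡⟨ cong suc (pos-vL {g = g} a) ⟨
  suc (pos (vL {f} {g} a))       ∎)
  where open ≡.≡-Reasoning

advances-vL : ∀ {f g} (a : Vertex f) {b} → Advances a b → Advances {g} nothing (ζ nothing) →
  Advances {bin f g} (vL a) (aheadL b)
advances-vL a (inj₂ (p , refl)) end = advances-end a p end
advances-vL {g = g} a {just k} (inj₁ p) end = inj₁ (trans (pos-vL {g = g} (just k))
  (cong suc (trans p (sym (pos-vL {g = g} a)))))

ζ-advances : ∀ {t} (a : Vertex t) → Advances a (ζ a)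
ζ-advances {leaf} nothing = inj₂ (refl , refl)
ζ-advances {bin f g} nothing = inj₁ refl
ζ-advances {bin f g} (just here) = subst (Advances (just here)) (sym (ζ-vL nothing))
  (advances-vL nothing (ζ-advances nothing) (ζ-advances nothing))
ζ-advances {bin f g} (just (left k)) = subst (Advances (just (left k))) (sym (ζ-vL (just k)))
  (advances-vL (just k) (ζ-advances (just k)) (ζ-advances nothing))
ζ-advances {bin f g} (just (right k)) = subst (Advances (just (right k))) (sym (met-embR (next k false)))
  (advances-vR k (ζ-advances (just k)))

χ-ζ : ∀ {t} (a : Vertex t) → χ (ζ a) ≡ rotate (χ a)
χ-ζ {t} a with last-or (χ a) | ζ-advances a
... | inj₁ lt | inj₁ p = Finₚ.toℕ-injective (trans p (sym (rotate-suc lt)))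
... | inj₁ lt | inj₂ (p , _) = contradiction p (ℕₚ.<⇒≢ lt)
... | inj₂ eq | inj₂ (_ , p) = trans (cong χ p) (sym (rotate-last eq))
... | inj₂ eq | inj₁ p = contradiction (subst (_≤ nodes t) (trans p (cong suc eq)) (ℕₚ.≤-pred (Finₚ.toℕ<n (χ (ζ a))))) ℕₚ.1+n≰n

-- Both half-edges of an edge have the same rank, which exceeds that of the half-edge following the
-- edge at the parent. A left subtree is lifted so that its leg has the rank of the top edge. The
-- definition knows nothing of the gluing.
rank : ∀ {t} → Half t → ℕ
nodeRank : ∀ {t} → Node t → Bool → ℕ

rank nothing = 0
rank (just (k , b)) = nodeRank k b
nodeRank {bin f g} here _ = suc (rank (top g))
nodeRank {bin f g} (left k) b = nodeRank k b + suc (rank (top g))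
nodeRank {bin f g} (right k) b = nodeRank k b

rank-embL : ∀ {f g} (x : Half f) → rank {bin f g} (embL x) ≡ rank x + suc (rank (top g))
rank-embL nothing = refl
rank-embL (just _) = refl

rank-embR : ∀ {f g} (x : Half g) → rank {bin f g} (embR x) ≡ rank x
rank-embR nothing = refl
rank-embR (just _) = refl

rank-next : ∀ {t} (k : Node t) b → rank (next k true) < rank (just (k , b))
rank-next {bin f g} here b rewrite rank-embR {f} (top g) = ℕₚ.≤-refl
rank-next {bin f g} (left k) b rewrite rank-embL {g = g} (next k true) =
  ℕₚ.+-monoˡ-< (suc (rank (top g))) (rank-next k b)
rank-next {bin f g} (right k) b rewrite rank-embR {f} (next k true) = rank-next k b

endsOrNot : ∀ {t} (x : Half t) → (∃ λ k → x ≡ just (k , true)) ⊎ (∃ λ a → x ≡ ιI a)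
endsOrNot nothing = inj₂ (nothing , refl)
endsOrNot (just (k , true)) = inj₁ (k , refl)
endsOrNot (just (k , false)) = inj₂ (just k , refl)

startsOrNot : ∀ {t} (x : Half t) → (∃ λ k → x ≡ just (k , false)) ⊎ (∃ λ a → x ≡ ιO a)
startsOrNot nothing = inj₂ (nothing , refl)
startsOrNot (just (k , false)) = inj₁ (k , refl)
startsOrNot (just (k , true)) = inj₂ (just k , refl)

ιI-injects : ∀ {t} → Injects (ιI {t})
ιI-injects {x = nothing} {nothing} _ = refl
ιI-injects {x = just _} {just _} refl = refl

-- The number of nodes is fixed through an equation, so that permutations of one type
-- `Permutation′ (suc n)` act on the vertices of all trees with n nodes.
vertexAt : ∀ {t n} → nodes t ≡ n → Fin (suc n) → Vertex t
vertexAt refl = χ⁻¹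

number : ∀ {t n} → nodes t ≡ n → Vertex t → Fin (suc n)
number refl = χ

number-vertexAt : ∀ {t n} (eq : nodes t ≡ n) i → number {t} eq (vertexAt eq i) ≡ i
number-vertexAt {t} refl = χ-χ⁻¹ {t}

vertexAt-number : ∀ {t n} (eq : nodes t ≡ n) a → vertexAt {t} eq (number eq a) ≡ a
vertexAt-number refl = χ⁻¹-χ

vertexAt-injects : ∀ {t n} (eq : nodes t ≡ n) → Injects (vertexAt {t} eq)
vertexAt-injects {t} eq {i} {j} p =
  trans (sym (number-vertexAt {t} eq i)) (trans (cong (number eq) p) (number-vertexAt {t} eq j))

number-ζ : ∀ {t n} (eq : nodes t ≡ n) (a : Vertex t) → number eq (ζ a) ≡ rotate (number eq a)
number-ζ refl = χ-ζ

-- Cutting a legged map into a plane tree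

module Cut {N} (L : Legged N) (O : Legged.Orientation L) where
  open Legged L
  open Orientation O

  σ′ : Fin N → Fin N
  σ′ = σ ⟨$⟩ʳ_

  Start : Fin N → Set
  Start x = out (σ ⟨$⟩ˡ x) ≡ false

  start-in : ∀ {x} → Start (σ′ x) → out x ≡ false
  start-in {x} p = trans (cong out (sym (Perm.inverseˡ σ))) p

  in-start : ∀ {x} → out x ≡ false → Start (σ′ x)
  in-start {x} p = trans (cong out (Perm.inverseˡ σ)) p

  -- Emb t x y: t encodes the part of the plane tree at and below the half-edges from x to y, the
  -- end of a piece; s is where the piece of the child α x begins.
  data Emb : Bin → Fin N → Fin N → Set where
    leaf : ∀ {x} → out x ≡ false → Emb leaf x x
    bin : ∀ {f g s x y} → out x ≡ true → Start s → Emb f s (α x) → Emb g (σ′ x) y → Emb (bin f g) x y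

  ψ : ∀ {t x y} → Emb t x y → Half t → Fin N
  ψ {y = y} e nothing = y
  ψ {x = x} (bin _ _ _ _) (just (here , true)) = x
  ψ {x = x} (bin _ _ _ _) (just (here , false)) = α x
  ψ (bin _ _ e _) (just (left k , b)) = ψ e (just (k , b))
  ψ (bin _ _ _ e) (just (right k , b)) = ψ e (just (k , b))

  module _ {f g s x y} {p : out x ≡ true} {q : Start s} {ef : Emb f s (α x)} {eg : Emb g (σ′ x) y} where

    ψ-embL : ∀ z → ψ (bin p q ef eg) (embL z) ≡ ψ ef z
    ψ-embL nothing = refl
    ψ-embL (just _) = refl

    ψ-embR : ∀ z → ψ (bin p q ef eg) (embR z) ≡ ψ eg z
    ψ-embR nothing = refl
    ψ-embR (just _) = refl

  ψ-top : ∀ {t x y} (e : Emb t x y) → ψ e (top t) ≡ x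
  ψ-top (leaf _) = refl
  ψ-top (bin _ _ _ _) = refl

  ψ-next : ∀ {t x y} (e : Emb t x y) k → ψ e (next k true) ≡ σ′ (ψ e (just (k , true)))
  ψ-next (bin {f} {g} p q ef eg) here = trans (ψ-embR {f} {g} {p = p} {q} {ef} {eg} (top g)) (ψ-top eg)
  ψ-next (bin p q ef eg) (left k) = trans (ψ-embL (next k true)) (ψ-next ef k)
  ψ-next (bin p q ef eg) (right k) = trans (ψ-embR (next k true)) (ψ-next eg k)

  ψ-α : ∀ {t x y} (e : Emb t x y) k → ψ e (just (k , false)) ≡ α (ψ e (just (k , true)))
  ψ-α (bin p q ef eg) here = refl
  ψ-α (bin p q ef eg) (left k) = ψ-α ef k
  ψ-α (bin p q ef eg) (right k) = ψ-α eg k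

  ψ-out-true : ∀ {t x y} (e : Emb t x y) k → out (ψ e (just (k , true))) ≡ true
  ψ-out-true (bin p q ef eg) here = p
  ψ-out-true (bin p q ef eg) (left k) = ψ-out-true ef k
  ψ-out-true (bin p q ef eg) (right k) = ψ-out-true eg k

  ψ-out-false : ∀ {t x y} (e : Emb t x y) k → out (ψ e (just (k , false))) ≡ false
  ψ-out-false e k = trans (cong out (ψ-α e k)) (α-in (ψ-out-true e k))

  ψ-start : ∀ {t x y} (e : Emb t x y) k → Start (ψ e (next k false))
  ψ-start (bin {f} {g} p q ef eg) here = subst Start (sym (trans (ψ-embL {f} {g} {p = p} {q} {ef} {eg} (top f)) (ψ-top ef))) q
  ψ-start (bin p q ef eg) (left k) = subst Start (sym (ψ-embL (next k false))) (ψ-start ef k)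
  ψ-start (bin p q ef eg) (right k) = subst Start (sym (ψ-embR (next k false))) (ψ-start eg k)

  -- An embedding can be recognised by its local properties. This serves the glued map, whose
  -- half-edges are those of `t` from the outset.
  mkEmb : ∀ t (ψ′ : Half t → Fin N) →
    (∀ k → out (ψ′ (just (k , true))) ≡ true) → out (ψ′ nothing) ≡ false →
    (∀ k → ψ′ (next k true) ≡ σ′ (ψ′ (just (k , true)))) →
    (∀ k → ψ′ (just (k , false)) ≡ α (ψ′ (just (k , true)))) →
    (∀ k → Start (ψ′ (next k false))) →
    ∀ {x y} → ψ′ (top t) ≡ x → ψ′ nothing ≡ y → Σ (Emb t x y) λ e → ∀ z → ψ e z ≡ ψ′ z
  mkEmb leaf ψ′ o i nx al st refl refl = leaf i , λ { nothing → refl ; (just (() , _)) }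
  mkEmb (bin f g) ψ′ o i nx al st refl refl =
    bin (o here) (st here) (proj₁ ef) (proj₁ eg) , λ
      { nothing → refl
      ; (just (here , true)) → refl
      ; (just (here , false)) → sym (al here)
      ; (just (left k , b)) → proj₂ ef (just (k , b))
      ; (just (right k , b)) → proj₂ eg (just (k , b)) }
    where
    ef = mkEmb f (ψ′ ∘ embL) (o ∘ left) (trans (cong out (al here)) (α-in (o here)))
      (nx ∘ left) (al ∘ left) (st ∘ left) refl (al here)
    eg = mkEmb g (ψ′ ∘ embR) (o ∘ right) i (nx ∘ right) (al ∘ right) (st ∘ right) (nx here) refl

  data Chain : Fin N → Fin N → Set where
    done : ∀ {x} → out x ≡ false → Chain x x
    more : ∀ {x y} → out x ≡ true → Chain (σ′ x) y → Chain x y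

  chain : ∀ {t x y} → Emb t x y → Chain x y
  chain (leaf p) = done p
  chain (bin p _ _ e) = more p (chain e)

  chain-fold : ∀ {x y} → Chain x y → ∃ λ k → fold x σ′ k ≡ y × (∀ j → j < k → out (fold x σ′ j) ≡ true)
  chain-fold (done _) = 0 , refl , λ _ ()
  chain-fold {x} (more p c) with chain-fold c
  ... | k , eq , o = suc k , trans (sym (fold-suc σ′ x k)) eq , λ
        { zero _ → p ; (suc j) (s≤s j<k) → trans (cong out (sym (fold-suc σ′ x j))) (o j j<k) }

  -- Both chains are read backwards from their common end. A start is preceded by a half-edge that
  -- is not out, whereas a chain consists of out half-edges before its end, so neither chain can
  -- extend beyond the start of the other.
  start-unique : ∀ {s s′ y} → Chain s y → Chain s′ y → Start s → Start s′ → s ≡ s′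
  start-unique {s} {s′} c c′ st st′ with chain-fold c | chain-fold c′
  ... | k , eq , o | k′ , eq′ , o′ = go k k′ (trans eq (sym eq′)) o o′
    where
    late : ∀ {s s′} → Start s → ∀ k → s ≡ fold s′ σ′ (suc k) → (∀ j → j < suc k → out (fold s′ σ′ j) ≡ true) → ⊥
    late st k eq o = true≢false (o k ℕₚ.≤-refl) (start-in (subst Start eq st))
    go : ∀ k k′ → fold s σ′ k ≡ fold s′ σ′ k′ → (∀ j → j < k → out (fold s σ′ j) ≡ true) →
      (∀ j → j < k′ → out (fold s′ σ′ j) ≡ true) → s ≡ s′
    go zero zero eq o o′ = eq
    go zero (suc k′) eq o o′ = ⊥-elim (late st k′ eq o′)
    go (suc k) zero eq o o′ = ⊥-elim (late st′ k (sym eq) o)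
    go (suc k) (suc k′) eq o o′ = go k k′ (perm-injects σ eq)
      (λ j j< → o j (ℕₚ.m≤n⇒m≤1+n j<)) (λ j j< → o′ j (ℕₚ.m≤n⇒m≤1+n j<))

  bool-irrelevant : ∀ {a b : Bool} (p q : a ≡ b) → p ≡ q
  bool-irrelevant refl refl = refl

  -- Every choice is forced: `out x` decides between `leaf` and `bin`, and the start of the child
  -- piece is determined by its end `α x`. Tree, end and embedding are compared together because
  -- each depends on the previous ones.
  emb-unique : ∀ {t t′ x y y′} (e : Emb t x y) (e′ : Emb t′ x y′) →
    _≡_ {A = ∃₂ λ t y → Emb t x y} (t , y , e) (t′ , y′ , e′)
  emb-unique (leaf p) (leaf p′) = cong (λ p → _ , _ , leaf p) (bool-irrelevant p p′)
  emb-unique (leaf p) (bin p′ _ _ _) = ⊥-elim (true≢false p′ p)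
  emb-unique (bin p _ _ _) (leaf p′) = ⊥-elim (true≢false p p′)
  emb-unique (bin p q ef eg) (bin p′ q′ ef′ eg′)
    with refl ← start-unique (chain ef) (chain ef′) q q′
    with refl ← emb-unique ef ef′ | refl ← emb-unique eg eg′
    with refl ← bool-irrelevant p p′ | refl ← bool-irrelevant q q′ = refl

  module _ {t x} (e : Emb t x r) where

    ψ-r : ∀ {z} → ψ e z ≡ r → z ≡ nothing
    ψ-r {nothing} _ = refl
    ψ-r {just (k , true)} p = ⊥-elim (out≢r (ψ-out-true e k) p)
    ψ-r {just (k , false)} p = ⊥-elim (α≢r (out≢r (ψ-out-true e k)) (trans (sym (ψ-α e k)) p))

    -- The orientation separates parent ends from child ends. For two of the same kind, `σ`, after
    -- `α` for child ends, leads to their `next`, which has smaller rank in the tree; `τ` being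
    -- injective, the induction returns.
    ψ-injects : Injects (ψ e)
    ψ-injects {z} {w} = go (rank z) z w ℕₚ.≤-refl
      where
      step-back : ∀ {k l : Node t} {b} → next k true ≡ next l true → just (k , b) ≡ just (l , b)
      step-back {k} {l} p with refl ← τ-injects {x = just (k , true)} {just (l , true)} p = refl
      go : ∀ m z w → rank z ≤ m → ψ e z ≡ ψ e w → z ≡ w
      go m nothing w le p = sym (ψ-r (sym p))
      go m (just (k , true)) nothing le p = ψ-r p
      go m (just (k , false)) nothing le p = ψ-r p
      go m (just (k , true)) (just (l , false)) le p =
        ⊥-elim (true≢false (ψ-out-true e k) (trans (cong out p) (ψ-out-false e l)))
      go m (just (k , false)) (just (l , true)) le p =
        ⊥-elim (true≢false (ψ-out-true e l) (trans (cong out (sym p)) (ψ-out-false e k)))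
      go zero (just (k , b)) (just (l , c)) le p = contradiction (ℕₚ.<-≤-trans (rank-next k b) le) λ ()
      go (suc m) (just (k , true)) (just (l , true)) le p = step-back
        (go m (next k true) (next l true) (ℕₚ.≤-pred (ℕₚ.<-≤-trans (rank-next k true) le))
          (trans (ψ-next e k) (trans (cong σ′ p) (sym (ψ-next e l)))))
      go (suc m) (just (k , false)) (just (l , false)) le p = step-back
        (go m (next k true) (next l true) (ℕₚ.≤-pred (ℕₚ.<-≤-trans (rank-next k false) le))
          (trans (ψ-next e k) (trans (cong σ′ (α-injects (trans (sym (ψ-α e k)) (trans p (ψ-α e l)))))
            (sym (ψ-next e l)))))

    ψ-opp : ∀ z → ψ e (opp z) ≡ α (ψ e z)
    ψ-opp nothing = sym α-r
    ψ-opp (just (k , true)) = ψ-α e k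
    ψ-opp (just (k , false)) = trans (sym (α-involutive _)) (cong α (sym (ψ-α e k)))

    ψ-outward : ∀ z → out (ψ e z) ≡ outward z
    ψ-outward nothing = out-r
    ψ-outward (just (k , true)) = ψ-out-true e k
    ψ-outward (just (k , false)) = ψ-out-false e k

    ψ-τ-start : Start x → ∀ a → Start (ψ e (τ (ιI a)))
    ψ-τ-start st nothing = subst Start (sym (ψ-top e)) st
    ψ-τ-start st (just k) = ψ-start e k

    module _ (st : Start x) (d : Fin N → ℕ) (ranked : Ranked d) where

      -- `σ o` is not a start, since `o` is outgoing. So its preimage is not the first half-edge of
      -- a vertex of the tree, and the tree half-edge before it is mapped to `o`.
      image-back : ∀ {o} → out o ≡ true → (∃ λ z → ψ e z ≡ σ′ o) → ∃ λ k → ψ e (just (k , true)) ≡ o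
      image-back {o} p (z , eq) with endsOrNot (prev z)
      ... | inj₁ (k , q) = k , perm-injects σ (trans (sym (ψ-next e k))
              (trans (cong (ψ e ∘ τ) (sym q)) (trans (cong (ψ e) (τ-prev z)) eq)))
      ... | inj₂ (a , q) = ⊥-elim (true≢false p (start-in
              (subst Start (trans (cong (ψ e ∘ τ) (sym q)) (trans (cong (ψ e) (τ-prev z)) eq)) (ψ-τ-start st a))))

      ψ-surjects : ∀ w → ∃ λ z → ψ e z ≡ w
      ψ-surjects w = go (d w) w ℕₚ.≤-refl
        where
        go : ∀ m w → d w ≤ m → ∃ λ z → ψ e z ≡ w
        go m w le with w Finₚ.≟ r | out w in eq
        go m w le | yes refl | _ = nothing , refl
        go zero w le | no _ | true = contradiction (ℕₚ.<-≤-trans (proj₁ (ranked eq)) le) λ ()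
        go (suc m) w le | no _ | true
          with k , p ← image-back eq (go m (σ′ w) (ℕₚ.≤-pred (ℕₚ.<-≤-trans (proj₁ (ranked eq)) le))) = just (k , true) , p
        go m w le | no w≢r | false
          with o ← α-out w≢r eq
          with lt ← subst (λ y → d (σ′ (α w)) < d y) (α-involutive w) (proj₂ (ranked o)) with m
        ... | zero = contradiction (ℕₚ.<-≤-trans lt le) λ ()
        ... | suc m′ with k , p ← image-back o (go m′ (σ′ (α w)) (ℕₚ.≤-pred (ℕₚ.<-≤-trans lt le))) =
              just (k , false) , trans (ψ-α e k) (trans (cong α p) (α-involutive w))

  module Build (d : Fin N → ℕ) (ranked : Ranked d) where

    D : ℕ
    D = proj₁ (bounded d)

    d≤D : ∀ x → d x ≤ D
    d≤D = proj₂ (bounded d)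

    chain-d : ∀ {x y} → Chain x y → d y ≤ d x
    chain-d (done _) = ℕₚ.≤-refl
    chain-d (more p c) = ℕₚ.≤-trans (chain-d c) (ℕₚ.<⇒≤ (proj₁ (ranked p)))

    -- Going backwards along outgoing half-edges increases `d`, which is bounded by `D`; `k` is the
    -- room that is left.
    startOf : ∀ k {x y} → D ≤ k + d x → Chain x y → ∃ λ s → Start s × Chain s y
    startOf k {x} le c with out (σ ⟨$⟩ˡ x) in eq
    ... | false = x , eq , c
    ... | true with lt ← subst (λ z → d z < d (σ ⟨$⟩ˡ x)) (Perm.inverseʳ σ) (proj₁ (ranked eq)) with k
    ... | zero = contradiction (ℕₚ.<-≤-trans lt (d≤D _)) (ℕₚ.≤⇒≯ le)
    ... | suc k′ = startOf k′
          (ℕₚ.≤-trans le (ℕₚ.≤-trans (ℕₚ.≤-reflexive (sym (ℕₚ.+-suc k′ (d x)))) (ℕₚ.+-monoʳ-≤ k′ lt)))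
          (more eq (subst (λ z → Chain z _) (sym (Perm.inverseʳ σ)) c))

    -- The child piece ends at `α x`, whose rank exceeds that of `σ x` and therefore that of `y`. So
    -- each descent to a child uses up some of the room `k`, while siblings are handled by recursion
    -- on the chain.
    build : ∀ k {x y} → D ≤ k + d y → Chain x y → ∃ λ t → Emb t x y
    build k le (done p) = leaf , leaf p
    build k {x} {y} le (more p c)
      with s , st , c′ ← startOf D (ℕₚ.m≤m+n D _) (done (α-in p))
      with lt ← ℕₚ.≤-<-trans (chain-d c) (proj₂ (ranked p)) with k
    ... | zero = contradiction (ℕₚ.<-≤-trans lt (d≤D _)) (ℕₚ.≤⇒≯ le)
    ... | suc k′ with f , ef ← build k′
            (ℕₚ.≤-trans le (ℕₚ.≤-trans (ℕₚ.≤-reflexive (sym (ℕₚ.+-suc k′ (d y)))) (ℕₚ.+-monoʳ-≤ k′ lt))) c′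
          | g , eg ← build (suc k′) le c = bin f g , bin p st ef eg

    whole : ∃₂ λ s t → Start s × Emb t s r
    whole with s , st , c ← startOf D (ℕₚ.m≤m+n D _) (done out-r)
      with t , e ← build D (ℕₚ.m≤m+n D _) c = s , t , st , e

-- The plane tree t and the permutation π of its vertices that glues the pieces together

record Realises {N} (L : Legged N) (O : Legged.Orientation L) {n t} (eq : nodes t ≡ n)
    (π : Permutation′ (suc n)) : Set where
  open Legged L using (r)
  open Cut L O
  field
    {start} : Fin N
    isStart : Start start
    emb : Emb t start r
    link : ∀ a → σ′ (ψ emb (ιI (vertexAt eq a))) ≡ ψ emb (τ (ιI (vertexAt eq (π ⟨$⟩ʳ a))))

module _ {N} {L : Legged N} {O : Legged.Orientation L} where
  open Legged L
  open Orientation O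
  open Cut L O

  -- The end `r` fixes the start, the start fixes the tree and its embedding, and `link` then fixes
  -- the permutation by injectivity.
  realises-unique : ∀ {n t t′} {eq : nodes t ≡ n} {eq′ : nodes t′ ≡ n} {π π′} →
    Realises L O eq π → Realises L O eq′ π′ → t ≡ t′ × π Perm.≈ π′
  realises-unique {n} {t₁} {t₂} {eq₁} {eq₂} {π} {π′} R R′ =
    unpacked eq₁ eq₂ (Realises.isStart R) (Realises.isStart R′) (Realises.emb R) (Realises.emb R′)
      (Realises.link R) (Realises.link R′)
    where
    unpacked : ∀ {t t′ x x′} (eq : nodes t ≡ n) (eq′ : nodes t′ ≡ n) → Start x → Start x′ →
      (e : Emb t x r) (e′ : Emb t′ x′ r) →
      (∀ a → σ′ (ψ e (ιI (vertexAt eq a))) ≡ ψ e (τ (ιI (vertexAt eq (π ⟨$⟩ʳ a))))) →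
      (∀ a → σ′ (ψ e′ (ιI (vertexAt eq′ a))) ≡ ψ e′ (τ (ιI (vertexAt eq′ (π′ ⟨$⟩ʳ a))))) →
      t ≡ t′ × π Perm.≈ π′
    unpacked {t} {x = x} eq eq′ st st′ e e′ link link′
      with refl ← start-unique (chain e) (chain e′) st st′
      with refl ← emb-unique e e′
      with refl ← ℕₚ.≡-irrelevant eq eq′ = refl , λ a →
        vertexAt-injects {t} eq (ιI-injects (τ-injects (ψ-injects e
          (trans (sym (link a)) (link′ a)))))

  realises-exists : ∀ (d : Fin N → ℕ) → Ranked d → ∃ λ t → ∃ λ π → Realises L O {t = t} refl π
  realises-exists d ranked with s , t , st , e ← Build.whole d ranked = t , π , record
      { isStart = st ; emb = e ; link = link }
    where
    ψ-injects′ = ψ-injects e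
    abstract
     -- The end of a piece is sent to the start of a piece, because every other half-edge already
     -- has an outgoing one as its predecessor under `σ`.
     glue : ∀ a → ∃ λ b → σ′ (ψ e (ιI a)) ≡ ψ e (τ (ιI b))
     glue a with z , p ← ψ-surjects e st d ranked (σ′ (ψ e (ιI a))) with endsOrNot (prev z)
     ... | inj₂ (b , q) = b , trans (sym p) (trans (cong (ψ e) (sym (τ-prev z))) (cong (ψ e ∘ τ) q))
     ... | inj₁ (k , q) = ⊥-elim (true≢false (ψ-out-true e k) (trans (cong out eq) (in-out a)))
       where
       in-out : ∀ a → out (ψ e (ιI a)) ≡ false
       in-out nothing = out-r
       in-out (just k) = ψ-out-false e k
       eq : ψ e (just (k , true)) ≡ ψ e (ιI a)
       eq = perm-injects σ (trans (sym (ψ-next e k))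
         (trans (cong (ψ e ∘ τ) (sym q)) (trans (cong (ψ e) (τ-prev z)) p)))
    π′ : Fin (suc (nodes t)) → Fin (suc (nodes t))
    π′ i = χ (proj₁ (glue (χ⁻¹ i)))
    π′-injects : Injects π′
    π′-injects {i} {j} p = trans (sym (χ-χ⁻¹ {t} i)) (trans (cong χ
      (ιI-injects (ψ-injects′ (perm-injects σ (begin
        σ′ (ψ e (ιI (χ⁻¹ i)))                       ≡⟨ proj₂ (glue (χ⁻¹ i)) ⟩
        ψ e (τ (ιI (proj₁ (glue (χ⁻¹ i)))))         ≡⟨ cong (ψ e ∘ τ ∘ ιI) same ⟩
        ψ e (τ (ιI (proj₁ (glue (χ⁻¹ j)))))         ≡⟨ proj₂ (glue (χ⁻¹ j)) ⟨
        σ′ (ψ e (ιI (χ⁻¹ j)))                       ∎))))) (χ-χ⁻¹ {t} j))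
      where
      open ≡.≡-Reasoning
      same : proj₁ (glue (χ⁻¹ i)) ≡ proj₁ (glue (χ⁻¹ j))
      same = trans (sym (χ⁻¹-χ (proj₁ (glue (χ⁻¹ i))))) (trans (cong χ⁻¹ p) (χ⁻¹-χ (proj₁ (glue (χ⁻¹ j)))))
    π = injection⇒permutation π′ π′-injects
    link : ∀ a → σ′ (ψ e (ιI (χ⁻¹ a))) ≡ ψ e (τ (ιI (χ⁻¹ (π′ a))))
    link a = trans (proj₂ (glue (χ⁻¹ a))) (cong (ψ e ∘ τ ∘ ιI) (sym (χ⁻¹-χ (proj₁ (glue (χ⁻¹ a))))))

  module Realised {n t} {eq : nodes t ≡ n} {π : Permutation′ (suc n)} (R : Realises L O eq π)
      (d : Fin N → ℕ) (ranked : Ranked d) where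
    open Realises R

    abstract
      ψ⁻¹ : Fin N → Half t
      ψ⁻¹ x = proj₁ (ψ-surjects emb isStart d ranked x)

      ψψ⁻¹ : ∀ x → ψ emb (ψ⁻¹ x) ≡ x
      ψψ⁻¹ x = proj₂ (ψ-surjects emb isStart d ranked x)

      ψ⁻¹ψ : ∀ z → ψ⁻¹ (ψ emb z) ≡ z
      ψ⁻¹ψ z = ψ-injects emb (ψψ⁻¹ (ψ emb z))

    Ψ : Half t ↔ Fin N
    Ψ = mk↔ₛ′ (ψ emb) ψ⁻¹ ψψ⁻¹ ψ⁻¹ψ

    σ-ιI : ∀ a → σ′ (ψ emb (ιI a)) ≡ ψ emb (τ (ιI (vertexAt eq (π ⟨$⟩ʳ number eq a))))
    σ-ιI a = trans (cong (σ′ ∘ ψ emb ∘ ιI) (sym (vertexAt-number eq a))) (link (number eq a))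

    -- Each piece is collapsed to its number. A step of `σ` inside a piece is then invisible, and
    -- `link` makes the step from the end of piece i lead to piece `π` i.
    vertices-inverse : Inverse (cycles σ) (cycles π)
    vertices-inverse = orbits-inverse {f = σ′} {g = π ⟨$⟩ʳ_} p ι
      (λ x → subst (λ x → EqClosure (Graph π) (p (σ′ x)) (p x)) (ψψ⁻¹ x) (p-σ (ψ⁻¹ x)))
      (λ i → ~trans (ι-end (vertexAt eq (π ⟨$⟩ʳ i))) (~sym (EqC.return (link i))))
      (λ i → trans (p-ψ (ιI (vertexAt eq i)))
        (trans (cong (number eq) (vertex-ιI (vertexAt eq i))) (number-vertexAt {t} eq i)))
      (λ x → subst (EqClosure (Step σ′) (ι (p x))) (ψψ⁻¹ x)
        (subst (λ a → EqClosure (Step σ′) (ψ emb (ιI a)) (ψ emb (ψ⁻¹ x))) (sym (vertexAt-number eq _))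
          (end (ψ⁻¹ x))))
      where
      p : Fin N → Fin (suc n)
      p x = number eq (vertex (ψ⁻¹ x))
      ι : Fin (suc n) → Fin N
      ι i = ψ emb (ιI (vertexAt eq i))
      p-ψ : ∀ z → p (ψ emb z) ≡ number eq (vertex z)
      p-ψ z = cong (number eq ∘ vertex) (ψ⁻¹ψ z)
      p-σ : ∀ z → EqClosure (Graph π) (p (σ′ (ψ emb z))) (p (ψ emb z))
      p-σ z with endsOrNot z
      ... | inj₁ (k , refl) = ≡⇒~ (trans (cong p (sym (ψ-next emb k)))
              (trans (p-ψ (next k true)) (trans (cong (number eq) (vertex-next k true)) (sym (p-ψ (just (k , true)))))))
      ... | inj₂ (a , refl) = ~sym (EqC.return (begin
        π ⟨$⟩ʳ p (ψ emb (ιI a))                ≡⟨ cong (π ⟨$⟩ʳ_) (trans (p-ψ (ιI a)) (cong (number eq) (vertex-ιI a))) ⟩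
        b                                      ≡⟨ number-vertexAt {t} eq b ⟨
        number eq (vertexAt eq b)              ≡⟨ cong (number eq) (trans (vertex-τ (ιI (vertexAt eq b))) (vertex-ιI _)) ⟨
        number eq (vertex (τ (ιI (vertexAt eq b)))) ≡⟨ p-ψ (τ (ιI (vertexAt eq b))) ⟨
        p (ψ emb (τ (ιI (vertexAt eq b))))     ≡⟨ cong p (σ-ιI a) ⟨
        p (σ′ (ψ emb (ιI a)))                  ∎))
        where
        open ≡.≡-Reasoning
        b = π ⟨$⟩ʳ number eq a
      end : ∀ z → EqClosure (Step σ′) (ψ emb (ιI (vertex z))) (ψ emb z)
      end = vertex-related (On.isEquivalence (ψ emb) EqC-isEquivalence)
        (λ k → EqC.return (sym (ψ-next emb k)))
      ι-end : ∀ b → EqClosure (Step σ′) (ψ emb (ιI b)) (ψ emb (τ (ιI b)))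
      ι-end b = subst (λ c → EqClosure (Step σ′) (ψ emb (ιI c)) (ψ emb (τ (ιI b))))
        (trans (vertex-τ (ιI b)) (vertex-ιI b)) (end (τ (ιI b)))

    -- Each half-edge is collapsed to the first outward one ahead of it on the contour. At a child
    -- end the face follows the contour of the tree, which is invisible. From `ιO a` it crosses to
    -- the end of piece a, and `link` moves it to the start of the piece b = `π` a, from where the
    -- next outward half-edge belongs to `ζ b`.
    faces-inverse : Inverse (orbits (σ′ ∘ α)) (cycles (π ∘ₚ rot n))
    faces-inverse = orbits-inverse {f = φ} {g = (π ∘ₚ rot n) ⟨$⟩ʳ_} p ι
      (λ x → subst (λ x → EqClosure (Graph (π ∘ₚ rot n)) (p (φ x)) (p x)) (ψψ⁻¹ x) (p-φ (ψ⁻¹ x)))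
      ι-φ
      (λ i → trans (p-ψ (ιO (vertexAt eq i)))
        (trans (cong (number eq) (met-ιO (vertexAt eq i))) (number-vertexAt {t} eq i)))
      (λ x → subst (EqClosure (Step φ) (ι (p x))) (ψψ⁻¹ x)
        (subst (λ a → EqClosure (Step φ) (ψ emb (ιO a)) (ψ emb (ψ⁻¹ x))) (sym (vertexAt-number eq _))
          (end (ψ⁻¹ x))))
      where
      φ : Fin N → Fin N
      φ = σ′ ∘ α
      p : Fin N → Fin (suc n)
      p x = number eq (met (ψ⁻¹ x))
      ι : Fin (suc n) → Fin N
      ι i = ψ emb (ιO (vertexAt eq i))
      p-ψ : ∀ z → p (ψ emb z) ≡ number eq (met z)
      p-ψ z = cong (number eq ∘ met) (ψ⁻¹ψ z)
      φ-ιO : ∀ a → φ (ψ emb (ιO a)) ≡ ψ emb (τ (ιI (vertexAt eq (π ⟨$⟩ʳ number eq a))))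
      φ-ιO a = trans (cong σ′ (trans (sym (ψ-opp emb (ιO a))) (cong (ψ emb) (opp-ιO a)))) (σ-ιI a)
      φ-false : ∀ k → φ (ψ emb (just (k , false))) ≡ ψ emb (next k true)
      φ-false k = trans (cong σ′ (sym (ψ-opp emb (just (k , false))))) (sym (ψ-next emb k))
      p-φ : ∀ z → EqClosure (Graph (π ∘ₚ rot n)) (p (φ (ψ emb z))) (p (ψ emb z))
      p-φ z with startsOrNot z
      ... | inj₁ (k , refl) = ≡⇒~ (trans (cong p (φ-false k))
              (trans (p-ψ (next k true)) (trans (cong (number eq) (met-next k)) (sym (p-ψ (just (k , false)))))))
      ... | inj₂ (a , refl) = ~sym (EqC.return (begin
        rotate (π ⟨$⟩ʳ p (ψ emb (ιO a)))       ≡⟨ cong (λ i → rotate (π ⟨$⟩ʳ i)) (trans (p-ψ (ιO a)) (cong (number eq) (met-ιO a))) ⟩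
        rotate b                               ≡⟨ cong rotate (number-vertexAt {t} eq b) ⟨
        rotate (number eq (vertexAt eq b))     ≡⟨ number-ζ eq (vertexAt eq b) ⟨
        number eq (ζ (vertexAt eq b))          ≡⟨ p-ψ (τ (ιI (vertexAt eq b))) ⟨
        p (ψ emb (τ (ιI (vertexAt eq b))))     ≡⟨ cong p (φ-ιO a) ⟨
        p (φ (ψ emb (ιO a)))                   ∎))
        where
        open ≡.≡-Reasoning
        b = π ⟨$⟩ʳ number eq a
      end : ∀ z → EqClosure (Step φ) (ψ emb (ιO (met z))) (ψ emb z)
      end = met-related (On.isEquivalence (ψ emb) EqC-isEquivalence)
        (λ k → EqC.return (φ-false k))
      ι-φ : ∀ i → EqClosure (Step φ) (ι (rotate (π ⟨$⟩ʳ i))) (ι i)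
      ι-φ i = ~trans (subst (λ a → EqClosure (Step φ) (ψ emb (ιO a)) (ψ emb (τ (ιI b))))
          (sym (trans (cong (vertexAt eq) (trans (cong rotate (sym (number-vertexAt {t} eq (π ⟨$⟩ʳ i)))) (sym (number-ζ eq b))))
            (vertexAt-number eq (ζ b))))
          (end (τ (ιI b))))
        (~sym (EqC.return (trans (φ-ιO (vertexAt eq i)) (cong (ψ emb ∘ τ ∘ ιI ∘ vertexAt eq ∘ (π ⟨$⟩ʳ_)) (number-vertexAt {t} eq i)))))
        where b = vertexAt eq (π ⟨$⟩ʳ i)

-- Isomorphisms of legged maps and their codes

record LegIso {N N′} (L : Legged N) (L′ : Legged N′) : Set where
  private
    module L = Legged L
    module L′ = Legged L′
  field
    φ : Fin N → Fin N′
    φ-injects : Injects φ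
    φ-σ : ∀ x → φ (L.σ ⟨$⟩ʳ x) ≡ L′.σ ⟨$⟩ʳ φ x
    φ-α : ∀ x → φ (L.α x) ≡ L′.α (φ x)
    φ-r : φ L.r ≡ L′.r

  φ-σ⁻¹ : ∀ x → φ (L.σ ⟨$⟩ˡ x) ≡ L′.σ ⟨$⟩ˡ φ x
  φ-σ⁻¹ x = trans (sym (Perm.inverseˡ L′.σ)) (cong (L′.σ ⟨$⟩ˡ_)
    (trans (sym (φ-σ _)) (cong φ (Perm.inverseʳ L.σ))))

module _ {N N′} {L : Legged N} {L′ : Legged N′} {O : Legged.Orientation L} {O′ : Legged.Orientation L′}
    (i : LegIso L L′)
    (φ-out : ∀ x → Legged.Orientation.out O′ (LegIso.φ i x) ≡ Legged.Orientation.out O x) where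
  open LegIso i
  private
    module C = Cut L O
    module C′ = Cut L′ O′

  start-map : ∀ {x} → C.Start x → C′.Start (φ x)
  start-map {x} p = trans (cong (Legged.Orientation.out O′) (sym (φ-σ⁻¹ x))) (trans (φ-out _) p)

  emb-map : ∀ {t x y x′} → C.Emb t x y → φ x ≡ x′ → C′.Emb t x′ (φ y)
  emb-map (C.leaf p) refl = C′.leaf (trans (φ-out _) p)
  emb-map (C.bin p q ef eg) refl = C′.bin (trans (φ-out _) p) (start-map q)
    (subst (C′.Emb _ _) (φ-α _) (emb-map ef refl)) (emb-map eg (φ-σ _))

  ψ-map : ∀ {t x y x′} (e : C.Emb t x y) (p : φ x ≡ x′) z → C′.ψ (emb-map e p) z ≡ φ (C.ψ e z)
  ψ-map (C.leaf _) refl nothing = refl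
  ψ-map (C.bin _ _ _ _) refl nothing = refl
  ψ-map (C.bin _ _ _ _) refl (just (here , true)) = refl
  ψ-map (C.bin _ _ _ _) refl (just (here , false)) = sym (φ-α _)
  ψ-map (C.bin _ _ ef _) refl (just (left k , b)) =
    trans (ψ-subst (φ-α _) (emb-map ef refl) k b) (ψ-map ef refl (just (k , b)))
    where
    ψ-subst : ∀ {t x y y′} (p : y ≡ y′) (e : C′.Emb t x y) k b →
      C′.ψ (subst (C′.Emb t x) p e) (just (k , b)) ≡ C′.ψ e (just (k , b))
    ψ-subst refl e k b = refl
  ψ-map (C.bin _ _ _ eg) refl (just (right k , b)) = ψ-map eg (φ-σ _) (just (k , b))

  realises-map : ∀ {n t} {eq : nodes t ≡ n} {π} → Realises L O eq π → Realises L′ O′ eq π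
  realises-map {t = t} {eq} {π} R = record { isStart = start-map isStart
      ; emb = subst (C′.Emb t _) φ-r (emb-map emb refl)
      ; link = λ a → trans (cong (Legged.σ L′ ⟨$⟩ʳ_) (ψ′ (ιI (vertexAt eq a))))
          (trans (sym (φ-σ _)) (trans (cong φ (link a)) (sym (ψ′ (τ (ιI (vertexAt eq (π ⟨$⟩ʳ a)))))))) }
    where
    open Realises R
    ψ-subst : ∀ {t x y y′} (p : y ≡ y′) (e : C′.Emb t x y) z → C′.ψ (subst (C′.Emb t x) p e) z ≡ C′.ψ e z
    ψ-subst refl e z = refl
    ψ′ : ∀ z → C′.ψ (subst (C′.Emb t _) φ-r (emb-map emb refl)) z ≡ φ (C.ψ emb z)
    ψ′ z = trans (ψ-subst φ-r (emb-map emb refl) z) (ψ-map emb refl z)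

module _ {N N′} {L : Legged N} {L′ : Legged N′} {O : Legged.Orientation L} {O′ : Legged.Orientation L′}
    {n t} {eq : nodes t ≡ n} {π π′ : Permutation′ (suc n)} (π≈ : π Perm.≈ π′)
    (R : Realises L O eq π) (R′ : Realises L′ O′ eq π′)
    {d : Fin N → ℕ} (ranked : Legged.Orientation.Ranked O d)
    {d′ : Fin N′ → ℕ} (ranked′ : Legged.Orientation.Ranked O′ d′) where
  private
    module L = Legged L
    module L′ = Legged L′
    module R = Realised R d ranked
    module R′ = Realised R′ d′ ranked′
    open Realises
    ψ₁ = Cut.ψ L O (emb R)
    ψ₂ = Cut.ψ L′ O′ (emb R′)

  realises-bijection : Fin N ↔ Fin N′
  realises-bijection = R′.Ψ ↔-∘ ↔-sym R.Ψ

  -- Both maps are identified with the half-edges of the same tree, where `α` is `opp` and `σ` is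
  -- expressed by `τ` and the permutation alone.
  realises-iso : LegIso L L′
  realises-iso = record { φ = φ ; φ-injects = ↔-injects realises-bijection
      ; φ-σ = λ x → subst (λ x → φ (L.σ ⟨$⟩ʳ x) ≡ L′.σ ⟨$⟩ʳ φ x) (R.ψψ⁻¹ x) (at-σ (R.ψ⁻¹ x))
      ; φ-α = λ x → subst (λ x → φ (L.α x) ≡ L′.α (φ x)) (R.ψψ⁻¹ x) (at-α (R.ψ⁻¹ x))
      ; φ-r = φ-ψ nothing }
    where
    φ : Fin N → Fin N′
    φ x = ψ₂ (R.ψ⁻¹ x)
    φ-ψ : ∀ z → φ (ψ₁ z) ≡ ψ₂ z
    φ-ψ z = cong ψ₂ (R.ψ⁻¹ψ z)
    at-α : ∀ z → φ (L.α (ψ₁ z)) ≡ L′.α (φ (ψ₁ z))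
    at-α z = begin
      φ (L.α (ψ₁ z))     ≡⟨ cong φ (Cut.ψ-opp L O (emb R) z) ⟨
      φ (ψ₁ (opp z))     ≡⟨ φ-ψ (opp z) ⟩
      ψ₂ (opp z)         ≡⟨ Cut.ψ-opp L′ O′ (emb R′) z ⟩
      L′.α (ψ₂ z)        ≡⟨ cong L′.α (φ-ψ z) ⟨
      L′.α (φ (ψ₁ z))    ∎
      where open ≡.≡-Reasoning
    at-σ : ∀ z → φ (L.σ ⟨$⟩ʳ ψ₁ z) ≡ L′.σ ⟨$⟩ʳ φ (ψ₁ z)
    at-σ z with endsOrNot z
    ... | inj₁ (k , refl) = begin
      φ (L.σ ⟨$⟩ʳ ψ₁ (just (k , true)))   ≡⟨ cong φ (Cut.ψ-next L O (emb R) k) ⟨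
      φ (ψ₁ (next k true))                ≡⟨ φ-ψ (next k true) ⟩
      ψ₂ (next k true)                    ≡⟨ Cut.ψ-next L′ O′ (emb R′) k ⟩
      L′.σ ⟨$⟩ʳ ψ₂ (just (k , true))      ≡⟨ cong (L′.σ ⟨$⟩ʳ_) (φ-ψ (just (k , true))) ⟨
      L′.σ ⟨$⟩ʳ φ (ψ₁ (just (k , true)))  ∎
      where open ≡.≡-Reasoning
    ... | inj₂ (a , refl) = begin
      φ (L.σ ⟨$⟩ʳ ψ₁ (ιI a))                                    ≡⟨ cong φ (R.σ-ιI a) ⟩
      φ (ψ₁ (τ (ιI (vertexAt eq (π ⟨$⟩ʳ number eq a)))))        ≡⟨ φ-ψ (τ (ιI (vertexAt eq (π ⟨$⟩ʳ number eq a)))) ⟩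
      ψ₂ (τ (ιI (vertexAt eq (π ⟨$⟩ʳ number eq a))))            ≡⟨ cong (ψ₂ ∘ τ ∘ ιI ∘ vertexAt eq) (π≈ (number eq a)) ⟩
      ψ₂ (τ (ιI (vertexAt eq (π′ ⟨$⟩ʳ number eq a))))           ≡⟨ R′.σ-ιI a ⟨
      L′.σ ⟨$⟩ʳ ψ₂ (ιI a)                                       ≡⟨ cong (L′.σ ⟨$⟩ʳ_) (φ-ψ (ιI a)) ⟨
      L′.σ ⟨$⟩ʳ φ (ψ₁ (ιI a))                                   ∎
      where open ≡.≡-Reasoning

  realises-iso-out : ∀ x → Legged.Orientation.out O′ (LegIso.φ realises-iso x) ≡ Legged.Orientation.out O x
  realises-iso-out x = begin
    Legged.Orientation.out O′ (ψ₂ (R.ψ⁻¹ x))  ≡⟨ Cut.ψ-outward L′ O′ (emb R′) (R.ψ⁻¹ x) ⟩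
    outward (R.ψ⁻¹ x)                         ≡⟨ Cut.ψ-outward L O (emb R) (R.ψ⁻¹ x) ⟨
    Legged.Orientation.out O (ψ₁ (R.ψ⁻¹ x))   ≡⟨ cong (Legged.Orientation.out O) (R.ψψ⁻¹ x) ⟩
    Legged.Orientation.out O x                ∎
    where open ≡.≡-Reasoning

-- Half-edges in pairs

double-fin : ∀ k → (Fin k × Bool) ↔ Fin (k * 2)
double-fin k = ↔-sym Finₚ.*↔× ↔-∘ (↔-id (Fin k) ×-↔ ↔-sym Finₚ.2↔Bool)

maybe-fin : {A : Set} {k : ℕ} → A ↔ Fin k → Maybe A ↔ Fin (suc k)
maybe-fin {A} {k} e = mk↔ₛ′ f g (λ { zero → refl ; (suc i) → cong suc (Inverse.strictlyInverseˡ e i) })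
  (λ { nothing → refl ; (just a) → cong just (Inverse.strictlyInverseʳ e a) })
  where
  f : Maybe A → Fin (suc k)
  f nothing = zero
  f (just a) = suc (Inverse.to e a)
  g : Fin (suc k) → Maybe A
  g zero = nothing
  g (suc i) = just (Inverse.from e i)

halves : ∀ {t n} → nodes t ≡ n → Half t ↔ Fin (suc (n * 2))
halves {t} refl = maybe-fin (double-fin (nodes t) ↔-∘ (mk↔ₛ′ index nodeAt (index-nodeAt {t}) nodeAt-index ×-↔ ↔-id Bool))

halves-nothing : ∀ {t n} (eq : nodes t ≡ n) → Inverse.to (halves {t} eq) nothing ≡ zero
halves-nothing refl = refl

module Pairs {m} (α : Permutation′ m) (inv : ∀ h → α ⟨$⟩ʳ (α ⟨$⟩ʳ h) ≡ h) (fixfree : ∀ h → α ⟨$⟩ʳ h ≢ h) where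

  same-pair : ∀ {x y} → EqClosure (Graph α) x y → x ≡ y ⊎ α ⟨$⟩ʳ x ≡ y
  same-pair = EqC.fold {S = λ x y → x ≡ y ⊎ α ⟨$⟩ʳ x ≡ y} {R = Graph α} (record
    { refl = inj₁ refl
    ; sym = λ { (inj₁ refl) → inj₁ refl ; {x} (inj₂ refl) → inj₂ (inv x) }
    ; trans = λ { (inj₁ refl) q → q ; {x} (inj₂ refl) (inj₁ refl) → inj₂ refl
                ; {x} (inj₂ refl) (inj₂ refl) → inj₁ (sym (inv x)) } }) inj₂

  pairs-double : ∀ {k} → HasSize (cycles α) k → m ≡ k * 2
  pairs-double {k} e = sym (Perm.↔⇒≡ (bijection half half-injects half-surjects ↔-∘ ↔-sym (double-fin k)))
    where
    open Inverse e
    half : Fin k × Bool → Fin m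
    half (i , true) = from i
    half (i , false) = α ⟨$⟩ʳ from i
    pair : ∀ z → EqClosure (Graph α) (from (proj₁ z)) (half z)
    pair (i , true) = ~refl
    pair (i , false) = EqC.return refl
    same : ∀ {z w} → half z ≡ half w → proj₁ z ≡ proj₁ w
    same {z} {w} p = trans (sym (strictlyInverseˡ (proj₁ z))) (trans
      (to-cong (~trans (pair z) (~trans (≡⇒~ p) (~sym (pair w))))) (strictlyInverseˡ (proj₁ w)))
    half-injects : Injects half
    half-injects {z} {w} p with same {z} {w} p
    half-injects {i , true} {j , true} p | refl = refl
    half-injects {i , false} {j , false} p | refl = refl
    half-injects {i , true} {j , false} p | refl = ⊥-elim (fixfree _ (sym p))
    half-injects {i , false} {j , true} p | refl = ⊥-elim (fixfree _ p)
    half-surjects : ∀ h → ∃ λ z → half z ≡ h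
    half-surjects h with same-pair (strictlyInverseʳ h)
    ... | inj₁ p = (to h , true) , p
    ... | inj₂ p = (to h , false) , p

  double-pairs : ∀ {n} → m ≡ n * 2 → HasSize (cycles α) n
  double-pairs {n} eq with k , e ← cycles-size α =
    subst (HasSize (cycles α)) (ℕₚ.*-cancelʳ-≡ k n 2 (trans (sym (pairs-double e)) eq)) e

-- Covered maps and their codes

lift₀-involutive : ∀ {m} (α : Permutation′ m) → (∀ h → α ⟨$⟩ʳ (α ⟨$⟩ʳ h) ≡ h) →
  ∀ x → lift₀ α ⟨$⟩ʳ (lift₀ α ⟨$⟩ʳ x) ≡ x
lift₀-involutive α inv zero = refl
lift₀-involutive α inv (suc h) = cong suc (inv h)

lift₀-fixed : ∀ {m} (α : Permutation′ m) → (∀ h → α ⟨$⟩ʳ h ≢ h) → ∀ {x} → lift₀ α ⟨$⟩ʳ x ≡ x → x ≡ zero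
lift₀-fixed α fixfree {zero} p = refl
lift₀-fixed α fixfree {suc h} p = ⊥-elim (fixfree h (Finₚ.suc-injective p))

legMap : (M : RootedMap) → Legged (suc (RootedMap.size M))
legMap M = record
  { σ = leg σ root ; α = lift₀ α ⟨$⟩ʳ_ ; r = zero
  ; α-involutive = lift₀-involutive α α-involutive ; α-r = refl ; α-fixed = lift₀-fixed α α-fixfree }
  where open RootedMap M

extend : ∀ {m} → Subset m → Fin (suc m) → Bool
extend S zero = false
extend S (suc h) = lookup S h

-- The leg is off the submap, so the motion passes over it: inserting the leg in the motion amounts
-- to inserting it in `σ`.
leg-motion : ∀ {m} (σ α : Permutation′ m) (S : Subset m) c (μ : Permutation′ m) →
  (∀ h → μ ⟨$⟩ʳ h ≡ σ ⟨$⟩ʳ partOf (α ⟨$⟩ʳ_) (lookup S) h) →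
  ∀ x → leg μ c ⟨$⟩ʳ x ≡ leg σ c ⟨$⟩ʳ partOf (lift₀ α ⟨$⟩ʳ_) (extend S) x
leg-motion {zero} σ α S c μ eq zero = refl
leg-motion {suc m} σ α S c μ eq zero = refl
leg-motion {suc m} σ α S c μ eq (suc h) =
  trans (cong (PC.transpose zero (suc c) ∘ suc) (eq h)) (cong (leg σ c ⟨$⟩ʳ_) (part h))
  where
  part : ∀ h → suc (partOf (α ⟨$⟩ʳ_) (lookup S) h) ≡ partOf (lift₀ α ⟨$⟩ʳ_) (extend S) (suc h)
  part h with lookup S h
  ... | true = refl
  ... | false = refl

connected-resp : {A : Set} {f g : A → A} → (∀ x → f x ≡ g x) → Connected (Step f) → Connected (Step g)
connected-resp eq con x y = EqC.map (λ {z} p → trans (sym (eq z)) p) (con x y)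

orbits-resp : {A : Set} {f g : A → A} → (∀ x → f x ≡ g x) → Inverse (orbits f) (orbits g)
orbits-resp {f = f} {g} eq = mkInverse {orbits f} {orbits g} (λ x → x) (λ x → x)
  (EqC.map λ {z} p → trans (sym (eq z)) p) (EqC.map λ {z} p → trans (eq z) p) (λ _ → ~refl) (λ _ → ~refl)

module Covered (A : CoveredMap) where
  open CoveredMap A renaming (map to M; sub to S) public
  open RootedMap M public
  open Motion M S (Covers.α-stable covers)

  L : Legged (suc size)
  L = legMap M

  subL : Legged.Sub L
  subL = record { s = extend S ; stable = λ { zero → refl ; (suc h) → stable-lookup h } ; s-r = refl }

  connectedL : Connected (Step (Legged.Sub.θ subL))
  connectedL = connected-resp (leg-motion σ α S root motion (λ _ → refl))
    (Equivalence.to (leg-connected motion root) (covers⇒connected covers))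

  abstract
    distanceL : Distance (Legged.Sub.θ subL) zero
    distanceL = distance _ (Legged.Sub.θ-injects subL) connectedL zero

  open Legged.FromSub L subL distanceL public using () renaming (orientation to O; ranked to O-ranked)

  RealisesA : ∀ {n t} → nodes t ≡ n → Permutation′ (suc n) → Set
  RealisesA = Realises L O

  module _ {n t} {eq : nodes t ≡ n} {π : Permutation′ (suc n)} (R : RealisesA eq π) where
    open Realised R (Distance.δ distanceL) O-ranked

    realised-size : size ≡ n * 2
    realised-size = ℕₚ.suc-injective (sym (Perm.↔⇒≡ (Ψ ↔-∘ ↔-sym (halves eq))))

    realised-vertices : HasSize vertices (cycleCount π)
    realised-vertices = hasSize-resp (invSym (legged-cells σ root))
      (hasSize-resp vertices-inverse (proj₂ (cycles-size π)))

    realised-faces : HasSize faces (cycleCount (π ∘ₚ rot n))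
    realised-faces = hasSize-resp (invSym (legged-cells (α ∘ₚ σ) root))
      (hasSize-resp (orbits-resp (leg-∘ α σ root))
        (hasSize-resp faces-inverse (proj₂ (cycles-size (π ∘ₚ rot n)))))

  edges-double : ∀ {n} → HasSize edges n → size ≡ n * 2
  edges-double = Pairs.pairs-double α α-involutive α-fixfree

  double-edges : ∀ {n} → size ≡ n * 2 → HasSize edges n
  double-edges = Pairs.double-pairs α α-involutive α-fixfree

  realised : ∀ {n} → HasSize edges n → ∃ λ t → Σ (nodes t ≡ n) λ eq → ∃ (RealisesA eq)
  realised {n} e = resize (realises-exists {L = L} {O} (Distance.δ distanceL) O-ranked)
    where
    resize′ : ∀ {t n} (eq : nodes t ≡ n) (π : Permutation′ (suc (nodes t))) → RealisesA {t = t} refl π →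
      ∃ λ t → Σ (nodes t ≡ n) λ eq → ∃ (RealisesA eq)
    resize′ {t} refl π R = t , refl , π , R
    resize : (∃ λ t → ∃ λ π → RealisesA {t = t} refl π) → ∃ λ t → Σ (nodes t ≡ n) λ eq → ∃ (RealisesA eq)
    resize (t , π , R) = resize′ {t}
      (ℕₚ.*-cancelʳ-≡ (nodes t) n 2 (trans (sym (realised-size R)) (edges-double e))) π R

-- This view and `LegSuc` confine the distinction between the two kinds of `Corner` to one place.
data LegZero {m} (π : Permutation′ m) (c : Corner m) : Set where
  none : leg π c ⟨$⟩ʳ zero ≡ zero → ¬ Fin m → LegZero π c
  some : ∀ h → corner h ≡ c → leg π c ⟨$⟩ʳ zero ≡ suc h → LegZero π c

legZero : ∀ {m} (π : Permutation′ m) c → LegZero π c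
legZero {zero} π c = none refl λ ()
legZero {suc m} π c = some c refl refl

data LegSuc {m} (π : Permutation′ m) (c : Corner m) (h : Fin m) : Set where
  before-root : corner (π ⟨$⟩ʳ h) ≡ c → leg π c ⟨$⟩ʳ suc h ≡ zero → LegSuc π c h
  elsewhere : corner (π ⟨$⟩ʳ h) ≢ c → leg π c ⟨$⟩ʳ suc h ≡ suc (π ⟨$⟩ʳ h) → LegSuc π c h

legSuc : ∀ {m} (π : Permutation′ m) c h → LegSuc π c h
legSuc {suc m} π c h with π ⟨$⟩ʳ h Finₚ.≟ c
... | yes p = before-root p (leg-root π h p)
... | no ¬p = elsewhere ¬p (leg-other π h ¬p)

corner-injects : ∀ {m} {h k : Fin m} → corner h ≡ corner k → h ≡ k
corner-injects {suc m} p = p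

leg-zero⁻¹ : ∀ {m} (π : Permutation′ m) c h → leg π c ⟨$⟩ʳ zero ≡ suc h → corner h ≡ c
leg-zero⁻¹ {suc m} π c h p = Finₚ.suc-injective (sym p)

legIso : ∀ {M N} → M ≅ N → LegIso (legMap M) (legMap N)
legIso {M} {N} i = record { φ = lift₀ φ ⟨$⟩ʳ_ ; φ-injects = perm-injects (lift₀ φ)
    ; φ-σ = at ; φ-α = λ { zero → refl ; (suc h) → cong suc (φ-α h) } ; φ-r = refl }
  where
  open _≅_ i
  module M = RootedMap M
  module N = RootedMap N
  at : ∀ x → lift₀ φ ⟨$⟩ʳ (leg M.σ M.root ⟨$⟩ʳ x) ≡ leg N.σ N.root ⟨$⟩ʳ (lift₀ φ ⟨$⟩ʳ x)
  at zero with legZero M.σ M.root | legZero N.σ N.root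
  ... | none p _ | none q _ = trans (cong (lift₀ φ ⟨$⟩ʳ_) p) (sym q)
  ... | none p ¬h | some h _ _ = ⊥-elim (¬h (φ ⟨$⟩ˡ h))
  ... | some h _ _ | none _ ¬h = ⊥-elim (¬h (φ ⟨$⟩ʳ h))
  ... | some h e p | some k e′ q = trans (cong (lift₀ φ ⟨$⟩ʳ_) p) (trans
          (cong suc (corner-injects (trans (Equivalence.to (φ-root h) e) (sym e′)))) (sym q))
  at (suc h) with legSuc M.σ M.root h | legSuc N.σ N.root (φ ⟨$⟩ʳ h)
  ... | before-root _ p | before-root _ q = trans (cong (lift₀ φ ⟨$⟩ʳ_) p) (sym q)
  ... | elsewhere _ p | elsewhere _ q =
          trans (cong (lift₀ φ ⟨$⟩ʳ_) p) (trans (cong suc (φ-σ h)) (sym q))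
  ... | before-root e _ | elsewhere ¬e _ = ⊥-elim (¬e
          (trans (cong corner (sym (φ-σ h))) (Equivalence.to (φ-root _) e)))
  ... | elsewhere ¬e _ | before-root e _ = ⊥-elim (¬e
          (Equivalence.from (φ-root _) (trans (cong corner (φ-σ h)) e)))

-- The root is recognised as the half-edge that follows the leg, so an isomorphism fixing the leg
-- preserves it. Only the half-edge before the root needs care for `σ`, as the leg interrupts the
-- vertex there.
unlegIso : ∀ {M N} (i : LegIso (legMap M) (legMap N)) →
  (∀ y → ∃ λ x → LegIso.φ i x ≡ y) → Σ (M ≅ N) λ j → ∀ h → LegIso.φ i (suc h) ≡ suc (_≅_.φ j ⟨$⟩ʳ h)
unlegIso {M} {N} i sur = record { φ = φ′ ; φ-σ = at ; φ-α = at-α ; φ-root = at-root } , φ-suc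
  where
  open LegIso i
  module M = RootedMap M
  module N = RootedMap N
  Φ : Permutation (suc M.size) (suc N.size)
  Φ = bijection φ φ-injects sur
  φ′ : Permutation M.size N.size
  φ′ = Perm.remove zero Φ
  φ-suc : ∀ h → φ (suc h) ≡ suc (φ′ ⟨$⟩ʳ h)
  φ-suc h = sym (Perm.lift₀-remove Φ φ-r (suc h))
  at-α : ∀ h → φ′ ⟨$⟩ʳ (M.α ⟨$⟩ʳ h) ≡ N.α ⟨$⟩ʳ (φ′ ⟨$⟩ʳ h)
  at-α h = Finₚ.suc-injective (trans (sym (φ-suc _)) (trans (φ-α (suc h)) (cong (lift₀ N.α ⟨$⟩ʳ_) (φ-suc h))))
  at-root : ∀ h → corner h ≡ M.root ⇔ corner (φ′ ⟨$⟩ʳ h) ≡ N.root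
  at-root h = mk⇔
    (λ e → leg-zero⁻¹ N.σ N.root _ (trans (cong (leg N.σ N.root ⟨$⟩ʳ_) (sym φ-r))
      (trans (sym (φ-σ zero)) (trans (cong φ (leg-zero M.σ h e)) (φ-suc h)))))
    (λ e → leg-zero⁻¹ M.σ M.root _ (φ-injects (trans (φ-σ zero) (trans (cong (leg N.σ N.root ⟨$⟩ʳ_) φ-r)
      (trans (leg-zero N.σ _ e) (sym (φ-suc h)))))))
  σ-suc : ∀ h → φ (leg M.σ M.root ⟨$⟩ʳ suc h) ≡ leg N.σ N.root ⟨$⟩ʳ suc (φ′ ⟨$⟩ʳ h)
  σ-suc h = trans (φ-σ (suc h)) (cong (leg N.σ N.root ⟨$⟩ʳ_) (φ-suc h))
  at : ∀ h → φ′ ⟨$⟩ʳ (M.σ ⟨$⟩ʳ h) ≡ N.σ ⟨$⟩ʳ (φ′ ⟨$⟩ʳ h)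
  at h with legSuc M.σ M.root h | legSuc N.σ N.root (φ′ ⟨$⟩ʳ h)
  ... | before-root e _ | before-root e′ _ =
          corner-injects (trans (Equivalence.to (at-root _) e) (sym e′))
  ... | elsewhere _ p | elsewhere _ q = Finₚ.suc-injective
          (trans (sym (φ-suc _)) (trans (cong φ (sym p)) (trans (σ-suc h) q)))
  ... | before-root _ p | elsewhere _ q
          with () ← trans (sym q) (trans (sym (σ-suc h)) (trans (cong φ p) φ-r))
  ... | elsewhere _ p | before-root _ q
          with () ← trans (sym q) (trans (sym (σ-suc h)) (trans (cong φ p) (φ-suc _)))

module _ {N N′} {L : Legged N} {L′ : Legged N′} (S : Legged.Sub L) (S′ : Legged.Sub L′)
    (D : Distance (Legged.Sub.θ S) (Legged.r L)) (D′ : Distance (Legged.Sub.θ S′) (Legged.r L′))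
    (i : LegIso L L′) where
  private
    module L = Legged L
    module L′ = Legged L′
    module B = L.Sub S
    module B′ = L′.Sub S′
    module F = L.FromSub S D
    module F′ = L′.FromSub S′ D′
  open LegIso i

  private
    φ-part : ∀ b x → φ (if b then L.α x else x) ≡ (if b then L′.α (φ x) else φ x)
    φ-part true x = φ-α x
    φ-part false x = refl

  out-natural : (∀ x → B′.s (φ x) ≡ B.s x) → ∀ x → F′.out (φ x) ≡ F.out x
  out-natural same x = cong₂ _xor_ (same x)
    (cong₂ (λ a b → does (a <? b)) (δ-φ x) (trans (cong (Distance.δ D′) (sym (φ-α x))) (δ-φ (L.α x))))
    where
    φ-θ : ∀ x → φ (B.θ x) ≡ B′.θ (φ x)
    φ-θ x = trans (φ-σ _) (cong (L′.σ ⟨$⟩ʳ_) (trans (φ-part (B.s x) x)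
      (cong (λ b → if b then L′.α (φ x) else φ x) (sym (same x)))))
    δ-φ : ∀ x → Distance.δ D′ (φ x) ≡ Distance.δ D x
    δ-φ = distance-natural Finₚ._≟_ D D′ φ φ-injects φ-r φ-θ

  -- The submap `S′` and its distance are pulled back along `φ`. By hypothesis the pulled-back
  -- submap induces the same orientation as `S`, so `sub-unique` applies.
  sub-natural : Connected (Step B.θ) → (∀ x → F′.out (φ x) ≡ F.out x) → ∀ x → B′.s (φ x) ≡ B.s x
  sub-natural con same x = sym (L.sub-unique S S″ D D″ con
      (λ x → trans (sym (same x)) (cong (λ y → B′.s (φ x) xor does (Distance.δ D′ (φ x) <? Distance.δ D′ y)) (sym (φ-α x)))) x)
    where
    S″ : L.Sub
    S″ = record { s = B′.s ∘ φ ; stable = λ x → trans (cong B′.s (φ-α x)) (B′.stable (φ x))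
                ; s-r = trans (cong B′.s φ-r) B′.s-r }
    φ-θ : ∀ x → φ (L.Sub.θ S″ x) ≡ B′.θ (φ x)
    φ-θ x = trans (φ-σ _) (cong (L′.σ ⟨$⟩ʳ_) (φ-part (B′.s (φ x)) x))
    D″ : Distance (L.Sub.θ S″) L.r
    D″ = record
      { δ = Distance.δ D′ ∘ φ
      ; δ-base = trans (cong (Distance.δ D′) φ-r) (Distance.δ-base D′)
      ; δ-step = λ {x} x≢r → trans (Distance.δ-step D′ (λ p → x≢r (φ-injects (trans p (sym φ-r)))))
          (cong (suc ∘ Distance.δ D′) (sym (φ-θ x)))
      ; δ-max = λ x → subst (λ y → Distance.δ D′ (φ x) ≤ Distance.δ D′ y)
          (trans (cong B′.θ (sym φ-r)) (sym (φ-θ L.r))) (Distance.δ-max D′ (φ x)) }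

module _ {A A′ : CoveredMap} where
  private
    module A = Covered A
    module A′ = Covered A′

  covered-code-unique : ∀ {n t t′} {eq : nodes t ≡ n} {eq′ : nodes t′ ≡ n} {π π′} →
    A.RealisesA eq π → A′.RealisesA eq′ π′ → A ≅ᶜ A′ → t ≡ t′ × π Perm.≈ π′
  covered-code-unique R R′ i = realises-unique
      (realises-map {L = A.L} {A′.L} {A.O} {A′.O} j
        (out-natural {L = A.L} {A′.L} A.subL A′.subL A.distanceL A′.distanceL j same) R) R′
    where
    j : LegIso A.L A′.L
    j = legIso {A.M} {A′.M} (_≅ᶜ_.iso i)
    same : ∀ x → extend A′.S (LegIso.φ j x) ≡ extend A.S x
    same zero = refl
    same (suc h) = bool-iff
      (λ p → Equivalence.to (∈⇔lookup A.S h) (Equivalence.from (_≅ᶜ_.φ-sub i h) (Equivalence.from (∈⇔lookup A′.S _) p)))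
      (λ p → Equivalence.to (∈⇔lookup A′.S _) (Equivalence.to (_≅ᶜ_.φ-sub i h) (Equivalence.from (∈⇔lookup A.S h) p)))

  same-code-covered : ∀ {n t} {eq : nodes t ≡ n} {π π′} → π Perm.≈ π′ →
    A.RealisesA eq π → A′.RealisesA eq π′ → A ≅ᶜ A′
  same-code-covered π≈ R R′ = record { iso = proj₁ j ; φ-sub = λ h → mk⇔
      (λ p → Equivalence.from (∈⇔lookup A′.S _) (trans (sym (at h)) (Equivalence.to (∈⇔lookup A.S h) p)))
      (λ p → Equivalence.from (∈⇔lookup A.S h) (trans (at h) (Equivalence.to (∈⇔lookup A′.S _) p))) }
    where
    i : LegIso A.L A′.L
    i = realises-iso π≈ R R′ (λ {x} → A.O-ranked {x}) (λ {x} → A′.O-ranked {x})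
    B = realises-bijection π≈ R R′ (λ {x} → A.O-ranked {x}) (λ {x} → A′.O-ranked {x})
    j = unlegIso {A.M} {A′.M} i (λ y → Inverse.from B y , Inverse.strictlyInverseˡ B y)
    at : ∀ h → lookup A.S h ≡ lookup A′.S (_≅_.φ (proj₁ j) ⟨$⟩ʳ h)
    at h = trans
      (sym (sub-natural {L = A.L} {A′.L} A.subL A′.subL A.distanceL A′.distanceL i A.connectedL
        (realises-iso-out π≈ R R′ (λ {x} → A.O-ranked {x}) (λ {x} → A′.O-ranked {x})) (suc h)))
      (cong (extend A′.S) (proj₂ j h))

-- From legged maps back to covered maps

transpose-left : ∀ {n} (i j : Fin n) → PC.transpose i j i ≡ j
transpose-left i j with i Finₚ.≟ i
... | yes _ = refl
... | no ¬p = ⊥-elim (¬p refl)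

-- The root has to be the successor of the leg, and a transposition takes the leg out again. The
-- hypothesis excludes the one obstruction, a leg that forms a cycle by itself beside other
-- half-edges.
unleg : ∀ {m} (σ : Permutation′ (suc m)) → (Fin m → σ ⟨$⟩ʳ zero ≢ zero) →
  ∃₂ λ (ρ : Permutation′ m) c → ∀ x → leg ρ c ⟨$⟩ʳ x ≡ σ ⟨$⟩ʳ x
unleg {zero} σ _ = Perm.id , tt , λ { zero → only (σ ⟨$⟩ʳ zero) }
  where
  only : (x : Fin 1) → zero ≡ x
  only zero = refl
unleg {suc m} σ ≢0 with σ ⟨$⟩ʳ zero in eq
... | zero = ⊥-elim (≢0 zero refl)
... | suc c = Perm.remove zero σ′ , c , λ x → trans
        (cong (PC.transpose zero (suc c)) (Perm.lift₀-remove σ′ fixed x))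
        (PC.transpose-inverse zero (suc c))
  where
  σ′ = σ ∘ₚ transpose (suc c) zero
  fixed : σ′ ⟨$⟩ʳ zero ≡ zero
  fixed = trans (cong (PC.transpose (suc c) zero) eq) (transpose-left (suc c) zero)

module Unleg {m} (σ : Permutation′ (suc m)) (α : Fin (suc m) → Fin (suc m))
    (inv : ∀ x → α (α x) ≡ x) (α-zero : α zero ≡ zero) (α-fixed : ∀ {x} → α x ≡ x → x ≡ zero) where

  legged : Legged (suc m)
  legged = record { σ = σ ; α = α ; r = zero ; α-involutive = inv ; α-r = α-zero ; α-fixed = α-fixed }

  α″ : Permutation′ m
  α″ = Perm.remove zero (involution α inv)

  α″-lift : ∀ x → lift₀ α″ ⟨$⟩ʳ x ≡ α x
  α″-lift = Perm.lift₀-remove (involution α inv) α-zero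

  α″-involutive : ∀ h → α″ ⟨$⟩ʳ (α″ ⟨$⟩ʳ h) ≡ h
  α″-involutive h = Finₚ.suc-injective (trans (α″-lift (suc (α″ ⟨$⟩ʳ h)))
    (trans (cong α (α″-lift (suc h))) (inv (suc h))))

  α″-fixfree : ∀ h → α″ ⟨$⟩ʳ h ≢ h
  α″-fixfree h p with () ← α-fixed {suc h} (trans (sym (α″-lift (suc h))) (cong suc p))

  module _ (sub : Legged.Sub legged) (con : Connected (Step (Legged.Sub.θ sub))) where
    open Legged.Sub sub

    -- Since the leg is off the submap, the motion would never leave it. A cyclic motion therefore
    -- excludes this as soon as there is another half-edge.
    stuck : σ ⟨$⟩ʳ zero ≡ zero → ∀ k → fold zero θ k ≡ zero
    stuck p zero = refl
    stuck p (suc k) = trans (cong θ (stuck p k)) (trans (θ-out s-r) p)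

    moves : Fin m → σ ⟨$⟩ʳ zero ≢ zero
    moves h p with k , e ← Orbit.~⇒reaches θ θ-injects (con zero (suc h))
      with () ← trans (sym e) (stuck p k)

    private
      σ″ = proj₁ (unleg σ moves)
      c = proj₁ (proj₂ (unleg σ moves))
      σ″-leg = proj₂ (proj₂ (unleg σ moves))

    S″ : Subset m
    S″ = tabulate (s ∘ suc)

    S″-extend : ∀ x → extend S″ x ≡ s x
    S″-extend zero = sym s-r
    S″-extend (suc h) = Vecₚ.lookup∘tabulate (s ∘ suc) h

    S″-stable : ∀ h → lookup S″ (α″ ⟨$⟩ʳ h) ≡ lookup S″ h
    S″-stable h = begin
      extend S″ (suc (α″ ⟨$⟩ʳ h))  ≡⟨ S″-extend (suc (α″ ⟨$⟩ʳ h)) ⟩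
      s (suc (α″ ⟨$⟩ʳ h))          ≡⟨ cong s (α″-lift (suc h)) ⟩
      s (α (suc h))                ≡⟨ stable (suc h) ⟩
      s (suc h)                    ≡⟨ S″-extend (suc h) ⟨
      extend S″ (suc h)            ∎
      where open ≡.≡-Reasoning

    μ : Permutation′ m
    μ = involution (partOf (α″ ⟨$⟩ʳ_) (lookup S″)) (part-involutive (α″ ⟨$⟩ʳ_) (lookup S″) α″-involutive S″-stable) ∘ₚ σ″

    μ-connected : Connected (Graph μ)
    μ-connected = Equivalence.from (leg-connected μ c) (connected-resp θ≡ con)
      where
      part≡ : ∀ x → partOf (lift₀ α″ ⟨$⟩ʳ_) (extend S″) x ≡ sw x
      part≡ x rewrite S″-extend x | α″-lift x = refl
      θ≡ : ∀ x → θ x ≡ leg μ c ⟨$⟩ʳ x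
      θ≡ x = sym (trans (leg-motion σ″ α″ S″ c μ (λ _ → refl) x)
        (trans (σ″-leg _) (cong (σ ⟨$⟩ʳ_) (part≡ x))))

    map″ : RootedMap
    map″ = record
      { size = m ; σ = σ″ ; α = α″ ; α-involutive = α″-involutive ; α-fixfree = α″-fixfree
      ; transitive = λ x y → EqC.fold {S = EqClosure (Graph σ″ ∪ Graph α″)} {R = Graph μ} EqC-isEquivalence
          (λ { {x} refl → moved x }) (μ-connected x y)
      ; root = c }
      where
      moved : ∀ x → EqClosure (Graph σ″ ∪ Graph α″) x (μ ⟨$⟩ʳ x)
      moved x with lookup S″ x
      ... | true = ~trans (EqC.return (inj₂ refl)) (EqC.return (inj₁ refl))
      ... | false = EqC.return (inj₁ refl)

    covered : CoveredMap
    covered = record { map = map″ ; sub = S″ ; covers = Motion.connected⇒covers map″ S″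
        (λ h p → Equivalence.from (∈⇔lookup S″ _) (trans (S″-stable h) (Equivalence.to (∈⇔lookup S″ h) p)))
        μ-connected }

    covered-iso : LegIso legged (legMap map″)
    covered-iso = record { φ = λ x → x ; φ-injects = λ p → p ; φ-σ = λ x → sym (σ″-leg x)
                         ; φ-α = λ x → sym (α″-lift x) ; φ-r = refl }

-- Gluing a plane tree along a permutation

module Glue {n t} (eq : nodes t ≡ n) (π : Permutation′ (suc n)) where

  Ξ : Half t ↔ Fin (suc (n * 2))
  Ξ = halves eq

  open Inverse Ξ using () renaming (to to ξ; from to ξ⁻¹; strictlyInverseˡ to ξξ⁻¹; strictlyInverseʳ to ξ⁻¹ξ)

  -- Permutes the ends of the pieces and fixes all outward half-edges. Followed by `τ`, it runs
  -- along each piece as in the tree, and passes from the end of piece a to the start of piece `π`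
  -- a.
  glue : Permutation′ (suc n) → Half t → Half t
  glue ρ (just (k , true)) = just (k , true)
  glue ρ (just (k , false)) = ιI (vertexAt eq (ρ ⟨$⟩ʳ number eq (just k)))
  glue ρ nothing = ιI (vertexAt eq (ρ ⟨$⟩ʳ number eq nothing))

  glue-ιI : ∀ ρ a → glue ρ (ιI a) ≡ ιI (vertexAt eq (ρ ⟨$⟩ʳ number eq a))
  glue-ιI ρ nothing = refl
  glue-ιI ρ (just k) = refl

  glue-inverse : ∀ ρ ρ′ → (∀ i → ρ′ ⟨$⟩ʳ (ρ ⟨$⟩ʳ i) ≡ i) → ∀ x → glue ρ′ (glue ρ x) ≡ x
  glue-inverse ρ ρ′ inv x with endsOrNot x
  ... | inj₁ (k , refl) = refl
  ... | inj₂ (a , refl) = begin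
    glue ρ′ (glue ρ (ιI a))                                            ≡⟨ cong (glue ρ′) (glue-ιI ρ a) ⟩
    glue ρ′ (ιI (vertexAt eq (ρ ⟨$⟩ʳ number eq a)))                    ≡⟨ glue-ιI ρ′ _ ⟩
    ιI (vertexAt eq (ρ′ ⟨$⟩ʳ number eq (vertexAt {t} eq (ρ ⟨$⟩ʳ number eq a))))
      ≡⟨ cong (λ i → ιI (vertexAt eq (ρ′ ⟨$⟩ʳ i))) (number-vertexAt {t} eq _) ⟩
    ιI (vertexAt eq (ρ′ ⟨$⟩ʳ (ρ ⟨$⟩ʳ number eq a)))                    ≡⟨ cong (ιI ∘ vertexAt eq) (inv _) ⟩
    ιI (vertexAt eq (number eq a))                                     ≡⟨ cong ιI (vertexAt-number eq a) ⟩
    ιI a                                                               ∎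
    where open ≡.≡-Reasoning

  σᴴ : Half t ↔ Half t
  σᴴ = mk↔ₛ′ τ prev τ-prev prev-τ ↔-∘ mk↔ₛ′ (glue π) (glue (Perm.flip π))
    (glue-inverse (Perm.flip π) π (λ _ → Perm.inverseʳ π)) (glue-inverse π (Perm.flip π) (λ _ → Perm.inverseˡ π))

  σ : Permutation′ (suc (n * 2))
  σ = Ξ ↔-∘ (σᴴ ↔-∘ ↔-sym Ξ)

  σ-ξ : ∀ x → σ ⟨$⟩ʳ ξ x ≡ ξ (τ (glue π x))
  σ-ξ x = cong (ξ ∘ τ ∘ glue π) (ξ⁻¹ξ x)

  α : Fin (suc (n * 2)) → Fin (suc (n * 2))
  α x = ξ (opp (ξ⁻¹ x))

  α-ξ : ∀ x → α (ξ x) ≡ ξ (opp x)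
  α-ξ x = cong (ξ ∘ opp) (ξ⁻¹ξ x)

  opp-involutive : (x : Half t) → opp (opp x) ≡ x
  opp-involutive nothing = refl
  opp-involutive (just (k , b)) = cong (λ b → just (k , b)) (Boolₚ.not-involutive b)

  α-inv : ∀ x → α (α x) ≡ x
  α-inv x = trans (α-ξ (opp (ξ⁻¹ x))) (trans (cong ξ (opp-involutive (ξ⁻¹ x))) (ξξ⁻¹ x))

  α-zero : α zero ≡ zero
  α-zero = trans (cong α (sym (halves-nothing eq))) (trans (α-ξ nothing) (halves-nothing eq))

  opp-fixed : (x : Half t) → opp x ≡ x → x ≡ nothing
  opp-fixed nothing _ = refl
  opp-fixed (just (k , true)) ()
  opp-fixed (just (k , false)) ()

  α-fix : ∀ {x} → α x ≡ x → x ≡ zero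
  α-fix {x} p = trans (sym (ξξ⁻¹ x)) (trans
    (cong ξ (opp-fixed (ξ⁻¹ x) (trans (sym (ξ⁻¹ξ _)) (cong ξ⁻¹ p)))) (halves-nothing eq))

  open Unleg σ α α-inv α-zero α-fix

  outᴴ : Fin (suc (n * 2)) → Bool
  outᴴ x = outward (ξ⁻¹ x)

  outᴴ-ξ : ∀ x → outᴴ (ξ x) ≡ outward x
  outᴴ-ξ x = cong outward (ξ⁻¹ξ x)

  orientation : Legged.Orientation legged
  orientation = record
    { out = outᴴ
    ; out-r = trans (cong outᴴ (sym (halves-nothing eq))) (outᴴ-ξ nothing)
    ; out-α = λ {x} x≢0 → trans (outᴴ-ξ (opp (ξ⁻¹ x))) (outward-opp (ξ⁻¹ x)
        (λ p → x≢0 (trans (sym (ξξ⁻¹ x)) (trans (cong ξ p) (halves-nothing eq))))) }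
    where
    outward-opp : (x : Half t) → x ≢ nothing → outward (opp x) ≡ not (outward x)
    outward-opp nothing ≢ = ⊥-elim (≢ refl)
    outward-opp (just _) _ = refl

  rankᴴ : Fin (suc (n * 2)) → ℕ
  rankᴴ x = rank (ξ⁻¹ x)

  -- At outward half-edges the glued `σ` is `next`, whatever `π` is, so the rank of the tree serves.
  rankedᴴ : Legged.Orientation.Ranked orientation rankᴴ
  rankedᴴ {x} = go (ξ⁻¹ x) (ξξ⁻¹ x)
    where
    go : ∀ z {x} → ξ z ≡ x → outᴴ x ≡ true → rankᴴ (σ ⟨$⟩ʳ x) < rankᴴ x × rankᴴ (σ ⟨$⟩ʳ x) < rankᴴ (α x)
    go nothing refl p = ⊥-elim (true≢false p (outᴴ-ξ nothing))
    go (just (k , false)) refl p = ⊥-elim (true≢false p (outᴴ-ξ (just (k , false))))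
    go (just (k , true)) refl p
      rewrite σ-ξ (just (k , true)) | α-ξ (just (k , true)) | ξ⁻¹ξ (next k true)
        | ξ⁻¹ξ (just (k , true)) | ξ⁻¹ξ (just (k , false)) = rank-next k true , rank-next k false

  open Legged.Explore legged orientation using () renaming (S to sub; connected to explored-connected; out-explored to explored-out)

  connectedᴴ : Connected (Step (Legged.Sub.θ sub))
  connectedᴴ = explored-connected rankᴴ (λ {x} → rankedᴴ {x})

  abstract
    D : Distance (Legged.Sub.θ sub) zero
    D = distance _ (Legged.Sub.θ-injects sub) connectedᴴ zero

  -- `orientation` is prescribed by the tree, while `O` is derived from the explored submap, as for
  -- every covered map. `out-ξ` identifies the two.
  O : Legged.Orientation legged
  O = Legged.FromSub.orientation legged sub D

  out-ξ : ∀ x → Legged.Orientation.out O (ξ x) ≡ outward x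
  out-ξ x = trans (explored-out rankᴴ (λ {x} → rankedᴴ {x}) D (ξ x)) (outᴴ-ξ x)

  open Cut legged O

  start-ξ : ∀ a → Start (ξ (τ (ιI a)))
  start-ξ a = subst Start eq′ (in-start (trans (out-ξ (ιI b)) (in-outward b)))
    where
    -- The piece of `a` is glued after that of its preimage under `π`, and the end of the latter is
    -- not outward.
    b = vertexAt eq (π ⟨$⟩ˡ number eq a)
    in-outward : ∀ (b : Vertex t) → outward (ιI b) ≡ false
    in-outward nothing = refl
    in-outward (just _) = refl
    eq′ : σ ⟨$⟩ʳ ξ (ιI b) ≡ ξ (τ (ιI a))
    eq′ = trans (σ-ξ (ιI b)) (cong (ξ ∘ τ) (trans (glue-ιI π b) (cong ιI (trans
      (cong (λ i → vertexAt eq (π ⟨$⟩ʳ i)) (number-vertexAt {t} eq _))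
      (trans (cong (vertexAt eq) (Perm.inverseʳ π)) (vertexAt-number eq a))))))

  embedding : Σ (Emb t (ξ (top t)) zero) λ e → ∀ z → ψ e z ≡ ξ z
  embedding = mkEmb t ξ (λ k → out-ξ (just (k , true))) (out-ξ nothing)
    (λ k → sym (σ-ξ (just (k , true)))) (λ k → sym (α-ξ (just (k , true))))
    (λ k → start-ξ (just k)) refl (halves-nothing eq)

  realises : Realises legged O eq π
  realises = record { isStart = start-ξ nothing ; emb = proj₁ embedding ; link = λ a → begin
      σ ⟨$⟩ʳ ψ e (ιI (vertexAt eq a))       ≡⟨ cong (σ ⟨$⟩ʳ_) (ψ≡ (ιI (vertexAt eq a))) ⟩
      σ ⟨$⟩ʳ ξ (ιI (vertexAt eq a))         ≡⟨ σ-ξ (ιI (vertexAt eq a)) ⟩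
      ξ (τ (glue π (ιI (vertexAt eq a))))   ≡⟨ cong (ξ ∘ τ) (glue-ιI π (vertexAt eq a)) ⟩
      ξ (τ (ιI (vertexAt eq (π ⟨$⟩ʳ number eq (vertexAt {t} eq a)))))
        ≡⟨ cong (λ i → ξ (τ (ιI (vertexAt eq (π ⟨$⟩ʳ i))))) (number-vertexAt {t} eq a) ⟩
      ξ (τ (ιI (vertexAt eq (π ⟨$⟩ʳ a))))   ≡⟨ ψ≡ (τ (ιI (vertexAt eq (π ⟨$⟩ʳ a)))) ⟨
      ψ e (τ (ιI (vertexAt eq (π ⟨$⟩ʳ a)))) ∎ }
    where
    open ≡.≡-Reasoning
    e = proj₁ embedding
    ψ≡ = proj₂ embedding

  glued : CoveredMap
  glued = covered sub connectedᴴ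

  abstract
    glued-realises : Covered.RealisesA glued eq π
    glued-realises = realises-map {L = legged} {Covered.L glued} {O} {Covered.O glued} i
      (out-natural {L = legged} {Covered.L glued} sub (Covered.subL glued) D (Covered.distanceL glued) i (S″-extend sub connectedᴴ))
      realises
      where
      i : LegIso legged (Covered.L glued)
      i = covered-iso sub connectedᴴ

-- Bipartite unicellular maps

toHalf : ∀ {m} (π : Permutation′ m) → Fin m → Setoid.Carrier (cells π) → Fin m
toHalf {suc m} π _ x = x

cellOf : ∀ {m} (π : Permutation′ m) → Fin m → Setoid.Carrier (cells π)
cellOf π h = cellAt π (corner h)

cellOf-toHalf : ∀ {m} (π : Permutation′ m) h x → cellOf π (toHalf π h x) ≡ x
cellOf-toHalf {suc m} π h x = refl

toHalf-cellOf : ∀ {m} (π : Permutation′ m) h k → toHalf π h (cellOf π k) ≡ k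
toHalf-cellOf {suc m} π h k = refl

cell-related : ∀ {m} (π : Permutation′ m) h {x y} → Setoid._≈_ (cells π) x y →
  EqClosure (Graph π) (toHalf π h x) (toHalf π h y)
cell-related {suc m} π h p = p

related-cell : ∀ {m} (π : Permutation′ m) {x y} → EqClosure (Graph π) x y →
  Setoid._≈_ (cells π) (cellOf π x) (cellOf π y)
related-cell {zero} π {()}
related-cell {suc m} π p = p

cornerHalf : ∀ {m} (c : Corner m) → Fin m → ∃ λ h → corner h ≡ c
cornerHalf {suc m} c _ = c , refl

surjects⇒injects′ : {A : Set} {m k : ℕ} → A ↔ Fin k → m ≡ k → (f : A → Fin m) →
  (∀ y → ∃ λ x → f x ≡ y) → Injects f
surjects⇒injects′ {k = k} e refl f sur {x} {y} p = begin
  x                            ≡⟨ Inverse.strictlyInverseʳ e x ⟨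
  Inverse.from e (Inverse.to e x)
    ≡⟨ cong (Inverse.from e) (surjects⇒injects (f ∘ Inverse.from e)
         (λ y → let x , q = sur y in Inverse.to e x , trans (cong f (Inverse.strictlyInverseʳ e x)) q)
         (trans (cong f (Inverse.strictlyInverseʳ e x)) (trans p (cong f (sym (Inverse.strictlyInverseʳ e y)))))) ⟩
  Inverse.from e (Inverse.to e y) ≡⟨ Inverse.strictlyInverseʳ e y ⟩
  y                            ∎
  where open ≡.≡-Reasoning

rotate-onto : ∀ {n} {P : Fin (suc n) → Set} → P zero → (∀ j → P j → P (rotate j)) → ∀ i → P i
rotate-onto {n} {P} base next i = go (toℕ i) i refl
  where
  go : ∀ k i → toℕ i ≡ k → P i
  go zero zero _ = base
  go (suc k) i eq = subst P i≡ (next j (go k j j≡k))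
    where
    k<n : k < n
    k<n = ℕₚ.≤-pred (subst (_< suc n) eq (Finₚ.toℕ<n i))
    j = fromℕ< (ℕₚ.m≤n⇒m≤1+n k<n)
    j≡k : toℕ j ≡ k
    j≡k = Finₚ.toℕ-fromℕ< _
    i≡ : rotate j ≡ i
    i≡ = Finₚ.toℕ-injective (trans (rotate-suc (subst (_< n) (sym j≡k) k<n)) (trans (cong suc j≡k) (sym eq)))

even-odd : {A : Set} (x : A) (u : A → A) (let u² = λ x → u (u x)) → ∀ k N → k < N * 2 →
  ∃ λ j → j < N × (fold x u k ≡ fold x u² j ⊎ fold x u k ≡ u (fold x u² j))
even-odd x u zero (suc N) _ = 0 , s≤s z≤n , inj₁ refl
even-odd x u (suc zero) (suc N) _ = 0 , s≤s z≤n , inj₂ refl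
even-odd x u (suc (suc k)) (suc N) (s≤s (s≤s lt)) with even-odd x u k N lt
... | j , j< , inj₁ e = suc j , s≤s j< , inj₁ (cong (λ x → u (u x)) e)
... | j , j< , inj₂ e = suc j , s≤s j< , inj₂ (cong (λ x → u (u x)) e)

spread : {A B : Set} → (B → B) → (A → B) → A × Bool → B
spread α w (i , true) = w i
spread α w (i , false) = α (w i)

-- w lists the half-edges at white vertices along the face, backwards from the root.
record RealisesB (M : RootedMap) {n} (π : Permutation′ (suc n)) : Set where
  open RootedMap M
  field
    w : Fin (suc n) → Fin size
    w-root : corner (w zero) ≡ root
    w-σ : ∀ i → σ ⟨$⟩ʳ w i ≡ w (π ⟨$⟩ʳ i)
    b-σ : ∀ i → σ ⟨$⟩ʳ (α ⟨$⟩ʳ w (rotate (π ⟨$⟩ʳ i))) ≡ α ⟨$⟩ʳ w i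

    W-injects : Injects (spread (α ⟨$⟩ʳ_) w)
    W-surjects : ∀ h → ∃ λ z → spread (α ⟨$⟩ʳ_) w z ≡ h

  W : Fin (suc n) × Bool → Fin size
  W = spread (α ⟨$⟩ʳ_) w

  -- The action of `σ` on indices. For black half-edges `b-σ` moves index `rotate (π i)` to `i`,
  -- which is the inverse of the permutation whose cycles are to be the black vertices.
  κ : Bool → Permutation′ (suc n)
  κ true = π
  κ false = Perm.flip (π ∘ₚ rot n)

  W-σ : ∀ i b → σ ⟨$⟩ʳ W (i , b) ≡ W (κ b ⟨$⟩ʳ i , b)
  W-σ i true = w-σ i
  W-σ i false = trans (cong (λ j → σ ⟨$⟩ʳ (α ⟨$⟩ʳ w j)) (sym (Perm.inverseʳ (π ∘ₚ rot n)))) (b-σ _)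

  W-α : ∀ i b → α ⟨$⟩ʳ W (i , b) ≡ W (i , not b)
  W-α i true = refl
  W-α i false = α-involutive (w i)

  f : Fin size → Fin size
  f h = σ ⟨$⟩ʳ (α ⟨$⟩ʳ h)

  f-injects : Injects f
  f-injects p = perm-injects α (perm-injects σ p)

  -- Two steps along the face go back by one place in the list, whatever `π` is. Hence the list is
  -- determined by the root and the face permutation, and isomorphisms preserve it.
  f² : ∀ j → f (f (w (rotate j))) ≡ w j
  f² j = begin
    f (f (w (rotate j)))           ≡⟨ cong (f ∘ f ∘ w ∘ rotate) (Perm.inverseʳ π) ⟨
    f (f (w (rotate (π ⟨$⟩ʳ i))))  ≡⟨ cong f (b-σ i) ⟩
    f (α ⟨$⟩ʳ w i)                 ≡⟨ cong (σ ⟨$⟩ʳ_) (α-involutive (w i)) ⟩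
    σ ⟨$⟩ʳ w i                     ≡⟨ w-σ i ⟩
    w (π ⟨$⟩ʳ i)                   ≡⟨ cong w (Perm.inverseʳ π) ⟩
    w j                            ∎
    where
    open ≡.≡-Reasoning
    i = π ⟨$⟩ˡ j

module _ {M M′ : RootedMap} {n} {π π′ : Permutation′ (suc n)} (R : RealisesB M π) (R′ : RealisesB M′ π′) where
  private
    module M = RootedMap M
    module M′ = RootedMap M′
    module R = RealisesB R
    module R′ = RealisesB R′

  bipartite-code-unique : M ≅ M′ → π Perm.≈ π′
  bipartite-code-unique i j = sym (cong proj₁ (R′.W-injects {π′ ⟨$⟩ʳ j , true} {π ⟨$⟩ʳ j , true} (begin
      R′.w (π′ ⟨$⟩ʳ j)               ≡⟨ R′.w-σ j ⟨
      M′.σ ⟨$⟩ʳ R′.w j               ≡⟨ cong (M′.σ ⟨$⟩ʳ_) (same j) ⟨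
      M′.σ ⟨$⟩ʳ (φ ⟨$⟩ʳ R.w j)       ≡⟨ φ-σ (R.w j) ⟨
      φ ⟨$⟩ʳ (M.σ ⟨$⟩ʳ R.w j)        ≡⟨ cong (φ ⟨$⟩ʳ_) (R.w-σ j) ⟩
      φ ⟨$⟩ʳ R.w (π ⟨$⟩ʳ j)          ≡⟨ same (π ⟨$⟩ʳ j) ⟩
      R′.w (π ⟨$⟩ʳ j)                ∎)))
    where
    open ≡.≡-Reasoning
    open _≅_ i
    φ-f : ∀ h → φ ⟨$⟩ʳ R.f h ≡ R′.f (φ ⟨$⟩ʳ h)
    φ-f h = trans (φ-σ _) (cong (M′.σ ⟨$⟩ʳ_) (φ-α h))
    same : ∀ j → φ ⟨$⟩ʳ R.w j ≡ R′.w j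
    same = rotate-onto
      (corner-injects (trans (Equivalence.to (φ-root _) R.w-root) (sym R′.w-root)))
      λ j p → R′.f-injects (R′.f-injects (begin
        R′.f (R′.f (φ ⟨$⟩ʳ R.w (rotate j)))   ≡⟨ cong R′.f (φ-f _) ⟨
        R′.f (φ ⟨$⟩ʳ R.f (R.w (rotate j)))    ≡⟨ φ-f _ ⟨
        φ ⟨$⟩ʳ R.f (R.f (R.w (rotate j)))     ≡⟨ cong (φ ⟨$⟩ʳ_) (R.f² j) ⟩
        φ ⟨$⟩ʳ R.w j                          ≡⟨ p ⟩
        R′.w j                                ≡⟨ R′.f² j ⟨
        R′.f (R′.f (R′.w (rotate j)))         ∎))

  same-code-bipartite : π Perm.≈ π′ → M ≅ M′
  same-code-bipartite π≈ = record
      { φ = φ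
      ; φ-σ = λ h → at-σ h (R.W-surjects h)
      ; φ-α = λ h → at-α h (R.W-surjects h)
      ; φ-root = λ h → mk⇔
          (λ p → trans (cong corner (trans (cong (φ ⟨$⟩ʳ_) (corner-injects (trans p (sym R.w-root)))) (φ-W (zero , true)))) R′.w-root)
          (λ p → trans (cong corner (perm-injects φ (trans (corner-injects (trans p (sym R′.w-root))) (sym (φ-W (zero , true)))))) R.w-root) }
    where
    open ≡.≡-Reasoning
    φ : Permutation M.size M′.size
    φ = bijection R′.W R′.W-injects R′.W-surjects ↔-∘ ↔-sym (bijection R.W R.W-injects R.W-surjects)
    φ-W : ∀ z → φ ⟨$⟩ʳ R.W z ≡ R′.W z
    φ-W z = cong R′.W (R.W-injects {proj₁ (R.W-surjects (R.W z))} {z} (proj₂ (R.W-surjects (R.W z))))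
    κ≈ : ∀ b i → R.κ b ⟨$⟩ʳ i ≡ R′.κ b ⟨$⟩ʳ i
    κ≈ true i = π≈ i
    κ≈ false i = perm-injects (π′ ∘ₚ rot n) (begin
      rotate (π′ ⟨$⟩ʳ (R.κ false ⟨$⟩ʳ i))   ≡⟨ cong rotate (π≈ _) ⟨
      rotate (π ⟨$⟩ʳ (R.κ false ⟨$⟩ʳ i))    ≡⟨ Perm.inverseʳ (π ∘ₚ rot n) ⟩
      i                                     ≡⟨ Perm.inverseʳ (π′ ∘ₚ rot n) ⟨
      rotate (π′ ⟨$⟩ʳ (R′.κ false ⟨$⟩ʳ i))  ∎)
    at-σ : ∀ h → (∃ λ z → R.W z ≡ h) → φ ⟨$⟩ʳ (M.σ ⟨$⟩ʳ h) ≡ M′.σ ⟨$⟩ʳ (φ ⟨$⟩ʳ h)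
    at-σ _ ((i , b) , refl) = begin
      φ ⟨$⟩ʳ (M.σ ⟨$⟩ʳ R.W (i , b))     ≡⟨ cong (φ ⟨$⟩ʳ_) (R.W-σ i b) ⟩
      φ ⟨$⟩ʳ R.W (R.κ b ⟨$⟩ʳ i , b)     ≡⟨ φ-W (R.κ b ⟨$⟩ʳ i , b) ⟩
      R′.W (R.κ b ⟨$⟩ʳ i , b)           ≡⟨ cong (λ j → R′.W (j , b)) (κ≈ b i) ⟩
      R′.W (R′.κ b ⟨$⟩ʳ i , b)          ≡⟨ R′.W-σ i b ⟨
      M′.σ ⟨$⟩ʳ R′.W (i , b)            ≡⟨ cong (M′.σ ⟨$⟩ʳ_) (φ-W (i , b)) ⟨
      M′.σ ⟨$⟩ʳ (φ ⟨$⟩ʳ R.W (i , b))    ∎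
    at-α : ∀ h → (∃ λ z → R.W z ≡ h) → φ ⟨$⟩ʳ (M.α ⟨$⟩ʳ h) ≡ M′.α ⟨$⟩ʳ (φ ⟨$⟩ʳ h)
    at-α _ ((i , b) , refl) = begin
      φ ⟨$⟩ʳ (M.α ⟨$⟩ʳ R.W (i , b))     ≡⟨ cong (φ ⟨$⟩ʳ_) (R.W-α i b) ⟩
      φ ⟨$⟩ʳ R.W (i , not b)            ≡⟨ φ-W (i , not b) ⟩
      R′.W (i , not b)                  ≡⟨ R′.W-α i b ⟨
      M′.α ⟨$⟩ʳ R′.W (i , b)            ≡⟨ cong (M′.α ⟨$⟩ʳ_) (φ-W (i , b)) ⟨
      M′.α ⟨$⟩ʳ (φ ⟨$⟩ʳ R.W (i , b))    ∎

white≢black : white ≢ black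
white≢black ()

other : Colour → Colour
other white = black
other black = white

other-≢ : ∀ {a b} → a ≢ b → b ≡ other a
other-≢ {white} {white} p = ⊥-elim (p refl)
other-≢ {white} {black} p = refl
other-≢ {black} {white} p = refl
other-≢ {black} {black} p = ⊥-elim (p refl)

other-other : ∀ a → other (other a) ≡ a
other-other white = refl
other-other black = refl

module Colouring {M : RootedMap} (c : ProperColouring M) where
  open RootedMap M
  open ProperColouring c

  hue : Fin size → Colour
  hue h = colour (vertexOf h)

  hue-σ : ∀ h → hue (σ ⟨$⟩ʳ h) ≡ hue h
  hue-σ h = Func.cong colouring (related-cell σ (~sym (EqC.return refl)))

  hue-α : ∀ h → hue (α ⟨$⟩ʳ h) ≡ other (hue h)
  hue-α h = other-≢ (proper h)

  hue-f : ∀ h → hue (σ ⟨$⟩ʳ (α ⟨$⟩ʳ h)) ≡ other (hue h)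
  hue-f h = trans (hue-σ _) (hue-α h)

  both-colours : ∀ {a b} → HasSize (verticesOfColour white) a → HasSize (verticesOfColour black) b →
    HasSize vertices (a + b)
  both-colours {a} {b} p q = hasSize-resp {S = vertices} {≡.setoid (Fin a ⊎ Fin b)}
      (mkInverse {vertices} {≡.setoid (Fin a ⊎ Fin b)} f g f-cong (λ { refl → Setoid.refl vertices }) fg gf)
      (↔-sym Finₚ.+↔⊎)
    where
    module P = Inverse p
    module Q = Inverse q
    f′ : ∀ x a → colour x ≡ a → Fin _ ⊎ Fin _
    f′ x white eq = inj₁ (P.to (x , eq))
    f′ x black eq = inj₂ (Q.to (x , eq))
    f : Setoid.Carrier vertices → Fin _ ⊎ Fin _
    f x = f′ x (colour x) refl
    g : Fin _ ⊎ Fin _ → Setoid.Carrier vertices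
    g (inj₁ i) = proj₁ (P.from i)
    g (inj₂ i) = proj₁ (Q.from i)
    f′-cong : ∀ {x y} a b (e : colour x ≡ a) (e′ : colour y ≡ b) → Setoid._≈_ vertices x y → f′ x a e ≡ f′ y b e′
    f′-cong white white e e′ r = cong inj₁ (P.to-cong r)
    f′-cong black black e e′ r = cong inj₂ (Q.to-cong r)
    f′-cong white black e e′ r = ⊥-elim (white≢black (trans (sym e) (trans (Func.cong colouring r) e′)))
    f′-cong black white e e′ r = ⊥-elim (white≢black (trans (sym e′) (trans (sym (Func.cong colouring r)) e)))
    f-cong : ∀ {x y} → Setoid._≈_ vertices x y → f x ≡ f y
    f-cong = f′-cong _ _ refl refl
    fg′ : ∀ i a (e : colour (g i) ≡ a) → f′ (g i) a e ≡ i
    fg′ (inj₁ i) white e = cong inj₁ (trans (P.to-cong (Setoid.refl vertices)) (P.strictlyInverseˡ i))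
    fg′ (inj₁ i) black e = ⊥-elim (white≢black (trans (sym (proj₂ (P.from i))) e))
    fg′ (inj₂ i) black e = cong inj₂ (trans (Q.to-cong (Setoid.refl vertices)) (Q.strictlyInverseˡ i))
    fg′ (inj₂ i) white e = ⊥-elim (white≢black (trans (sym e) (proj₂ (Q.from i))))
    fg : ∀ i → f (g i) ≡ i
    fg i = fg′ i (colour (g i)) refl
    gf′ : ∀ x a (e : colour x ≡ a) → Setoid._≈_ vertices (g (f′ x a e)) x
    gf′ x white e = P.strictlyInverseʳ (x , e)
    gf′ x black e = Q.strictlyInverseʳ (x , e)
    gf : ∀ x → Setoid._≈_ vertices (g (f x)) x
    gf x = gf′ x (colour x) refl

orbits-flip : ∀ {m} (π : Permutation′ m) → Inverse (cycles (Perm.flip π)) (cycles π)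
orbits-flip π = orbits-inverse {f = π ⟨$⟩ˡ_} {g = π ⟨$⟩ʳ_} (λ x → x) (λ x → x)
  (λ x → EqC.return (Perm.inverseʳ π)) (λ x → EqC.return (Perm.inverseˡ π)) (λ _ → refl) (λ _ → ~refl)

shade : Bool → Colour
shade true = white
shade false = black

shade-injects : Injects shade
shade-injects {true} {true} _ = refl
shade-injects {false} {false} _ = refl

module ColourCount {M : RootedMap} {n} {π : Permutation′ (suc n)} (R : RealisesB M π) (c : ProperColouring M)
    (root-white : ProperColouring.colour c (RootedMap.rootVertex M) ≡ white) where
  open RootedMap M
  open ProperColouring c
  open RealisesB R
  open Colouring c

  w-white : ∀ i → hue (w i) ≡ white
  w-white = rotate-onto (trans (cong (colour ∘ cellAt σ) w-root) root-white) λ j p → begin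
    hue (w (rotate j))                 ≡⟨ other-other _ ⟨
    other (other (hue (w (rotate j)))) ≡⟨ cong other (hue-f _) ⟨
    other (hue (f (w (rotate j))))     ≡⟨ hue-f _ ⟨
    hue (f (f (w (rotate j))))         ≡⟨ cong hue (f² j) ⟩
    hue (w j)                          ≡⟨ p ⟩
    white                            ∎
    where open ≡.≡-Reasoning

  W-shade : ∀ i b → hue (W (i , b)) ≡ shade b
  W-shade i true = w-white i
  W-shade i false = trans (hue-α (w i)) (cong other (w-white i))

  Related : Rel (Fin (suc n) × Bool) 0ℓ
  Related (i , b) (j , b′) = b ≡ b′ × EqClosure (Graph (κ b)) i j

  related : ∀ {z z′} → EqClosure (Graph σ) (W z) (W z′) → Related z z′
  related {z} {z′} p = subst₂′ (W⁻¹-W z) (W⁻¹-W z′) (EqC.gfold {S = Related} related-equivalence W⁻¹ steps p)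
    where
    W⁻¹ : Fin size → Fin (suc n) × Bool
    W⁻¹ h = proj₁ (W-surjects h)
    W⁻¹-W : ∀ z → W⁻¹ (W z) ≡ z
    W⁻¹-W z = W-injects (proj₂ (W-surjects (W z)))
    subst₂′ : ∀ {a b a′ b′} → a ≡ a′ → b ≡ b′ → Related a b → Related a′ b′
    subst₂′ refl refl r = r
    related-equivalence : IsEquivalence Related
    related-equivalence = record { refl = refl , ~refl ; sym = λ { (refl , r) → refl , ~sym r }
                                 ; trans = λ { (refl , r) (refl , r′) → refl , ~trans r r′ } }
    steps : ∀ {x y} → σ ⟨$⟩ʳ x ≡ y → Related (W⁻¹ x) (W⁻¹ y)
    steps {x} refl with W-surjects x
    ... | (i , b) , refl = subst (Related (i , b)) (sym (trans (cong W⁻¹ (W-σ i b)) (W⁻¹-W _))) (refl , EqC.return refl)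

  related⁻¹ : ∀ {b i j} → EqClosure (Graph (κ b)) i j → EqClosure (Graph σ) (W (i , b)) (W (j , b))
  related⁻¹ {b} = EqC.gmap (λ i → W (i , b)) (λ { {i} refl → W-σ i b })

  colour-inverse : ∀ b → Inverse (verticesOfColour (shade b)) (cycles (κ b))
  colour-inverse b = mkInverse {verticesOfColour (shade b)} {cycles (κ b)} to from
      (λ {x} {y} p → proj₂ (related {to x , b} {to y , b} (subst₂ (EqClosure (Graph σ)) (sym (W-to x)) (sym (W-to y)) (cell-related σ (w zero) p))))
      (λ {i} {j} p → related-cell σ (related⁻¹ {b} {i} {j} p))
      (λ i → ≡⇒~ (cong proj₁ (W-injects {_ , b} {i , b} (trans (W-to (from i)) (toHalf-cellOf σ (w zero) _)))))
      (λ x → subst (λ y → Setoid._≈_ vertices y (proj₁ x))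
        (sym (trans (cong (cellOf σ) (W-to x)) (cellOf-toHalf σ (w zero) (proj₁ x)))) (Setoid.refl vertices))
    where
    subst₂ = ≡.subst₂
    half : Setoid.Carrier (verticesOfColour (shade b)) → Fin size
    half (x , _) = toHalf σ (w zero) x
    half-shade : ∀ x → hue (half x) ≡ shade b
    half-shade (x , p) = trans (cong colour (cellOf-toHalf σ (w zero) x)) p
    split : ∀ h → hue h ≡ shade b → ∃ λ i → W (i , b) ≡ h
    split h p with W-surjects h
    ... | (i , b′) , refl with refl ← shade-injects {b′} {b} (trans (sym (W-shade i b′)) p) = i , refl
    to : Setoid.Carrier (verticesOfColour (shade b)) → Fin (suc n)
    to x = proj₁ (split (half x) (half-shade x))
    W-to : ∀ x → W (to x , b) ≡ half x
    W-to x = proj₂ (split (half x) (half-shade x))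
    from : Fin (suc n) → Setoid.Carrier (verticesOfColour (shade b))
    from i = cellOf σ (W (i , b)) , W-shade i b

  white-size : HasSize (verticesOfColour white) (cycleCount π)
  white-size = hasSize-resp (colour-inverse true) (proj₂ (cycles-size π))

  black-size : HasSize (verticesOfColour black) (cycleCount (π ∘ₚ rot n))
  black-size = hasSize-resp (colour-inverse false)
    (hasSize-resp (orbits-flip (π ∘ₚ rot n)) (proj₂ (cycles-size (π ∘ₚ rot n))))

  vertices-size : HasSize vertices (cycleCount π + cycleCount (π ∘ₚ rot n))
  vertices-size = both-colours white-size black-size

module ReadOff (M : RootedMap) (c : ProperColouring M)
    (root-white : ProperColouring.colour c (RootedMap.rootVertex M) ≡ white)
    (one-face : Unicellular M) {n} (edges-n : HasSize (RootedMap.edges M) (suc n)) where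
  open RootedMap M
  open ProperColouring c
  open Colouring c

  size-double : size ≡ suc n * 2
  size-double = Pairs.pairs-double α α-involutive α-fixfree edges-n

  h₀ : Fin size
  h₀ = proj₁ (cornerHalf root (subst Fin (sym size-double) zero))

  h₀-root : corner h₀ ≡ root
  h₀-root = proj₂ (cornerHalf root (subst Fin (sym size-double) zero))

  h₀-white : hue h₀ ≡ white
  h₀-white = trans (cong (colour ∘ cellAt σ) h₀-root) root-white

  -- The inverse of the face permutation. Each step changes the colour, so its square preserves
  -- white; as there is only one face, the square runs through all white half-edges.
  u : Fin size → Fin size
  u x = α ⟨$⟩ʳ (σ ⟨$⟩ˡ x)

  f : Fin size → Fin size
  f x = σ ⟨$⟩ʳ (α ⟨$⟩ʳ x)

  fu : ∀ x → f (u x) ≡ x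
  fu x = trans (cong (σ ⟨$⟩ʳ_) (α-involutive _)) (Perm.inverseʳ σ)

  uf : ∀ x → u (f x) ≡ x
  uf x = trans (cong (α ⟨$⟩ʳ_) (Perm.inverseˡ σ)) (α-involutive x)

  u-injects : Injects u
  u-injects {x} {y} p = trans (sym (fu x)) (trans (cong f p) (fu y))

  hue-σ⁻¹ : ∀ x → hue (σ ⟨$⟩ˡ x) ≡ hue x
  hue-σ⁻¹ x = trans (sym (hue-σ _)) (cong hue (Perm.inverseʳ σ))

  hue-u : ∀ x → hue (u x) ≡ other (hue x)
  hue-u x = trans (hue-α _) (cong other (hue-σ⁻¹ x))

  u² : Fin size → Fin size
  u² x = u (u x)

  w : Fin (suc n) → Fin size
  w i = fold h₀ u² (toℕ i)

  u²-white : ∀ k → hue (fold h₀ u² k) ≡ white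
  u²-white zero = h₀-white
  u²-white (suc k) = trans (hue-u _) (trans (cong other (hue-u _)) (trans (other-other _) (u²-white k)))

  unfold : ∀ k x → fold (fold x f k) u k ≡ x
  unfold zero x = refl
  unfold (suc k) x = trans (sym (fold-suc u (f (fold x f k)) k))
    (trans (cong (λ y → fold y u k) (uf _)) (unfold k x))

  abstract
    reached : ∀ h → ∃ λ k → k < suc n * 2 × fold h₀ u k ≡ h
    reached h with k , k< , e ← Orbit.reaches-< f (perm-injects (α ∘ₚ σ))
          (Orbit.~⇒reaches f (perm-injects (α ∘ₚ σ)) (one-cell⁻¹ (α ∘ₚ σ) one-face h h₀)) =
      k , subst (k <_) size-double k< , trans (cong (λ x → fold x u k) (sym e)) (unfold k h)

    white-listed : ∀ h → hue h ≡ white → ∃ λ i → w i ≡ h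
    white-listed h p = listed (reached h)
      where
      parity : ∀ k → fold h₀ u k ≡ h →
        (∃ λ j → j < suc n × (fold h₀ u k ≡ fold h₀ u² j ⊎ fold h₀ u k ≡ u (fold h₀ u² j))) → ∃ λ i → w i ≡ h
      parity k e (j , j< , inj₁ e′) = fromℕ< j< , trans (cong (fold h₀ u²) (Finₚ.toℕ-fromℕ< j<)) (trans (sym e′) e)
      parity k e (j , j< , inj₂ e′) = ⊥-elim (white≢black (trans (sym p) (trans (cong hue (trans (sym e) e′))
        (trans (hue-u _) (cong other (u²-white j))))))
      listed : (∃ λ k → k < suc n * 2 × fold h₀ u k ≡ h) → ∃ λ i → w i ≡ h
      listed (k , k< , e) = parity k e (even-odd h₀ u k (suc n) k<)

  W : Fin (suc n) × Bool → Fin size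
  W = spread (α ⟨$⟩ʳ_) w

  W-surjects : ∀ h → ∃ λ z → W z ≡ h
  W-surjects h = by (hue h) refl
    where
    by : ∀ a → hue h ≡ a → ∃ λ z → W z ≡ h
    by white p with i , e ← white-listed h p = (i , true) , e
    by black p with i , e ← white-listed (α ⟨$⟩ʳ h) (trans (hue-α h) (cong other p)) =
      (i , false) , trans (cong (α ⟨$⟩ʳ_) e) (α-involutive h)

  W-injects : Injects W
  W-injects = surjects⇒injects′ (double-fin (suc n)) size-double W W-surjects

  w-injects : Injects w
  w-injects p = cong proj₁ (W-injects {_ , true} {_ , true} p)

  w-rotate : ∀ j → w (rotate j) ≡ u² (w j)
  w-rotate j = by (last-or j)
    where
    wrap : toℕ j ≡ n → (∃ λ i → w i ≡ u² (w j)) → w (rotate j) ≡ u² (w j)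
    wrap eq (zero , e) = trans (cong w (rotate-last eq)) e
    -- The list closes up at its beginning: a later place would make the half-edge in front of it
    -- equal to the last one, against injectivity.
    wrap eq (suc i , e) = contradiction (trans (cong toℕ (w-injects {inject₁ i} {j}
        (trans (cong (fold h₀ u²) (Finₚ.toℕ-inject₁ i)) (u-injects (u-injects e))))) eq)
      (ℕₚ.<⇒≢ (subst (_< n) (sym (Finₚ.toℕ-inject₁ i)) (Finₚ.toℕ<n i)))
    by : toℕ j < n ⊎ toℕ j ≡ n → w (rotate j) ≡ u² (w j)
    by (inj₁ lt) = cong (fold h₀ u²) (rotate-suc lt)
    by (inj₂ eq) = wrap eq (white-listed (u² (w j)) (u²-white (suc (toℕ j))))

  σ-white : ∀ i → ∃ λ j → w j ≡ σ ⟨$⟩ʳ w i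
  σ-white i = white-listed (σ ⟨$⟩ʳ w i) (trans (hue-σ _) (u²-white (toℕ i)))

  π : Permutation′ (suc n)
  π = injection⇒permutation (proj₁ ∘ σ-white) λ {i} {j} p → w-injects (perm-injects σ
    (trans (sym (proj₂ (σ-white i))) (trans (cong w p) (proj₂ (σ-white j)))))

  realises : RealisesB M π
  realises = record
    { w = w ; w-root = h₀-root ; w-σ = λ i → sym (proj₂ (σ-white i))
    ; b-σ = λ i → begin
        f (w (rotate (π ⟨$⟩ʳ i)))  ≡⟨ cong f (w-rotate _) ⟩
        f (u² (w (π ⟨$⟩ʳ i)))      ≡⟨ fu _ ⟩
        u (w (π ⟨$⟩ʳ i))           ≡⟨ cong u (proj₂ (σ-white i)) ⟩
        u (σ ⟨$⟩ʳ w i)             ≡⟨ cong (α ⟨$⟩ʳ_) (Perm.inverseˡ σ) ⟩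
        α ⟨$⟩ʳ w i                 ∎
    ; W-injects = W-injects
    ; W-surjects = W-surjects }
    where open ≡.≡-Reasoning

module Draw {n} (π : Permutation′ (suc n)) where

  E : (Fin (suc n) × Bool) ↔ Fin (suc n * 2)
  E = double-fin (suc n)

  open Inverse E using () renaming (to to ε; from to ε⁻¹; strictlyInverseˡ to εε⁻¹; strictlyInverseʳ to ε⁻¹ε)

  κ : Bool → Permutation′ (suc n)
  κ true = π
  κ false = Perm.flip (π ∘ₚ rot n)

  σᴴ : (Fin (suc n) × Bool) ↔ (Fin (suc n) × Bool)
  σᴴ = mk↔ₛ′ (λ (i , b) → κ b ⟨$⟩ʳ i , b) (λ (i , b) → κ b ⟨$⟩ˡ i , b)
    (λ (i , b) → cong (_, b) (Perm.inverseʳ (κ b))) (λ (i , b) → cong (_, b) (Perm.inverseˡ (κ b)))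

  σ : Permutation′ (suc n * 2)
  σ = E ↔-∘ (σᴴ ↔-∘ ↔-sym E)

  flipᴴ : Fin (suc n * 2) → Fin (suc n * 2)
  flipᴴ h = let i , b = ε⁻¹ h in ε (i , not b)

  flip-ε : ∀ i b → flipᴴ (ε (i , b)) ≡ ε (i , not b)
  flip-ε i b = cong (λ (i , b) → ε (i , not b)) (ε⁻¹ε (i , b))

  flip-involutive : ∀ h → flipᴴ (flipᴴ h) ≡ h
  flip-involutive h = let i , b = ε⁻¹ h in
    trans (flip-ε i (not b)) (trans (cong (λ b → ε (i , b)) (Boolₚ.not-involutive b)) (εε⁻¹ h))

  α : Permutation′ (suc n * 2)
  α = involution flipᴴ flip-involutive

  σ-ε : ∀ i b → σ ⟨$⟩ʳ ε (i , b) ≡ ε (κ b ⟨$⟩ʳ i , b)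
  σ-ε i b = cong (λ (i , b) → ε (κ b ⟨$⟩ʳ i , b)) (ε⁻¹ε (i , b))

  not-fixed : ∀ b → not b ≢ b
  not-fixed true ()
  not-fixed false ()

  fixfree : ∀ h → flipᴴ h ≢ h
  fixfree h p = not-fixed (proj₂ (ε⁻¹ h)) (trans (cong proj₂ (sym (ε⁻¹ε (proj₁ (ε⁻¹ h) , not (proj₂ (ε⁻¹ h))))))
    (cong (proj₂ ∘ ε⁻¹) p))

  f : Fin (suc n * 2) → Fin (suc n * 2)
  f h = σ ⟨$⟩ʳ flipᴴ h

  f-ε : ∀ i b → f (ε (i , b)) ≡ ε (κ (not b) ⟨$⟩ʳ i , not b)
  f-ε i b = trans (cong (σ ⟨$⟩ʳ_) (flip-ε i b)) (σ-ε i (not b))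

  private
    _~_ = EqClosure (Step f)

  to-white : ∀ i → ε (i , false) ~ ε (π ⟨$⟩ʳ i , true)
  to-white i = EqC.return (f-ε i false)

  -- Over two steps of the face `π` cancels and only the rotation remains, so every permutation
  -- yields a map with a single face.
  white-step : ∀ j → ε (rotate j , true) ~ ε (j , true)
  white-step j = ~trans (EqC.return (f-ε (rotate j) true)) (~trans (to-white _) (≡⇒~ (cong (λ i → ε (i , true)) (begin
    π ⟨$⟩ʳ (κ false ⟨$⟩ʳ rotate j)  ≡⟨ rotate-injects (Perm.inverseʳ (π ∘ₚ rot n)) ⟩
    j                               ∎))))
    where open ≡.≡-Reasoning

  to-zero : ∀ i → ε (i , true) ~ ε (zero , true)
  to-zero = rotate-onto {P = λ i → ε (i , true) ~ ε (zero , true)} ~refl λ j p → ~trans (white-step j) p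

  f-connected : Connected (Step f)
  f-connected x y = ~trans (path x) (~sym (path y))
    where
    path′ : ∀ z → ε z ~ ε (zero , true)
    path′ (i , true) = to-zero i
    path′ (i , false) = ~trans (to-white i) (to-zero (π ⟨$⟩ʳ i))
    path : ∀ x → x ~ ε (zero , true)
    path x = subst (_~ _) (εε⁻¹ x) (path′ (ε⁻¹ x))

  M : RootedMap
  M = record
    { size = suc n * 2 ; σ = σ ; α = α ; α-involutive = flip-involutive ; α-fixfree = fixfree
    ; transitive = λ x y → EqC.fold {S = EqClosure (Graph σ ∪ Graph α)} {R = Step f} EqC-isEquivalence
        (λ { {x} refl → ~trans {y = flipᴴ x} (EqC.return (inj₂ refl)) (EqC.return (inj₁ refl)) }) (f-connected x y)
    ; root = ε (zero , true) }

  colouring : ProperColouring M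
  colouring = record
    { colouring = record
        { to = shade ∘ proj₂ ∘ ε⁻¹
        ; cong = EqC.gfold ≡.isEquivalence (shade ∘ proj₂ ∘ ε⁻¹)
            λ { {h} refl → cong (shade ∘ proj₂) (sym (ε⁻¹ε (κ (proj₂ (ε⁻¹ h)) ⟨$⟩ʳ proj₁ (ε⁻¹ h) , proj₂ (ε⁻¹ h)))) } }
    ; proper = λ h p → not-fixed (proj₂ (ε⁻¹ h)) (sym (trans (shade-injects p)
        (cong proj₂ (ε⁻¹ε (proj₁ (ε⁻¹ h) , not (proj₂ (ε⁻¹ h))))))) }

  root-white : ProperColouring.colour colouring (RootedMap.rootVertex M) ≡ white
  root-white = cong (shade ∘ proj₂) (ε⁻¹ε (zero , true))

  one-face : Unicellular M
  one-face = one-cell (α ∘ₚ σ) f-connected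

  edges-size : HasSize (RootedMap.edges M) (suc n)
  edges-size = Pairs.double-pairs α flip-involutive fixfree refl

  realises : RealisesB M π
  realises = record
    { w = λ i → ε (i , true) ; w-root = refl ; w-σ = λ i → σ-ε i true
    ; b-σ = λ i → begin
        f (ε (rotate (π ⟨$⟩ʳ i) , true))                ≡⟨ f-ε _ true ⟩
        ε (κ false ⟨$⟩ʳ rotate (π ⟨$⟩ʳ i) , false)      ≡⟨ cong (λ i → ε (i , false)) (Perm.inverseˡ (π ∘ₚ rot n)) ⟩
        ε (i , false)                                   ≡⟨ flip-ε i true ⟨
        flipᴴ (ε (i , true))                            ∎
    ; W-injects = λ {z} {z′} p → ↔-injects E {z} {z′} (trans (sym (W≡ z)) (trans p (W≡ z′)))
    ; W-surjects = λ h → ε⁻¹ h , trans (W≡ (ε⁻¹ h)) (εε⁻¹ h) }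
    where
    open ≡.≡-Reasoning
    W≡ : ∀ z → spread flipᴴ (λ i → ε (i , true)) z ≡ ε z
    W≡ (i , true) = refl
    W≡ (i , false) = flip-ε i true

-- Counting

-- The ratio (n - k) / (k + 1) of neighbouring binomial coefficients, written without subtraction or
-- division.
binomial-shift : ∀ n k → suc k * (n C suc k) + k * (n C k) ≡ n * (n C k)
binomial-shift zero zero = refl
binomial-shift zero (suc k) = cong₂ _+_ (ℕₚ.*-zeroʳ (suc (suc k))) (ℕₚ.*-zeroʳ (suc k))
binomial-shift (suc n) zero =
  trans (ℕₚ.+-identityʳ _) (trans (ℕₚ.+-identityʳ _) (trans (nC1≡n (suc n)) (sym (ℕₚ.*-identityʳ (suc n)))))
binomial-shift (suc n) (suc k) = begin
  suc (suc k) * (suc n C suc (suc k)) + suc k * (suc n C suc k)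
    ≡⟨ cong₂ (λ a b → suc (suc k) * a + suc k * b) (nCk+nC[k+1]≡[n+1]C[k+1] n (suc k)) (nCk+nC[k+1]≡[n+1]C[k+1] n k) ⟨
  suc (suc k) * (n C suc k + n C suc (suc k)) + suc k * (n C k + n C suc k)
    ≡⟨ regroup k (n C k) (n C suc k) (n C suc (suc k)) ⟩
  (suc (suc k) * (n C suc (suc k)) + suc k * (n C suc k)) + (n C k + n C suc k) + (suc k * (n C suc k) + k * (n C k))
    ≡⟨ cong₂ (λ a b → a + (n C k + n C suc k) + b) (binomial-shift n (suc k)) (binomial-shift n k) ⟩
  n * (n C suc k) + (n C k + n C suc k) + n * (n C k)
    ≡⟨ collect n (n C k) (n C suc k) ⟩
  suc n * (n C k + n C suc k)
    ≡⟨ cong (suc n *_) (nCk+nC[k+1]≡[n+1]C[k+1] n k) ⟩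
  suc n * (suc n C suc k) ∎
  where
  open ≡.≡-Reasoning
  regroup : ∀ k a b c → suc (suc k) * (b + c) + suc k * (a + b) ≡
    (suc (suc k) * c + suc k * b) + (a + b) + (suc k * b + k * a)
  regroup = solve-∀
  collect : ∀ n a b → n * b + (a + b) + n * a ≡ suc n * (a + b)
  collect = solve-∀

-- The number of forests with h trees and u nodes in all.
ballot : ℕ → ℕ → ℕ
ballot zero zero = 1
ballot zero (suc u) = 0
ballot (suc h) zero = ballot h zero
ballot (suc h) (suc u) = ballot h (suc u) + ballot (suc (suc h)) u

ballot-zero : ∀ h → ballot h 0 ≡ 1
ballot-zero zero = refl
ballot-zero (suc h) = ballot-zero h

-- The reflection formula for ballot numbers with the subtracted binomial moved to the other side.
-- Pascal's rule, applied to both binomials, matches the recursion of `ballot`.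
ballot-binomial : ∀ u h → ballot h (suc u) + (u * 2 + suc h) C u ≡ (u * 2 + suc h) C suc u
-- There is no forest without trees but with nodes; the two binomials are the equal middle ones of
-- an odd row.
ballot-binomial u zero = begin
  (u * 2 + 1) C u                          ≡⟨ nCk≡nC[n∸k] (ℕₚ.≤-trans (ℕₚ.m≤m+n u (u + 1)) (ℕₚ.≤-reflexive (sym (double u)))) ⟩
  (u * 2 + 1) C (u * 2 + 1 ∸ u)            ≡⟨ cong (λ m → (u * 2 + 1) C (m ∸ u)) (double u) ⟩
  (u * 2 + 1) C (u + (u + 1) ∸ u)          ≡⟨ cong ((u * 2 + 1) C_) (ℕₚ.m+n∸m≡n u (u + 1)) ⟩
  (u * 2 + 1) C (u + 1)                    ≡⟨ cong ((u * 2 + 1) C_) (ℕₚ.+-comm u 1) ⟩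
  (u * 2 + 1) C suc u                      ∎
  where
  open ≡.≡-Reasoning
  double : ∀ u → u * 2 + 1 ≡ u + (u + 1)
  double = solve-∀
ballot-binomial zero (suc h) = begin
  ballot h 1 + ballot h 0 + suc (suc h) C 0        ≡⟨ cong (λ b → ballot h 1 + b + 1) (ballot-zero h) ⟩
  ballot h 1 + 1 + 1                               ≡⟨ cong (_+ 1) (ballot-binomial zero h) ⟩
  suc h C 1 + 1                                    ≡⟨ ℕₚ.+-comm (suc h C 1) 1 ⟩
  suc h C 0 + suc h C 1                            ≡⟨ nCk+nC[k+1]≡[n+1]C[k+1] (suc h) 0 ⟩
  suc (suc h) C 1                                  ∎
  where open ≡.≡-Reasoning
ballot-binomial (suc u) (suc h) = begin
  b₁ + b₂ + N′ C suc u                    ≡⟨ cong (λ n → b₁ + b₂ + n C suc u) N′≡ ⟩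
  b₁ + b₂ + suc N C suc u                 ≡⟨ cong (b₁ + b₂ +_) (nCk+nC[k+1]≡[n+1]C[k+1] N u) ⟨
  b₁ + b₂ + (N C u + N C suc u)           ≡⟨ regroup b₁ b₂ (N C u) (N C suc u) ⟩
  (b₂ + N C u) + (b₁ + N C suc u)         ≡⟨ cong₂ _+_ (ballot-binomial u (suc (suc h)))
                                               (subst (λ n → b₁ + n C suc u ≡ n C suc (suc u)) N≡ (ballot-binomial (suc u) h)) ⟩
  N C suc u + N C suc (suc u)             ≡⟨ nCk+nC[k+1]≡[n+1]C[k+1] N (suc u) ⟩
  suc N C suc (suc u)                     ≡⟨ cong (_C suc (suc u)) N′≡ ⟨
  N′ C suc (suc u)                        ∎
  where
  open ≡.≡-Reasoning
  b₁ = ballot h (suc (suc u))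
  b₂ = ballot (suc (suc h)) (suc u)
  N = u * 2 + suc (suc (suc h))
  N′ = suc u * 2 + suc (suc h)
  N′≡ : N′ ≡ suc N
  N′≡ = lemma u h
    where
    lemma : ∀ u h → suc u * 2 + suc (suc h) ≡ suc (u * 2 + suc (suc (suc h)))
    lemma = solve-∀
  N≡ : suc u * 2 + suc h ≡ N
  N≡ = lemma u h
    where
    lemma : ∀ u h → suc u * 2 + suc h ≡ u * 2 + suc (suc (suc h))
    lemma = solve-∀
  regroup : ∀ a b c d → a + b + (c + d) ≡ (b + c) + (a + d)
  regroup = solve-∀

ballot-cat : ∀ n → ballot 1 n ≡ Cat n
ballot-cat zero = refl
ballot-cat (suc u) = sym (trans (cong (_/ suc (suc u)) (sym exact)) (m*n/n≡m b (suc (suc u))))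
  where
  open ≡.≡-Reasoning
  b = ballot 1 (suc u)
  N = 2 * suc u
  N≡ : u * 2 + 2 ≡ N
  N≡ = lemma u
    where
    lemma : ∀ u → u * 2 + 2 ≡ 2 * suc u
    lemma = solve-∀
  X = N C u
  Y = N C suc u
  b+X : b + X ≡ Y
  b+X = subst (λ n → b + n C u ≡ n C suc u) N≡ (ballot-binomial u 1)
  shift : suc u * Y ≡ suc (suc u) * X
  shift = ℕₚ.+-cancelʳ-≡ (u * X) _ _ (trans (binomial-shift N u) (lemma u X))
    where
    lemma : ∀ u X → 2 * suc u * X ≡ suc (suc u) * X + u * X
    lemma = solve-∀
  -- With b = Y - X and (u + 2) X = (u + 1) Y, the product (u + 2) b equals Y, so the division in
  -- `Cat` is exact.
  exact : b * suc (suc u) ≡ Y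
  exact = ℕₚ.+-cancelʳ-≡ (suc u * Y) _ _ (begin
    b * suc (suc u) + suc u * Y          ≡⟨ cong (b * suc (suc u) +_) shift ⟩
    b * suc (suc u) + suc (suc u) * X    ≡⟨ lemma u b X ⟩
    suc (suc u) * (b + X)                ≡⟨ cong (suc (suc u) *_) b+X ⟩
    Y + suc u * Y                        ∎)
    where
    lemma : ∀ u b X → b * suc (suc u) + suc (suc u) * X ≡ suc (suc u) * (b + X)
    lemma = solve-∀

total : ∀ {h} → Vec Bin h → ℕ
total [] = 0
total (t ∷ ts) = nodes t + total ts

Forest : ℕ → ℕ → Set
Forest h u = Σ (Vec Bin h) λ ts → total ts ≡ u

forest-≡ : ∀ {h u} {F G : Forest h u} → proj₁ F ≡ proj₁ G → F ≡ G
forest-≡ {F = ts , p} {.ts , q} refl = cong (ts ,_) (ℕₚ.≡-irrelevant p q)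

-- The recursion of `ballot` on forests: a leaf in front is removed, and a node in front is replaced
-- by its two subtrees, which gives one tree more and one node less.
forest-fin : ∀ u h → Forest h u ↔ Fin (ballot h u)
forest-fin zero zero = mk↔ₛ′ (λ _ → zero) (λ _ → [] , refl) (λ { zero → refl }) (λ { ([] , refl) → refl })
forest-fin (suc u) zero = mk↔ₛ′ (λ { ([] , ()) }) (λ ()) (λ ()) (λ { ([] , ()) })
forest-fin zero (suc h) = forest-fin zero h ↔-∘ mk↔ₛ′
  (λ { (leaf ∷ ts , p) → ts , p ; (bin _ _ ∷ _ , ()) })
  (λ { (ts , p) → leaf ∷ ts , p }) (λ { (ts , p) → refl })
  (λ { (leaf ∷ ts , p) → refl ; (bin _ _ ∷ _ , ()) })
forest-fin (suc u) (suc h) = ↔-sym Finₚ.+↔⊎ ↔-∘ ((forest-fin (suc u) h ⊎-↔ forest-fin u (suc (suc h))) ↔-∘ mk↔ₛ′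
  (λ { (leaf ∷ ts , p) → inj₁ (ts , p)
     ; (bin f g ∷ ts , p) → inj₂ (f ∷ g ∷ ts , trans (sym (ℕₚ.+-assoc (nodes f) (nodes g) (total ts))) (ℕₚ.suc-injective p)) })
  (λ { (inj₁ (ts , p)) → leaf ∷ ts , p
     ; (inj₂ (f ∷ g ∷ ts , p)) → bin f g ∷ ts , cong suc (trans (ℕₚ.+-assoc (nodes f) (nodes g) (total ts)) p) })
  (λ { (inj₁ (ts , p)) → refl ; (inj₂ (f ∷ g ∷ ts , p)) → cong inj₂ (forest-≡ refl) })
  (λ { (leaf ∷ ts , p) → refl ; (bin f g ∷ ts , p) → forest-≡ refl }))

trees-size : ∀ n → HasSize (Restrict (≡.setoid Bin) (λ t → nodes t ≡ n)) (Cat n)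
trees-size n = subst (HasSize _) (ballot-cat n) (hasSize-resp
  (mkInverse {Restrict (≡.setoid Bin) (λ t → nodes t ≡ n)} {≡.setoid (Forest 1 n)}
    (λ (t , p) → t ∷ [] , trans (ℕₚ.+-identityʳ _) p) (λ { (t ∷ [] , p) → t , trans (sym (ℕₚ.+-identityʳ _)) p })
    (λ { refl → forest-≡ refl }) (λ { refl → refl }) (λ { (t ∷ [] , p) → forest-≡ refl }) (λ _ → refl))
  (forest-fin n 1))

-- Finiteness of the codes and comparison with both families

cycleCount-cong : ∀ {m} {π ρ : Permutation′ m} → π Perm.≈ ρ → cycleCount π ≡ cycleCount ρ
cycleCount-cong {π = π} {ρ} eq =
  cycleCount-unique π (hasSize-resp (orbits-resp {f = π ⟨$⟩ʳ_} {ρ ⟨$⟩ʳ_} eq) (proj₂ (cycles-size ρ)))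

permutations : ℕ → Setoid 0ℓ 0ℓ
permutations k = record
  { Carrier = Permutation′ k ; _≈_ = Perm._≈_
  ; isEquivalence = record { refl = λ _ → refl ; sym = λ p i → sym (p i) ; trans = λ p q i → trans (p i) (q i) } }

-- All k^k functions are enumerated; those that are not injective or fail `P` become gaps. `P` must
-- respect pointwise equality because a permutation is recovered from its function only up to it.
finite-permutations : ∀ k (P : Permutation′ k → Set) → (∀ π → Dec (P π)) →
  (∀ {π ρ} → π Perm.≈ ρ → P π → P ρ) → ∃ (HasSize (Restrict (permutations k) P))
finite-permutations k P P? resp = enumerable⇒hasSize (k ^ k) (Restrict (permutations k) P)
    (λ (π , _) (ρ , _) → Finₚ.all? λ i → π ⟨$⟩ʳ i Finₚ.≟ ρ ⟨$⟩ʳ i)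
    (λ i → pick (finToFun i)) covers
  where
  Inj : (Fin k → Fin k) → Set
  Inj f = ∀ x y → f x ≡ f y → x ≡ y
  inj? : ∀ f → Dec (Inj f)
  inj? f = Finₚ.all? λ x → Finₚ.all? λ y → (f x Finₚ.≟ f y) →-dec (x Finₚ.≟ y)
  check : ∀ π → Dec (P π) → Maybe (Σ _ P)
  check π (yes p) = just (π , p)
  check π (no _) = nothing
  build : ∀ f → Dec (Inj f) → Maybe (Σ _ P)
  build f (yes inj) = let π = injection⇒permutation f (λ {x} {y} → inj x y) in check π (P? π)
  build f (no _) = nothing
  pick : (Fin k → Fin k) → Maybe (Σ _ P)
  pick f = build f (inj? f)
  check-just : ∀ π (d : Dec (P π)) → P π → ∃ λ p → check π d ≡ just (π , p)
  check-just π (yes p) _ = p , refl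
  check-just π (no ¬p) p = ⊥-elim (¬p p)
  build-just : ∀ π f → f ≡.≗ (π ⟨$⟩ʳ_) → P π → (d : Dec (Inj f)) → ∃ λ x → build f d ≡ just x × proj₁ x Perm.≈ π
  build-just π f eq p (yes inj) =
    let ρ = injection⇒permutation f (λ {x} {y} → inj x y)
        q , e = check-just ρ (P? ρ) (resp {π} {ρ} (λ i → sym (eq i)) p)
    in (ρ , q) , e , eq
  build-just π f eq p (no ¬inj) = ⊥-elim (¬inj λ x y q → perm-injects π (trans (sym (eq x)) (trans q (eq y))))
  covers : ∀ (s : Σ (Permutation′ k) P) → ∃₂ λ i x → pick (finToFun i) ≡ just x × proj₁ x Perm.≈ proj₁ s
  covers (π , p) = funToFin (π ⟨$⟩ʳ_) , build-just π _ (Finₚ.finToFun-funToFin (π ⟨$⟩ʳ_)) p (inj? _)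

-- Q is a condition on the numbers of vertices and faces of a covered map, and at the same time on
-- the numbers of white and black vertices of a bipartite unicellular map.
module Count (n : ℕ) (Q : ℕ → ℕ → Set) (Q? : ∀ v f → Dec (Q v f)) where

  QPerm : Permutation′ (suc n) → Set
  QPerm π = Q (cycleCount π) (cycleCount (π ∘ₚ rot n))

  permCodes : Setoid 0ℓ 0ℓ
  permCodes = Restrict (permutations (suc n)) QPerm

  trees : Setoid 0ℓ 0ℓ
  trees = Restrict (≡.setoid Bin) (λ t → nodes t ≡ n)

  permCodes-size : ∃ (HasSize permCodes)
  permCodes-size = finite-permutations (suc n) QPerm (λ π → Q? _ _)
    (λ {π} {ρ} eq → ≡.subst₂ Q (cycleCount-cong {π = π} {ρ} eq)
      (cycleCount-cong {π = π ∘ₚ rot n} {ρ ∘ₚ rot n} (λ i → cong rotate (eq i))))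

  b : ℕ
  b = proj₁ permCodes-size

  codes : Setoid 0ℓ 0ℓ
  codes = record
    { Carrier = Setoid.Carrier trees × Setoid.Carrier permCodes
    ; _≈_ = λ (t , π) (t′ , π′) → Setoid._≈_ trees t t′ × Setoid._≈_ permCodes π π′
    ; isEquivalence = record
        { refl = λ {x} → Setoid.refl trees {proj₁ x} , Setoid.refl permCodes {proj₂ x}
        ; sym = λ {x} {y} (p , q) → Setoid.sym trees {proj₁ x} {proj₁ y} p , Setoid.sym permCodes {proj₂ x} {proj₂ y} q
        ; trans = λ {x} {y} {z} (p , q) (p′ , q′) → Setoid.trans trees {proj₁ x} {proj₁ y} {proj₁ z} p p′
            , Setoid.trans permCodes {proj₂ x} {proj₂ y} {proj₂ z} q q′ } }

  codes-size : HasSize codes (Cat n * b)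
  codes-size = hasSize-resp (mkInverse {codes} {≡.setoid (Fin (Cat n) × Fin b)}
      (λ (t , π) → T.to t , P.to π) (λ (i , j) → T.from i , P.from j)
      (λ (p , q) → cong₂ _,_ (T.to-cong p) (P.to-cong q))
      (λ { {x} refl → Setoid.refl codes {T.from (proj₁ x) , P.from (proj₂ x)} })
      (λ (i , j) → cong₂ _,_ (T.strictlyInverseˡ i) (P.strictlyInverseˡ j))
      (λ (t , π) → T.strictlyInverseʳ t , P.strictlyInverseʳ π))
    (↔-sym Finₚ.*↔×)
    where
    module T = Inverse (trees-size n)
    module P = Inverse (proj₂ permCodes-size)

  module _ (P : CoveredMap → Set)
      (P⇒edges : ∀ A → P A → HasSize (RootedMap.edges (CoveredMap.map A)) n)
      (P⇒Q : ∀ A {v f} → P A → HasSize (RootedMap.vertices (CoveredMap.map A)) v →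
        HasSize (RootedMap.faces (CoveredMap.map A)) f → Q v f)
      (Q⇒P : ∀ A {v f} → HasSize (RootedMap.edges (CoveredMap.map A)) n →
        HasSize (RootedMap.vertices (CoveredMap.map A)) v →
        HasSize (RootedMap.faces (CoveredMap.map A)) f → Q v f → P A) where

    covered-size : HasSize (Restrict coveredMaps P) (Cat n * b)
    covered-size = hasSize-via {Restrict coveredMaps P} {codes}
      (λ (A , _) ((t , eq) , (π , _)) → Covered.RealisesA A {t = t} eq π)
      (λ (A , p) → let t , eq , π , R = Covered.realised A (P⇒edges A p) in
        ((t , eq) , (π , P⇒Q A p (Covered.realised-vertices A R) (Covered.realised-faces A R))) , R)
      (λ ((t , eq) , (π , q)) → let A = Glue.glued {t = t} eq π ; R = Glue.glued-realises {t = t} eq π in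
        (A , Q⇒P A (Covered.double-edges A refl) (Covered.realised-vertices A R) (Covered.realised-faces A R) q) , R)
      (λ {s} {s′} R R′ i → covered-code-unique {proj₁ s} {proj₁ s′} R R′ i)
      (λ {s} {s′} {c} {c′} R R′ (p , q) → go {s} {s′} {c} {c′} R R′ p q)
      codes-size
      where
      go : ∀ {s s′ : Σ CoveredMap P} {c c′ : Setoid.Carrier codes} →
        Covered.RealisesA (proj₁ s) {t = proj₁ (proj₁ c)} (proj₂ (proj₁ c)) (proj₁ (proj₂ c)) →
        Covered.RealisesA (proj₁ s′) {t = proj₁ (proj₁ c′)} (proj₂ (proj₁ c′)) (proj₁ (proj₂ c′)) →
        proj₁ (proj₁ c) ≡ proj₁ (proj₁ c′) → proj₁ (proj₂ c) Perm.≈ proj₁ (proj₂ c′) → proj₁ s ≅ᶜ proj₁ s′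
      go {s} {s′} {(t , eq) , _} {(t , eq′) , _} R R′ refl q with refl ← ℕₚ.≡-irrelevant eq eq′ =
        same-code-covered {proj₁ s} {proj₁ s′} q R R′

  module _ (P : RootedMap → Set)
      (P⇒map : ∀ M → P M → Unicellular M × HasSize (RootedMap.edges M) (suc n) ×
        Σ (ProperColouring M) λ c → ProperColouring.colour c (RootedMap.rootVertex M) ≡ white)
      (P⇒Q : ∀ M {π} → P M → RealisesB M π → QPerm π)
      (Q⇒P : ∀ π → QPerm π → P (Draw.M π)) where

    bipartite-size : HasSize (Restrict maps P) b
    bipartite-size = hasSize-via {Restrict maps P} {permCodes}
      (λ (M , _) (π , _) → RealisesB M π)
      (λ (M , p) → read M p (P⇒map M p))
      (λ (π , q) → (Draw.M π , Q⇒P π q) , Draw.realises π)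
      (λ R R′ i → bipartite-code-unique R R′ i)
      (λ R R′ eq → same-code-bipartite R R′ eq)
      (proj₂ permCodes-size)
      where
      read : ∀ M → P M → _ → Σ (Setoid.Carrier permCodes) λ (π , _) → RealisesB M π
      read M p (one , e , c , rw) = (ReadOff.π M c rw one e , P⇒Q M p R) , R
        where R = ReadOff.realises M c rw one e

-- Counting by genus leaves the choice between the two colourings open, while codes presuppose a
-- white root vertex; exchanging the colours bridges the gap.
rootWhite : ∀ {M} → ProperColouring M →
  Σ (ProperColouring M) λ c → ProperColouring.colour c (RootedMap.rootVertex M) ≡ white
rootWhite {M} c = by (ProperColouring.colour c (RootedMap.rootVertex M)) refl
  where
  open ProperColouring c
  other-injects : Injects other
  other-injects {a} {b} p = trans (sym (other-other a)) (trans (cong other p) (other-other b))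
  by : ∀ a → colour (RootedMap.rootVertex M) ≡ a →
    Σ (ProperColouring M) λ c → ProperColouring.colour c (RootedMap.rootVertex M) ≡ white
  by white p = c , p
  by black p = record
    { colouring = record { to = other ∘ colour ; cong = λ q → cong other (Func.cong colouring q) }
    ; proper = λ h q → proper h (other-injects q) } , cong other p

-- The counts by genus and by numbers of cells

module ByGenus (n g : ℕ) where

  open ℤ using (+_)

  Q : ℕ → ℕ → Set
  Q v f = + v ℤ.- + n ℤ.+ + f ≡ + 2 ℤ.- + 2 ℤ.* + g

  Q? : ∀ v f → Dec (Q v f)
  Q? v f = _ ℤ.≟ _

  open Count n Q Q? public

  -- A bipartite unicellular map has n + 1 edges and one face, with v + f vertices.
  euler : ∀ v f → + (v + f) ℤ.- + suc n ℤ.+ + 1 ≡ + v ℤ.- + n ℤ.+ + f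
  euler v f = trans (cong₂ (λ a b → a ℤ.- b ℤ.+ + 1) (ℤₚ.pos-+ v f) (ℤₚ.pos-+ 1 n)) (lemma (+ v) (+ f) (+ n))
    where
    lemma : ∀ a b c → a ℤ.+ b ℤ.- (+ 1 ℤ.+ c) ℤ.+ + 1 ≡ a ℤ.- c ℤ.+ b
    lemma = ℤ-solve-∀

  hasGenus-unique : ∀ M {v e f} → HasGenus M g → HasSize (RootedMap.vertices M) v → HasSize (RootedMap.edges M) e →
    HasSize (RootedMap.faces M) f → + v ℤ.- + e ℤ.+ + f ≡ + 2 ℤ.- + 2 ℤ.* + g
  hasGenus-unique M (v , e , f , V , E , F , eq) V′ E′ F′
    with refl ← hasSize-unique V V′ | refl ← hasSize-unique E E′ | refl ← hasSize-unique F F′ = eq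

  covered : HasSize (coveredOfGenus g n) (Cat n * b)
  covered = covered-size (λ A → HasGenus (CoveredMap.map A) g × HasSize (RootedMap.edges (CoveredMap.map A)) n)
    (λ A p → proj₂ p)
    (λ A (genus , e) v f → hasGenus-unique (CoveredMap.map A) genus v e f)
    (λ A e v f q → (_ , _ , _ , v , e , f , q) , e)

  bipartite : HasSize (bipartiteOfGenus g (suc n)) b
  bipartite = bipartite-size
    (λ M → ProperColouring M × Unicellular M × HasGenus M g × HasSize (RootedMap.edges M) (suc n))
    (λ M (c , one , _ , e) → one , e , rootWhite c)
    (λ M {π} (c , one , genus , e) R → let c′ , w = rootWhite c in
      trans (sym (euler (cycleCount π) (cycleCount (π ∘ₚ rot n))))
        (hasGenus-unique M genus (ColourCount.vertices-size R c′ w) e one))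
    (λ π q → let open Draw π in colouring , one-face
      , (_ , _ , _ , ColourCount.vertices-size realises colouring root-white , edges-size , one-face
        , trans (euler (cycleCount π) (cycleCount (π ∘ₚ rot n))) q)
      , edges-size)

module ByCells (n v f : ℕ) where

  Q : ℕ → ℕ → Set
  Q v′ f′ = v′ ≡ v × f′ ≡ f

  Q? : ∀ v′ f′ → Dec (Q v′ f′)
  Q? v′ f′ = (v′ ℕₚ.≟ v) ×-dec (f′ ℕₚ.≟ f)

  open Count n Q Q? public

  covered : HasSize (coveredByCells v f n) (Cat n * b)
  covered = covered-size (λ A → let open RootedMap (CoveredMap.map A) in
      HasSize edges n × HasSize vertices v × HasSize faces f)
    (λ A p → proj₁ p)
    (λ A (_ , V , F) V′ F′ → hasSize-unique V′ V , hasSize-unique F′ F)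
    (λ { A E V F (refl , refl) → E , V , F })

  bipartite : HasSize (bipartiteByColours v f (suc n)) b
  bipartite = bipartite-size
    (λ M → Unicellular M × HasSize (RootedMap.edges M) (suc n) × Σ (ProperColouring M) λ c →
      ProperColouring.colour c (RootedMap.rootVertex M) ≡ white ×
      HasSize (ProperColouring.verticesOfColour c white) v × HasSize (ProperColouring.verticesOfColour c black) f)
    (λ M (one , e , c , w , _) → one , e , c , w)
    (λ M (_ , _ , c , w , V , F) R → hasSize-unique (ColourCount.white-size R c w) V
      , hasSize-unique (ColourCount.black-size R c w) F)
    (λ { π (p , q) → let open Draw π in one-face , edges-size , colouring , root-white
      , subst (HasSize _) p (ColourCount.white-size realises colouring root-white)
      , subst (HasSize _) q (ColourCount.black-size realises colouring root-white) })

mainTheorem3 : ((n g : ℕ) →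
    ∃ λ c → ∃ λ b →
    HasSize (coveredOfGenus g n) c ×
    HasSize (bipartiteOfGenus g (suc n)) b ×
    c ≡ Cat n * b)
    ×
    ((n v f : ℕ) → 1 ≤ v → 1 ≤ f →
    ∃ λ c → ∃ λ b →
    HasSize (coveredByCells v f n) c ×
    HasSize (bipartiteByColours v f (suc n)) b ×
    c ≡ Cat n * b)
mainTheorem3 =
    (λ n g → let open ByGenus n g in Cat n * b , b , covered , bipartite , refl)
  , (λ n v f _ _ → let open ByCells n v f in Cat n * b , b , covered , bipartite , refl)
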